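{- Let $\mu$ be a strict partition. Then for every integer $n\ge0$, $$\sum_{|\lambda/\mu|=n}\frac{2^{|\lambda|-\ell(\lambda)-|\mu|+\ell(\mu)}f_{\lambda/\mu}H_\mu}{H_\lambda}\Bigl(\sum_{\square\in\lambda}\binom{c_\square+1}{4}-\sum_{\square\in\mu}\binom{c_\square+1}{4}\Bigr)=\frac23\binom{n}{3}+\frac23|\mu|\binom{n}{2}+\frac1{12}\bigl(q_2(\mu)+|\mu|^2-2|\mu|\bigr)n,$$ where the sum ranges over strict partitions $\lambda\supseteq\mu$ with $|\lambda|-|\mu|=n$.
   Context: A strict partition is a finite strictly decreasing sequence of positive integers $\lambda=(\lambda_1>\cdots>\lambda_\ell)$ (the empty sequence is allowed); $|\lambda|=\sum_i\lambda_i$, $\ell(\lambda)=\ell$, and $\lambda_i=0$ for $i>\ell(\lambda)$. The (shifted Young) diagram of $\lambda$ is the set of boxes $(i,j)$ with $1\le i\le\ell(\lambda)$, $i+1\le j\le i+\lambda_i$ (row $i$, column $j$); $\lambda$ is identified with its diagram. The content of $\square=(i,j)$ is $c_\square=j-i$. The hook length $h_\square$ of $\square=(i,j)\in\lambda$ is the number of boxes of $\lambda$ in row $i$ strictly to the right of $\square$, plus the number of boxes $(i',j)\in\lambda$ with $i'>i$, plus $1$, plus $\lambda_j$; $H_\lambda=\prod_{\square\in\lambda}h_\square$ ($H_\emptyset=1$). Write $\lambda\supseteq\mu$ if $\lambda_i\ge\mu_i$ for all $i$; $\lambda/\mu$ is the set of boxes of $\lambda$ not in $\mu$, $|\lambda/\mu|=|\lambda|-|\mu|$.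 $f_{\lambda/\mu}$ is the number of standard shifted Young tableaux of shape $\lambda/\mu$ (bijective fillings of the boxes of $\lambda/\mu$ with $1,\dots,|\lambda/\mu|$ increasing along rows left to right and columns top to bottom; $f_{\mu/\mu}=1$). For a strict partition $\mu$: an outer corner is a box of $\mu$ whose removal leaves the diagram of a strict partition; let $(\alpha_1,\beta_1),\dots,(\alpha_m,\beta_m)$ be the outer corners with $\alpha_1>\cdots>\alpha_m$, $y_j=\beta_j-\alpha_j$; set $\alpha_{m+1}=0$, $\beta_0=\ell(\mu)+1$, $x_i=\beta_i-\alpha_{i+1}$ ($0\le i\le m$); and $q_2(\mu)=\sum_{i=0}^m\binom{x_i}{2}^2-\sum_{i=1}^m\binom{y_i}{2}^2$. -}

module Defs where

open import Data.Fin.Base as Fin using (Fin; finToFun)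
import Data.Fin.Properties as Fin
open import Data.Integer.Base as ℤ using (ℤ; +_)
open import Data.List.Base
  using (List; []; _∷_; _++_; map; concatMap; filter; foldr; length; lookup
        ; reverse; zipWith; applyUpTo; allFin)
import Data.List.Membership.DecPropositional as DecMembership
open import Data.List.Membership.Propositional using (_∈_; find; lose)
open import Data.List.Membership.Propositional.Properties
  using (∈-map⁺; ∈-map⁻; ∈-++⁺ˡ; ∈-++⁺ʳ; ∈-applyUpTo⁺; ∈-applyUpTo⁻
        ; ∈-concatMap⁺; ∈-concatMap⁻)
open import Data.List.Relation.Unary.All as All using (All; []; _∷_)
import Data.List.Relation.Unary.All.Properties as All
open import Data.List.Relation.Unary.Any as Any using (here; there)
open import Data.List.Relation.Unary.Linked as Linked using (Linked; []; [-]; _∷_)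
open import Data.Nat.Base
open import Data.Nat.Combinatorics using (_C_)
open import Data.Nat.ListAction using (sum; product)
open import Data.Nat.ListAction.Properties using (product≢0)
open import Data.Nat.Properties
  using (_≟_; _<?_; _≤?_; ≤-trans; ≤-refl; ≤∧≢⇒<; ≮⇒≥)
open import Data.Product.Base using (∃; _×_; _,_; proj₁; proj₂)
open import Data.Product.Properties using (≡-dec)
open import Data.Rational.Base as ℚ using (ℚ; 0ℚ)
open import Function.Base using (_∘_)
open import Function.Bundles using (_⇔_; mk⇔; Equivalence)
open import Function.Consequences.Propositional
  using (strictlySurjective⇒surjective; surjective⇒strictlySurjective)
open import Function.Definitions using (Bijective)
open import Relation.Binary.Definitions using (DecidableEquality)
open import Relation.Binary.PropositionalEquality
  using (_≡_; _≢_; refl; sym; subst)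
open import Relation.Nullary.Decidable
  using (Dec; yes; no; map′; ¬?; _×-dec_; _→-dec_)
open import Relation.Unary using (Decidable)

Σℚ : List ℚ → ℚ
Σℚ = foldr ℚ._+_ 0ℚ

[1⋯_] : ℕ → List ℕ
[1⋯ n ] = applyUpTo suc n

-- |λ| is sum λ and ℓ(λ) is length λ.
IsStrictPartition : List ℕ → Set
IsStrictPartition ps = Linked _>_ ps × All (0 <_) ps

isStrictPartition? : Decidable IsStrictPartition
isStrictPartition? ps =
  Linked.linked? (λ m n → n <? m) ps ×-dec All.all? (0 <?_) ps

-- part ps i is the i-th part, counted from 1, and 0 for i > ℓ.  It is also 0
-- at i = 0, which makes the case i = 0 of _⊇_ vacuous.
part : List ℕ → ℕ → ℕ
part []       _             = 0
part (p ∷ ps) zero          = 0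
part (p ∷ ps) (suc zero)    = p
part (p ∷ ps) (suc (suc i)) = part ps (suc i)

_⊇_ : List ℕ → List ℕ → Set
ps ⊇ qs = ∀ i → part qs i ≤ part ps i

-- The strict partitions with all parts at most k, each listed once.
strictUpTo : ℕ → List (List ℕ)
strictUpTo zero    = [] ∷ []
strictUpTo (suc k) = map (suc k ∷_) (strictUpTo k) ++ strictUpTo k

strictPartitions : ℕ → List (List ℕ)
strictPartitions n = filter (λ ps → sum ps ≟ n) (strictUpTo n)

∈-strictUpTo : ∀ k ps → IsStrictPartition ps → part ps 1 ≤ k → ps ∈ strictUpTo k
∈-strictUpTo zero    []       _                    _   = here refl
∈-strictUpTo zero    (p ∷ ps) (_ , 0<p ∷ _)        p≤0 with ≤-trans 0<p p≤0
... | ()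
∈-strictUpTo (suc k) []       s                    _   =
  ∈-++⁺ʳ (map (suc k ∷_) (strictUpTo k)) (∈-strictUpTo k [] s z≤n)
∈-strictUpTo (suc k) (p ∷ ps) (dec , pos@(_ ∷ pos′)) p≤ with p ≟ suc k
... | yes refl = ∈-++⁺ˡ (∈-map⁺ (suc k ∷_)
                   (∈-strictUpTo k ps (Linked.tail dec , pos′) (s≤s⁻¹ (next dec))))
  where
  next : ∀ {ps} → Linked _>_ (suc k ∷ ps) → part ps 1 < suc k
  next [-]       = s≤s z≤n
  next (q<p ∷ _) = q<p
... | no p≢ = ∈-++⁺ʳ (map (suc k ∷_) (strictUpTo k))
                (∈-strictUpTo k (p ∷ ps) (dec , pos) (s≤s⁻¹ (≤∧≢⇒< p≤ p≢)))

_⊇?_ : ∀ ps qs → Dec (ps ⊇ qs)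
ps ⊇? qs = map′ (λ h i → to qs i h) (λ h → All.applyUpTo⁺₂ suc (length qs) (h ∘ suc))
                (All.all? (λ i → part qs i ≤? part ps i) [1⋯ length qs ])
  where
  beyond : ∀ qs i → length qs ≤ i → part qs (suc i) ≡ 0
  beyond []       i       _       = refl
  beyond (q ∷ qs) (suc i) (s≤s l) = beyond qs i l

  zeroth : ∀ qs → part qs 0 ≡ 0
  zeroth []       = refl
  zeroth (q ∷ qs) = refl

  to : ∀ qs i → All (λ i → part qs i ≤ part ps i) [1⋯ length qs ] →
       part qs i ≤ part ps i
  to qs zero    h = subst (_≤ part ps 0) (sym (zeroth qs)) z≤n
  to qs (suc i) h with i <? length qs
  ... | yes i<l = All.lookup h (∈-applyUpTo⁺ suc i<l)
  ... | no  i≮l = subst (_≤ part ps (suc i)) (sym (beyond qs i (≮⇒≥ i≮l))) z≤n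

Box : Set
Box = ℕ × ℕ

row col : Box → ℕ
row = proj₁
col = proj₂

_≟ᵇ_ : DecidableEquality Box
_≟ᵇ_ = ≡-dec _≟_ _≟_

open DecMembership _≟ᵇ_ using (_∈?_)

-- The boxes (i , j) with 1 ≤ i ≤ ℓ and i + 1 ≤ j ≤ i + λᵢ, in lexicographic order.
boxes : List ℕ → List Box
boxes ps = concatMap (λ i → map (λ k → i , i + k) [1⋯ part ps i ]) [1⋯ length ps ]

∈-boxes⁺ : ∀ ps {i k} → i < length ps → k < part ps (suc i) →
           (suc i , suc i + suc k) ∈ boxes ps
∈-boxes⁺ ps {i} {k} i< k< =
  ∈-concatMap⁺ (λ i → map (λ k → i , i + k) [1⋯ part ps i ])
    (lose (∈-applyUpTo⁺ suc i<) (∈-map⁺ (λ k → suc i , suc i + k) (∈-applyUpTo⁺ suc k<)))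

∈-boxes⁻ : ∀ ps {b} → b ∈ boxes ps →
           ∃ λ i → ∃ λ k → i < length ps × k < part ps (suc i) ×
                           b ≡ (suc i , suc i + suc k)
∈-boxes⁻ ps b∈
  with find (∈-concatMap⁻ (λ i → map (λ k → i , i + k) [1⋯ part ps i ])
                          {xs = [1⋯ length ps ]} b∈)
... | i′ , i∈ , b∈row with ∈-applyUpTo⁻ suc i∈
... | i , i< , refl with ∈-map⁻ (λ k → suc i , suc i + k) b∈row
... | k′ , k∈ , refl with ∈-applyUpTo⁻ suc k∈
... | k , k< , refl = i , k , i< , k< , refl

-- Every box has row < column, so the subtraction is exact.
content : Box → ℕ
content (i , j) = j ∸ i

contentSum : List ℕ → ℕ
contentSum ps = sum (map (λ b → (content b + 1) C 4) (boxes ps))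

hook : List ℕ → Box → ℕ
hook ps (i , j) = suc (arm + leg + part ps j)
  where
  arm = length (filter (λ b → (row b ≟ i) ×-dec (j <? col b)) (boxes ps))
  leg = length (filter (λ b → (i <? row b) ×-dec (col b ≟ j)) (boxes ps))

H : List ℕ → ℕ
H ps = product (map (hook ps) (boxes ps))

H-nonZero : ∀ ps → NonZero (H ps)
H-nonZero ps = product≢0 (All.map⁺ (All.universal (λ _ → _) (boxes ps)))

skew : List ℕ → List ℕ → List Box
skew ps qs = filter (λ b → ¬? (b ∈? boxes qs)) (boxes ps)

-- T a is the entry in the a-th box of the list, shifted to start from 0.
record IsStandard (bs : List Box) (T : Fin (length bs) → Fin (length bs)) : Set where
  field
    bijective : Bijective _≡_ _≡_ T
    rows      : ∀ a b → row (lookup bs a) ≡ row (lookup bs b) →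
                col (lookup bs a) < col (lookup bs b) → T a Fin.< T b
    columns   : ∀ a b → col (lookup bs a) ≡ col (lookup bs b) →
                row (lookup bs a) < row (lookup bs b) → T a Fin.< T b

isStandard? : ∀ bs → Decidable (IsStandard bs)
isStandard? bs T = map′
  (λ (inj , sur , r , c) → record
    { bijective = (λ {a} {b} → inj a b) , strictlySurjective⇒surjective sur
    ; rows = r ; columns = c })
  (λ s → let open IsStandard s in
    (λ a b → proj₁ bijective) ,
    surjective⇒strictlySurjective (proj₂ bijective) , rows , columns)
  (Fin.all? (λ a → Fin.all? λ b → (T a Fin.≟ T b) →-dec (a Fin.≟ b))
   ×-dec Fin.all? (λ c → Fin.any? λ a → T a Fin.≟ c)
   ×-dec Fin.all? (λ a → Fin.all? λ b → (row (lookup bs a) ≟ row (lookup bs b)) →-dec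
           ((col (lookup bs a) <? col (lookup bs b)) →-dec (T a Fin.<? T b)))
   ×-dec Fin.all? (λ a → Fin.all? λ b → (col (lookup bs a) ≟ col (lookup bs b)) →-dec
           ((row (lookup bs a) <? row (lookup bs b)) →-dec (T a Fin.<? T b))))

-- finToFun enumerates all functions Fin N → Fin N, each once, as N ^ N codes.
countStandard : List Box → ℕ
countStandard bs =
  length (filter (λ c → isStandard? bs (finToFun c)) (allFin (length bs ^ length bs)))

f : List ℕ → List ℕ → ℕ
f ps qs = countStandard (skew ps qs)

RemovalGives : List ℕ → Box → List ℕ → Set
RemovalGives qs b ps = ∀ c → c ∈ boxes ps ⇔ (c ∈ boxes qs × c ≢ b)

record IsOuterCorner (qs : List ℕ) (b : Box) : Set where
  constructor outerCorner
  field
    inside  : b ∈ boxes qs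
    removal : ∃ λ ps → IsStrictPartition ps × RemovalGives qs b ps

removalGives? : ∀ qs b ps → Dec (RemovalGives qs b ps)
removalGives? qs b ps = map′
  (λ (to , from) c → mk⇔ (All.lookup to) (λ (c∈ , c≢) → All.lookup from c∈ c≢))
  (λ h → All.tabulate (λ {c} → Equivalence.to (h c)) ,
         All.tabulate (λ {c} c∈ c≢ → Equivalence.from (h c) (c∈ , c≢)))
  (All.all? (λ c → (c ∈? boxes qs) ×-dec ¬? (c ≟ᵇ b)) (boxes ps)
   ×-dec All.all? (λ c → ¬? (c ≟ᵇ b) →-dec (c ∈? boxes ps)) (boxes qs))

isOuterCorner? : ∀ qs → Decidable (IsOuterCorner qs)
isOuterCorner? qs b = map′
  (λ (b∈ , ∃ps) → let ps , _ , r = find ∃ps in outerCorner b∈ (ps , r))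
  (λ (outerCorner b∈ (ps , strict , r)) →
    b∈ , lose (∈-strictUpTo _ ps strict (bound ps strict r)) (strict , r))
  ((b ∈? boxes qs)
   ×-dec Any.any? (λ ps → isStrictPartition? ps ×-dec removalGives? qs b ps)
                  (strictUpTo (part qs 1)))
  where
  bound : ∀ ps → IsStrictPartition ps → RemovalGives qs b ps → part ps 1 ≤ part qs 1
  bound []           _                  r = z≤n
  bound (suc p ∷ ps) (_ , _)            r
    with ∈-boxes⁻ qs (proj₁ (Equivalence.to (r _) (∈-boxes⁺ (suc p ∷ ps) z<s ≤-refl)))
  ... | zero , _ , _ , k< , refl = k<
  bound (zero ∷ ps)  (_ , () ∷ _)       r

-- Outer corners lie in distinct rows, so reversing the lexicographic order
-- lists them with α₁ > ⋯ > αₘ.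
outerCorners : List ℕ → List Box
outerCorners qs = filter (isOuterCorner? qs) (reverse (boxes qs))

-- x₀, …, xₘ pair β₀, …, βₘ with α₁, …, αₘ₊₁.  Since α₁ ≤ ℓ and
-- αᵢ₊₁ < αᵢ < βᵢ, no subtraction truncates, here or in yContents.
xContents yContents : List ℕ → List ℕ
xContents qs = zipWith _∸_ ((length qs + 1) ∷ map col (outerCorners qs))
                    (map row (outerCorners qs) ++ 0 ∷ [])
yContents qs = map (λ b → col b ∸ row b) (outerCorners qs)

q₂ : List ℕ → ℤ
q₂ qs = + sum (map (λ x → (x C 2) ^ 2) (xContents qs))
        ℤ.- + sum (map (λ y → (y C 2) ^ 2) (yContents qs))

-- For λ ⊇ μ the exponent |λ| - ℓ(λ) - |μ| + ℓ(μ) is nonnegative: it is the sum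
-- over i of max(λᵢ - 1, 0) - max(μᵢ - 1, 0).
-- ƛ stands for λ, a keyword.
weight : List ℕ → List ℕ → ℚ
weight μ ƛ = ((+ (2 ^ ((sum ƛ + length μ) ∸ (length ƛ + sum μ)) * f ƛ μ * H μ)) ℚ./ H ƛ)
               {{H-nonZero ƛ}}

fromℤ : ℤ → ℚ
fromℤ i = i ℚ./ 1

extensions : List ℕ → ℕ → List (List ℕ)
extensions μ n = filter (_⊇? μ) (strictPartitions (sum μ + n))

-- Let strict partitions grow at random, one box at a time, passing from μ to ν with
-- probability ρ ν / ρ μ, where ρ λ = 2^(|λ| - ℓ(λ)) / H λ.  The left side of the theorem is
-- the expected increase of the content sum in n steps.  Put X p = p (p + 1) and
-- Y p = p (p - 1).  By the product formula for H, enlarging the part a of μ (a = 0 for a new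
-- row) has as its probability the residue at t = X a of  ∏ (t - Y p) / (t ∏ (t - X p)),
-- with p ranging over the parts of μ.  Hence X a has mean 2 |μ| and second moment
-- 2 (|μ|² + Σ p³).  The new box has content a + 1, so the content sum increases by
-- X a (X a - 2) / 24, while Σ p³ = q₂ μ increases by 3 X a + 1; induction on n follows.

module Submission where

open import Defs
open import Data.Fin.Base as Fin
  using (Fin; zero; suc; cast; combine; finToFun; funToFin; punchIn; punchOut)
import Data.Fin.Properties as Fin
open import Data.Integer.Base as ℤ using (ℤ; +_; ∣_∣)
import Data.Integer.Properties as ℤ
open import Data.List.Base
  using (List; []; _∷_; [_]; _++_; map; concatMap; filter; length; lookup; reverse; zipWith
        ; upTo; applyUpTo; allFin; tabulate)
import Data.List.Membership.DecPropositional as DecMembership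
open import Data.List.Membership.Propositional using (_∈_; _∉_; find; lose)
open import Data.List.Membership.Propositional.Properties
  using (∈-map⁺; ∈-map⁻; ∈-++⁺ˡ; ∈-++⁺ʳ; ∈-++⁻; ∈-applyUpTo⁻; ∈-concatMap⁺; ∈-concatMap⁻
        ; ∈-filter⁺; ∈-filter⁻; ∈-allFin; ∈-lookup)
open import Data.List.Membership.Propositional.Properties.WithK using (unique∧set⇒bag)
import Data.List.Properties as List
open import Data.List.Relation.Binary.BagAndSetEquality using (∼bag⇒↭)
open import Data.List.Relation.Binary.Disjoint.Propositional using (Disjoint)
open import Data.List.Relation.Binary.Permutation.Propositional using (_↭_)
import Data.List.Relation.Binary.Permutation.Propositional.Properties as ↭
open import Data.List.Relation.Unary.All as All using (All; []; _∷_)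
import Data.List.Relation.Unary.All.Properties as All
open import Data.List.Relation.Unary.AllPairs as AllPairs using (AllPairs; []; _∷_)
import Data.List.Relation.Unary.AllPairs.Properties as AllPairs
open import Data.List.Relation.Unary.Any using (here; there)
open import Data.List.Relation.Unary.Linked as Linked using (Linked; []; [-]; _∷_)
import Data.List.Relation.Unary.Linked.Properties as Linked
open import Data.List.Relation.Unary.Unique.Propositional using (Unique)
import Data.List.Relation.Unary.Unique.Propositional.Properties as Unique
open import Data.Nat.Base as ℕ using (ℕ; zero; suc; _<_; _≤_; z≤n; s≤s; _∸_; _^_; _!)
open import Data.Nat.Combinatorics using (_C_; nCk+nC[k+1]≡[n+1]C[k+1]; nC1≡n)
import Data.Nat.Coprimality as Coprimality
open import Data.Nat.ListAction using (sum; product)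
open import Data.Nat.ListAction.Properties using (sum-↭; sum-++; product-++)
import Data.Nat.Properties as ℕ
open import Data.Product.Base using (∃; _×_; _,_; proj₁; proj₂; map₂) renaming (map to ×-map)
open import Data.Rational.Base
  using (ℚ; mkℚ; 0ℚ; 1ℚ; ½; _+_; _*_; _-_; -_; _/_; 1/_; ≢-nonZero; ↥_; toℚᵘ)
open import Data.Rational.Properties as ℚ using (_≟_)
open import Data.Rational.Solver using (module +-*-Solver)
import Data.Rational.Unnormalised.Base as ℚᵘ
import Data.Rational.Unnormalised.Properties as ℚᵘ
open import Data.Sum.Base using (_⊎_; inj₁; inj₂)
open import Function.Base using (_∘_; id; _on_)
open import Function.Bundles using (mk⇔; Equivalence)
open import Function.Consequences.Propositional
  using (strictlySurjective⇒surjective; surjective⇒strictlySurjective)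
open import Relation.Binary.PropositionalEquality
  using (_≡_; _≢_; _≗_; refl; sym; trans; cong; cong₂; subst; module ≡-Reasoning)
open import Relation.Nullary.Decidable using (Dec; yes; no; ¬?; _×-dec_; _⊎-dec_; _→-dec_)
open import Relation.Nullary.Negation using (¬_; contradiction)
open import Relation.Unary using (Decidable)
open DecMembership _≟ᵇ_ using (_∈?_)
open +-*-Solver using (solve; _:=_; _:+_; _:*_; _:-_; :-_; con)

-- Rational arithmetic

-- The moments come from one induction on the largest part p instead of residue calculus. The part p
-- multiplies the rational function by (t - Y p) / (t - X p), which adds the pole X p and reweights
-- the smaller ones. Rewriting the new pole through the old ones leaves, of a test function, only
-- its divided differences at X p; for 1, X and X² these are 0, 1 and X a + X p. Growths with two
-- equal parts have ρ = 0, so the sums may run over all rows.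
--
-- The left side meets the process through f. Removing the box with the least entry gives f λ/μ = Σ
-- f λ/ν over the growths ν of μ inside λ, so f counts the paths from μ to λ, and each path has
-- probability ρ λ / ρ μ. The induction on n thus splits off the first step and replaces μ by ν;
-- this is why contents are measured from a free constant c, set to the content sum of μ only at the
-- end, and why all sums carry the factor ρ μ until then.
--
-- Σ p³ = q₂ μ holds because binom(p + 1, 2)² - binom(p, 2)² = p³: a new first row p changes the
-- corner sums by exactly this difference, whether or not it creates a corner.

2ℚ : ℚ
2ℚ = + 2 / 1

-- `i / 1` is stuck on the sign and the gcd of a variable `i`; in this normal form sums and products
-- of integers compute.
fromℤ-normal : ∀ i → fromℤ i ≡ mkℚ i 0 (Coprimality.sym (Coprimality.1-coprimeTo ∣ i ∣))
fromℤ-normal i = ℚ.↥p/↧p≡p (mkℚ i 0 _)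

abstract
  -- Opaque, so that `ι n` is an atom for the ring solver and no gcd is unfolded during checking.
  ι : ℕ → ℚ
  ι n = fromℤ (+ n)

  ι≡fromℤ : ∀ n → ι n ≡ fromℤ (+ n)
  ι≡fromℤ n = refl

fromℤ-+ : ∀ i j → fromℤ (i ℤ.+ j) ≡ fromℤ i + fromℤ j
fromℤ-+ i j rewrite fromℤ-normal i | fromℤ-normal j =
  cong (_/ 1) (sym (cong₂ ℤ._+_ (ℤ.*-identityʳ i) (ℤ.*-identityʳ j)))

fromℤ-* : ∀ i j → fromℤ (i ℤ.* j) ≡ fromℤ i * fromℤ j
fromℤ-* i j rewrite fromℤ-normal i | fromℤ-normal j = refl

fromℤ-neg : ∀ i → fromℤ (ℤ.- i) ≡ - fromℤ i
fromℤ-neg (+ zero)   = refl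
fromℤ-neg (+ suc n)  = refl
fromℤ-neg ℤ.-[1+ n ] = solve 1 (λ x → x := :- :- x) refl (fromℤ (+ suc n))

fromℤ-- : ∀ i j → fromℤ (i ℤ.- j) ≡ fromℤ i - fromℤ j
fromℤ-- i j = trans (fromℤ-+ i (ℤ.- j)) (cong (λ z → fromℤ i + z) (fromℤ-neg j))

abstract
  ι-+ : ∀ m n → ι (m ℕ.+ n) ≡ ι m + ι n
  ι-+ m n = fromℤ-+ (+ m) (+ n)

  ι-* : ∀ m n → ι (m ℕ.* n) ≡ ι m * ι n
  ι-* m n = trans (cong fromℤ (ℤ.pos-* m n)) (fromℤ-* (+ m) (+ n))

  ι-0 : ι 0 ≡ 0ℚ
  ι-0 = refl

  ι-1 : ι 1 ≡ 1ℚ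
  ι-1 = refl

  ι-suc : ∀ n → ι (suc n) ≡ 1ℚ + ι n
  ι-suc = ι-+ 1

  ι-injective : ∀ {m n} → ι m ≡ ι n → m ≡ n
  ι-injective {m} {n} e = ℤ.+-injective (cong ↥_ (trans (sym (fromℤ-normal (+ m)))
                                         (trans e (fromℤ-normal (+ n)))))

  ι≢0 : ∀ n .{{_ : ℕ.NonZero n}} → ι n ≢ 0ℚ
  ι≢0 (suc n) e with ι-injective {suc n} {0} e
  ... | ()

ι-∸ : ∀ {m n} → n ≤ m → ι (m ℕ.∸ n) ≡ ι m - ι n
ι-∸ {m} {n} n≤m = begin
  ι (m ℕ.∸ n)               ≡⟨ solve 2 (λ x y → x := (x :+ y) :- y) refl (ι (m ℕ.∸ n)) (ι n) ⟩
  ι (m ℕ.∸ n) + ι n - ι n   ≡⟨ cong (_- ι n) (sym (ι-+ (m ℕ.∸ n) n)) ⟩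
  ι (m ℕ.∸ n ℕ.+ n) - ι n   ≡⟨ cong (λ k → ι k - ι n) (ℕ.m∸n+n≡m n≤m) ⟩
  ι m - ι n                 ∎
  where open ≡-Reasoning

-≢0 : ∀ {m n} → n < m → ι m - ι n ≢ 0ℚ
-≢0 {m} {n} n<m e = ι≢0 (m ℕ.∸ n) {{ℕ.>-nonZero (ℕ.m<n⇒0<n∸m n<m)}} (trans (ι-∸ (ℕ.<⇒≤ n<m)) e)

ι+ι≢0 : ∀ {m n} → 0 < m → ι m + ι n ≢ 0ℚ
ι+ι≢0 {suc m} {n} _ e = ι≢0 (suc m ℕ.+ n) (trans (ι-+ (suc m) n) e)

-- The value at 0 is irrelevant; totality avoids carrying proofs of non-vanishing.
abstract
  inv : ℚ → ℚ
  inv q with q ≟ 0ℚ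
  ... | yes _  = 0ℚ
  ... | no q≢0 = 1/_ q {{≢-nonZero q≢0}}

  inv-inverse : ∀ {q} → q ≢ 0ℚ → q * inv q ≡ 1ℚ
  inv-inverse {q} q≢0 with q ≟ 0ℚ
  ... | yes q≡0 = contradiction q≡0 q≢0
  ... | no q≢0′ = ℚ.*-inverseʳ q {{≢-nonZero q≢0′}}

*-cancelˡ : ∀ d {x y} → d ≢ 0ℚ → d * x ≡ d * y → x ≡ y
*-cancelˡ d {x} {y} d≢0 e = begin
  x                ≡⟨ unit x ⟩
  inv d * (d * x)  ≡⟨ cong (inv d *_) e ⟩
  inv d * (d * y)  ≡⟨ unit y ⟨
  y                ∎
  where
  open ≡-Reasoning
  unit : ∀ x → x ≡ inv d * (d * x)
  unit x = begin
    x                ≡⟨ ℚ.*-identityˡ x ⟨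
    1ℚ * x           ≡⟨ cong (_* x) (inv-inverse d≢0) ⟨
    d * inv d * x    ≡⟨ solve 3 (λ d i x → d :* i :* x := i :* (d :* x)) refl d (inv d) x ⟩
    inv d * (d * x)  ∎

*-≢0 : ∀ {x y} → x ≢ 0ℚ → y ≢ 0ℚ → x * y ≢ 0ℚ
*-≢0 {x} x≢0 y≢0 e = y≢0 (*-cancelˡ x x≢0 (trans e (sym (ℚ.*-zeroʳ x))))

-- Cross-multiplication: what remains is a polynomial identity for the ring solver.
frac≡ : ∀ n d n₁ d₁ n₂ d₂ → d ≢ 0ℚ → d₁ ≢ 0ℚ → d₂ ≢ 0ℚ →
        n * (d₁ * d₂) ≡ n₁ * n₂ * d → n * inv d ≡ n₁ * inv d₁ * (n₂ * inv d₂)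
frac≡ n d n₁ d₁ n₂ d₂ d≢0 d₁≢0 d₂≢0 e =
  *-cancelˡ (d * (d₁ * d₂)) (*-≢0 d≢0 (*-≢0 d₁≢0 d₂≢0)) (begin
    d * (d₁ * d₂) * (n * inv d)
      ≡⟨ solve 5 (λ n d d₁ d₂ i → d :* (d₁ :* d₂) :* (n :* i) := d :* i :* (n :* (d₁ :* d₂)))
           refl n d d₁ d₂ (inv d) ⟩
    d * inv d * (n * (d₁ * d₂))
      ≡⟨ cong₂ _*_ (inv-inverse d≢0) e ⟩
    1ℚ * (n₁ * n₂ * d)
      ≡⟨ cong (_* (n₁ * n₂ * d)) (cong₂ _*_ (inv-inverse d₁≢0) (inv-inverse d₂≢0)) ⟨
    (d₁ * inv d₁) * (d₂ * inv d₂) * (n₁ * n₂ * d)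
      ≡⟨ solve 7 (λ d n₁ d₁ i₁ n₂ d₂ i₂ → (d₁ :* i₁) :* (d₂ :* i₂) :* (n₁ :* n₂ :* d)
                    := d :* (d₁ :* d₂) :* (n₁ :* i₁ :* (n₂ :* i₂)))
           refl d n₁ d₁ (inv d₁) n₂ d₂ (inv d₂) ⟩
    d * (d₁ * d₂) * (n₁ * inv d₁ * (n₂ * inv d₂)) ∎)
  where open ≡-Reasoning

frac≡₁ : ∀ n d n₁ d₁ → d ≢ 0ℚ → d₁ ≢ 0ℚ → n * d₁ ≡ n₁ * d → n * inv d ≡ n₁ * inv d₁
frac≡₁ n d n₁ d₁ d≢0 d₁≢0 e = begin
  n * inv d                      ≡⟨ frac≡ n d n₁ d₁ 1ℚ 1ℚ d≢0 d₁≢0 (λ ()) e′ ⟩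
  n₁ * inv d₁ * (1ℚ * inv 1ℚ)    ≡⟨ cong (n₁ * inv d₁ *_) (inv-inverse {1ℚ} (λ ())) ⟩
  n₁ * inv d₁ * 1ℚ               ≡⟨ ℚ.*-identityʳ (n₁ * inv d₁) ⟩
  n₁ * inv d₁                    ∎
  where
  open ≡-Reasoning
  e′ : n * (d₁ * 1ℚ) ≡ n₁ * 1ℚ * d
  e′ = trans (cong (n *_) (ℚ.*-identityʳ d₁)) (trans e (cong (_* d) (sym (ℚ.*-identityʳ n₁))))

∑ : {A : Set} → List A → (A → ℚ) → ℚ
∑ xs g = Σℚ (map g xs)

infix 8 ∑
syntax ∑ xs (λ x → e) = ∑[ x ∈ xs ] e

module _ {A : Set} where
  open ≡-Reasoning

  ∑-cong : ∀ (xs : List A) {g h : A → ℚ} → (∀ {x} → x ∈ xs → g x ≡ h x) → ∑ xs g ≡ ∑ xs h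
  ∑-cong []       e = refl
  ∑-cong (x ∷ xs) e = cong₂ _+_ (e (here refl)) (∑-cong xs (e ∘ there))

  ∑-*ˡ : ∀ c (xs : List A) {g : A → ℚ} → ∑[ x ∈ xs ] (c * g x) ≡ c * ∑ xs g
  ∑-*ˡ c []           = sym (ℚ.*-zeroʳ c)
  ∑-*ˡ c (x ∷ xs) {g} = begin
    c * g x + ∑[ y ∈ xs ] (c * g y)  ≡⟨ cong (λ z → c * g x + z) (∑-*ˡ c xs) ⟩
    c * g x + c * ∑ xs g             ≡⟨ ℚ.*-distribˡ-+ c (g x) (∑ xs g) ⟨
    c * (g x + ∑ xs g)               ∎

  ∑-+ : ∀ (xs : List A) {g h : A → ℚ} → ∑[ x ∈ xs ] (g x + h x) ≡ ∑ xs g + ∑ xs h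
  ∑-+ []               = refl
  ∑-+ (x ∷ xs) {g} {h} = begin
    g x + h x + ∑[ y ∈ xs ] (g y + h y)  ≡⟨ cong (λ z → g x + h x + z) (∑-+ xs) ⟩
    g x + h x + (∑ xs g + ∑ xs h)
      ≡⟨ solve 4 (λ a b c d → a :+ b :+ (c :+ d) := a :+ c :+ (b :+ d)) refl (g x) (h x) _ _ ⟩
    g x + ∑ xs g + (h x + ∑ xs h)        ∎

  ∑-0 : ∀ (xs : List A) {g : A → ℚ} → (∀ {x} → x ∈ xs → g x ≡ 0ℚ) → ∑ xs g ≡ 0ℚ
  ∑-0 []       e = refl
  ∑-0 (x ∷ xs) e = cong₂ _+_ (e (here refl)) (∑-0 xs (e ∘ there))

∑-swap : ∀ {A B : Set} (xs : List A) (ys : List B) {g : A → B → ℚ} →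
         ∑[ x ∈ xs ] ∑[ y ∈ ys ] g x y ≡ ∑[ y ∈ ys ] ∑[ x ∈ xs ] g x y
∑-swap []       ys     = sym (∑-0 ys (λ _ → refl))
∑-swap (x ∷ xs) ys {g} = trans (cong (λ z → ∑ ys (g x) + z) (∑-swap xs ys)) (sym (∑-+ ys))

∑-map : ∀ {A B : Set} (k : A → B) xs {g : B → ℚ} → ∑ (map k xs) g ≡ ∑[ x ∈ xs ] g (k x)
∑-map k xs = cong Σℚ (sym (List.map-∘ xs))

-- Growing a strict partition

strict-tail : ∀ {p ps} → IsStrictPartition (p ∷ ps) → IsStrictPartition ps
strict-tail (dec , _ ∷ pos) = Linked.tail dec , pos

strict-positive : ∀ {p ps} → IsStrictPartition (p ∷ ps) → 0 < p
strict-positive (_ , 0<p ∷ _) = 0<p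

strict-below : ∀ {p ps} → IsStrictPartition (p ∷ ps) → All (_< p) ps
strict-below (dec , _) = AllPairs.head (Linked.Linked⇒AllPairs (λ j<i k<j → ℕ.<-trans k<j j<i) dec)

strict-cons : ∀ {p ps} → 0 < p → All (_< p) ps → IsStrictPartition ps → IsStrictPartition (p ∷ ps)
strict-cons {ps = []}     0<p _         _           = [-] , 0<p ∷ []
strict-cons {ps = q ∷ qs} 0<p (q<p ∷ _) (dec , pos) = q<p ∷ dec , 0<p ∷ pos

-- One box is added to a part a, or to a new part a = 0; the result need not be
-- strict, in which case its ρ below vanishes.
grow : List ℕ → List (ℕ × List ℕ)
grow []       = (0 , 1 ∷ []) ∷ []
grow (p ∷ ps) = (p , suc p ∷ ps) ∷ map (map₂ (p ∷_)) (grow ps)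

X Y : ℕ → ℚ
X a = ι a * ι a + ι a
Y a = ι a * ι a - ι a

-- This is 2^(p - 1) / p!, the contribution of a single row to `ρ`; at p = 0 it starts from 1/2.
τ : ℕ → ℚ
τ zero    = ½
τ (suc p) = τ p * (2ℚ * inv (ι (suc p)))

-- The interaction of p with the parts below it in the product formula for H. It vanishes if one of
-- them equals p.
χ : ℕ → List ℕ → ℚ
χ p []       = 1ℚ
χ p (a ∷ as) = (ι p - ι a) * inv (ι p + ι a) * χ p as

-- The reciprocal of the hook product, up to a power of 2 (ρ-hook below).
ρ : List ℕ → ℚ
ρ []       = 1ℚ
ρ (p ∷ ps) = τ p * χ p ps * ρ ps

-- The rational function of the overview, evaluated at t = `X b`.
resolvent : ℕ → List ℕ → ℚ
resolvent b []       = inv (X b)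
resolvent b (a ∷ as) = (X b - Y a) * inv (X b - X a) * resolvent b as

X-X : ∀ b a → X b - X a ≡ (ι b - ι a) * (ι b + ι (suc a))
X-X b a rewrite ι-suc a = solve 2 (λ b a → (b :* b :+ b) :- (a :* a :+ a) :=
  (b :- a) :* (b :+ (con 1ℚ :+ a))) refl (ι b) (ι a)

X≢0 : ∀ {b} → 0 < b → X b ≢ 0ℚ
X≢0 {suc b} _ = subst (_≢ 0ℚ)
    (trans (ι-+ (suc b ℕ.* suc b) (suc b)) (cong (_+ ι (suc b)) (ι-* (suc b) (suc b))))
  (ι≢0 (suc b ℕ.* suc b ℕ.+ suc b))

X-X≢0 : ∀ {b a} → a < b → X b - X a ≢ 0ℚ
X-X≢0 {b} {a} a<b = subst (_≢ 0ℚ) (sym (X-X b a)) (*-≢0 (-≢0 a<b)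
  (ι+ι≢0 (ℕ.≤-<-trans z≤n a<b)))

-- This gives the probability that the first part p grows: 2p = `X p - Y p` is its own numerator.
-- Factor by factor, X p - Y a = (p + a)(p + 1 - a) and X p - X a = (p - a)(p + a + 1).
χ-suc : ∀ {p as} → 0 < p → All (_< p) as →
        2ℚ * inv (ι (suc p)) * χ (suc p) as ≡ χ p as * (2ℚ * ι p * resolvent p as)
χ-suc {p} 0<p [] = begin
  2ℚ * inv (ι (suc p)) * 1ℚ     ≡⟨ ℚ.*-identityʳ (2ℚ * inv (ι (suc p))) ⟩
  2ℚ * inv (ι (suc p))          ≡⟨ frac≡₁ 2ℚ (ι (suc p)) (2ℚ * ι p) (X p) (ι≢0 (suc p)) (X≢0 0<p)
      factor ⟩
  2ℚ * ι p * inv (X p)          ≡⟨ ℚ.*-identityˡ (2ℚ * ι p * inv (X p)) ⟨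
  1ℚ * (2ℚ * ι p * inv (X p))   ∎
  where
  open ≡-Reasoning
  factor : 2ℚ * X p ≡ 2ℚ * ι p * ι (suc p)
  factor rewrite ι-suc p =
    solve 1 (λ p → con 2ℚ :* (p :* p :+ p) := con 2ℚ :* p :* (con 1ℚ :+ p)) refl (ι p)
χ-suc {p} {a ∷ as} 0<p (a<p ∷ as<p) = begin
  2ℚ * inv (ι (suc p)) * (((ι (suc p) - ι a) * inv (ι (suc p) + ι a)) * χ (suc p) as)
    ≡⟨ solve 3 (λ x y z → x :* (y :* z) := y :* (x :* z)) refl
         (2ℚ * inv (ι (suc p))) ((ι (suc p) - ι a) * inv (ι (suc p) + ι a)) (χ (suc p) as) ⟩
  ((ι (suc p) - ι a) * inv (ι (suc p) + ι a)) * (2ℚ * inv (ι (suc p)) * χ (suc p) as)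
    ≡⟨ cong₂ _*_ factor (χ-suc 0<p as<p) ⟩
  ((ι p - ι a) * inv (ι p + ι a)) * ((X p - Y a) * inv (X p - X a)) *
      (χ p as * (2ℚ * ι p * resolvent p as))
    ≡⟨ solve 5 (λ u v c t r → u :* v :* (c :* (t :* r)) := u :* c :* (t :* (v :* r))) refl
         ((ι p - ι a) * inv (ι p + ι a)) ((X p - Y a) * inv (X p - X a)) (χ p as) (2ℚ * ι p)
             (resolvent p as) ⟩
  ((ι p - ι a) * inv (ι p + ι a)) * χ p as *
      (2ℚ * ι p * ((X p - Y a) * inv (X p - X a) * resolvent p as)) ∎
  where
  open ≡-Reasoning
  factor : (ι (suc p) - ι a) * inv (ι (suc p) + ι a) ≡
           ((ι p - ι a) * inv (ι p + ι a)) * ((X p - Y a) * inv (X p - X a))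
  factor = frac≡
    (ι (suc p) - ι a) (ι (suc p) + ι a) (ι p - ι a) (ι p + ι a) (X p - Y a) (X p - X a)
        (ι+ι≢0 (s≤s z≤n)) (ι+ι≢0 0<p) (X-X≢0 a<p)
    (subst (λ s → (s - ι a) * ((ι p + ι a) * (X p - X a)) ≡ (ι p - ι a) * (X p - Y a) * (s + ι a))
      (sym (ι-suc p))
      (solve 2 (λ p a → (con 1ℚ :+ p :- a) :* ((p :+ a) :* ((p :* p :+ p) :- (a :* a :+ a)))
         := (p :- a) :* ((p :* p :+ p) :- (a :* a :- a)) :* (con 1ℚ :+ p :+ a)) refl (ι p) (ι a)))

grow-below : ∀ {p ps a ν} → 0 < p → All (_< p) ps → (a , ν) ∈ grow ps → a < p
grow-below {ps = []}     0<p _           (here refl) = 0<p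
grow-below {ps = q ∷ qs} 0<p (q<p ∷ _)   (here refl) = q<p
grow-below {ps = q ∷ qs} 0<p (_ ∷ qs<p)  (there m) with ∈-map⁻ (map₂ (q ∷_)) m
... | (a , ν) , m′ , refl = grow-below 0<p qs<p m′

-- Only the factor of the enlarged part changes, from (p - a)/(p + a) to (p - a - 1)/(p + a + 1),
-- and Y p - X a = (p + a)(p - a - 1). A new row fits in with a = 0.
χ-grow : ∀ {p ps a ν} → 0 < p → All (_< p) ps → (a , ν) ∈ grow ps →
         χ p ν ≡ χ p ps * ((Y p - X a) * inv (X p - X a))
χ-grow {p} {[]} 0<p _ (here refl) = begin
  (ι p - ι 1) * inv (ι p + ι 1) * 1ℚ        ≡⟨ ℚ.*-identityʳ ((ι p - ι 1) * inv (ι p + ι 1)) ⟩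
  (ι p - ι 1) * inv (ι p + ι 1)
    ≡⟨ frac≡₁ (ι p - ι 1) (ι p + ι 1) (Y p - X 0) (X p - X 0) (ι+ι≢0 0<p) (X-X≢0 0<p)
         (factor (ι 1) (ι 0) ι-1 ι-0) ⟩
  (Y p - X 0) * inv (X p - X 0)             ≡⟨ ℚ.*-identityˡ ((Y p - X 0) * inv (X p - X 0)) ⟨
  1ℚ * ((Y p - X 0) * inv (X p - X 0))      ∎
  where
  open ≡-Reasoning
  factor : ∀ u z → u ≡ 1ℚ → z ≡ 0ℚ →
           (ι p - u) * (X p - (z * z + z)) ≡ (Y p - (z * z + z)) * (ι p + u)
  factor u z refl refl = solve 1
      (λ p → (p :- con 1ℚ) :* (p :* p :+ p :- (con 0ℚ :* con 0ℚ :+ con 0ℚ))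
    := (p :* p :- p :- (con 0ℚ :* con 0ℚ :+ con 0ℚ)) :* (p :+ con 1ℚ)) refl (ι p)
χ-grow {p} {a ∷ as} 0<p (a<p ∷ _) (here refl) = begin
  (ι p - ι (suc a)) * inv (ι p + ι (suc a)) * χ p as
    ≡⟨ cong (_* χ p as) factor ⟩
  (ι p - ι a) * inv (ι p + ι a) * ((Y p - X a) * inv (X p - X a)) * χ p as
    ≡⟨ solve 3 (λ x y z → x :* y :* z := x :* z :* y) refl
         ((ι p - ι a) * inv (ι p + ι a)) ((Y p - X a) * inv (X p - X a)) (χ p as) ⟩
  (ι p - ι a) * inv (ι p + ι a) * χ p as * ((Y p - X a) * inv (X p - X a)) ∎
  where
  open ≡-Reasoning
  factor : (ι p - ι (suc a)) * inv (ι p + ι (suc a)) ≡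
           (ι p - ι a) * inv (ι p + ι a) * ((Y p - X a) * inv (X p - X a))
  factor = frac≡
    (ι p - ι (suc a)) (ι p + ι (suc a)) (ι p - ι a) (ι p + ι a) (Y p - X a) (X p - X a) (ι+ι≢0 0<p)
    (ι+ι≢0 0<p) (X-X≢0 a<p)
    (subst (λ s → (ι p - s) * ((ι p + ι a) * (X p - X a)) ≡ (ι p - ι a) * (Y p - X a) * (ι p + s))
      (sym (ι-suc a))
      (solve 2 (λ p a → (p :- (con 1ℚ :+ a)) :* ((p :+ a) :* ((p :* p :+ p) :- (a :* a :+ a)))
         := (p :- a) :* ((p :* p :- p) :- (a :* a :+ a)) :* (p :+ (con 1ℚ :+ a))) refl (ι p) (ι a)))
χ-grow {p} {b ∷ bs} 0<p (_ ∷ bs<p) (there m) with ∈-map⁻ (map₂ (b ∷_)) m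
... | (a , ν) , m′ , refl = trans
  (cong ((ι p - ι b) * inv (ι p + ι b) *_) (χ-grow 0<p bs<p m′))
  (sym (ℚ.*-assoc ((ι p - ι b) * inv (ι p + ι b)) (χ p bs) _))

-- Moments of the growth

-- The expectation of `h` at the enlarged part, multiplied by `ρ ps`.
growSum : List ℕ → (ℕ → ℚ) → ℚ
growSum ps h = ∑[ aν ∈ grow ps ] (ρ (proj₂ aν) * h (proj₁ aν))

growSum-cong : ∀ ps {g h} → (∀ a → g a ≡ h a) → growSum ps g ≡ growSum ps h
growSum-cong ps e = ∑-cong (grow ps) (λ {(a , ν)} _ → cong (ρ ν *_) (e a))

growSum-+ : ∀ ps {g h} → growSum ps (λ a → g a + h a) ≡ growSum ps g + growSum ps h
growSum-+ ps {g} {h} = trans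
  (∑-cong (grow ps) (λ {(a , ν)} _ → ℚ.*-distribˡ-+ (ρ ν) (g a) (h a)))
  (∑-+ (grow ps))

growSum-*ˡ : ∀ ps c {g} → growSum ps (λ a → c * g a) ≡ c * growSum ps g
growSum-*ˡ ps c {g} = trans
  (∑-cong (grow ps) (λ {(a , ν)} _ → solve 3 (λ r c x → r :* (c :* x) := c :* (r :* x)) refl (ρ ν) c
      (g a)))
  (∑-*ˡ c (grow ps))

-- The new node X p is eliminated by Σ ρ ν / (X p - X a) = ρ ps * resolvent p ps,
-- leaving the divided difference δ of h.
growSum-∷ : ∀ {p ps} → IsStrictPartition (p ∷ ps) →
  growSum ps (λ a → inv (X p - X a)) ≡ ρ ps * resolvent p ps →
  ∀ (h δ : ℕ → ℚ) → (∀ {a} → a < p → h p - h a ≡ (X p - X a) * δ a) →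
  growSum (p ∷ ps) h ≡ τ p * χ p ps * growSum ps (λ a → h a + 2ℚ * ι p * δ a)
growSum-∷ {p} {ps} s res h δ hδ = begin
  ρ (suc p ∷ ps) * h p + ∑ (map (map₂ (p ∷_)) (grow ps)) (λ aν → ρ (proj₂ aν) * h (proj₁ aν))
    ≡⟨ cong₂ _+_ first rest ⟩
  K * growSum ps (λ a → P * h p * inv (X p - X a))
    + K * growSum ps (λ a → (Y p - X a) * inv (X p - X a) * h a)
    ≡⟨ ℚ.*-distribˡ-+ K (growSum ps (λ a → P * h p * inv (X p - X a)))
         (growSum ps (λ a → (Y p - X a) * inv (X p - X a) * h a)) ⟨
  K * (growSum ps (λ a → P * h p * inv (X p - X a))
    + growSum ps (λ a → (Y p - X a) * inv (X p - X a) * h a))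
    ≡⟨ cong (K *_) (sym (growSum-+ ps)) ⟩
  K * growSum ps (λ a → P * h p * inv (X p - X a) + (Y p - X a) * inv (X p - X a) * h a)
    ≡⟨ cong (K *_) (∑-cong (grow ps)
         (λ {(a , ν)} m → cong (ρ ν *_) (termwise a (grow-below 0<p below m)))) ⟩
  K * growSum ps (λ a → h a + P * δ a) ∎
  where
  open ≡-Reasoning
  K = τ p * χ p ps
  P = 2ℚ * ι p
  0<p = strict-positive s
  below = strict-below s
  first : ρ (suc p ∷ ps) * h p ≡ K * growSum ps (λ a → P * h p * inv (X p - X a))
  first = begin
    τ p * (2ℚ * inv (ι (suc p))) * χ (suc p) ps * ρ ps * h p
      ≡⟨ solve 5 (λ t i c r h → t :* i :* c :* r :* h := t :* (i :* c) :* r :* h) refl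
           (τ p) (2ℚ * inv (ι (suc p))) (χ (suc p) ps) (ρ ps) (h p) ⟩
    τ p * (2ℚ * inv (ι (suc p)) * χ (suc p) ps) * ρ ps * h p
      ≡⟨ cong (λ z → τ p * z * ρ ps * h p) (χ-suc 0<p below) ⟩
    τ p * (χ p ps * (P * resolvent p ps)) * ρ ps * h p
      ≡⟨ solve 6 (λ t c P R r h → t :* (c :* (P :* R)) :* r :* h := t :* c :* (P :* h :* (r :* R)))
           refl
           (τ p) (χ p ps) P (resolvent p ps) (ρ ps) (h p) ⟩
    K * (P * h p * (ρ ps * resolvent p ps))
      ≡⟨ cong (λ z → K * (P * h p * z)) (sym res) ⟩
    K * (P * h p * growSum ps (λ a → inv (X p - X a)))
      ≡⟨ cong (K *_) (sym (growSum-*ˡ ps (P * h p))) ⟩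
    K * growSum ps (λ a → P * h p * inv (X p - X a)) ∎
  rest : ∑ (map (map₂ (p ∷_)) (grow ps)) (λ aν → ρ (proj₂ aν) * h (proj₁ aν)) ≡
         K * growSum ps (λ a → (Y p - X a) * inv (X p - X a) * h a)
  rest = begin
    ∑ (map (map₂ (p ∷_)) (grow ps)) (λ aν → ρ (proj₂ aν) * h (proj₁ aν))
      ≡⟨ ∑-map (map₂ (p ∷_)) (grow ps) ⟩
    ∑[ aν ∈ grow ps ] (τ p * χ p (proj₂ aν) * ρ (proj₂ aν) * h (proj₁ aν))
      ≡⟨ ∑-cong (grow ps) (λ {(a , ν)} m → trans
           (cong (λ z → τ p * z * ρ ν * h a) (χ-grow 0<p below m))
           (solve 5 (λ t c f r h → t :* (c :* f) :* r :* h := t :* c :* (r :* (f :* h))) refl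
              (τ p) (χ p ps) ((Y p - X a) * inv (X p - X a)) (ρ ν) (h a))) ⟩
    ∑[ aν ∈ grow ps ] (K * (ρ (proj₂ aν) *
        ((Y p - X (proj₁ aν)) * inv (X p - X (proj₁ aν)) * h (proj₁ aν))))
      ≡⟨ ∑-*ˡ K (grow ps) ⟩
    K * growSum ps (λ a → (Y p - X a) * inv (X p - X a) * h a) ∎
  -- Since Y p = X p - 2p, the reweighting factor is 1 - 2p / (X p - X a); its second term combines
  -- with the new pole into 2p times the divided difference.
  termwise : ∀ a → a < p →
    P * h p * inv (X p - X a) + (Y p - X a) * inv (X p - X a) * h a ≡ h a + P * δ a
  termwise a a<p = begin
    P * h p * i + (Y p - X a) * i * h a
      ≡⟨ solve 5 (λ p x i hp ha →
           con 2ℚ :* p :* hp :* i :+ ((p :* p :- p) :- x) :* i :* ha :=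
           ((p :* p :+ p) :- x) :* i :* ha :+ con 2ℚ :* p :* i :* (hp :- ha)) refl (ι p) (X a) i
               (h p) (h a) ⟩
    (X p - X a) * i * h a + P * i * (h p - h a)
      ≡⟨ cong (λ z → (X p - X a) * i * h a + P * i * z) (hδ a<p) ⟩
    (X p - X a) * i * h a + P * i * ((X p - X a) * δ a)
      ≡⟨ solve 5 (λ P D i ha δ → D :* i :* ha :+ P :* i :* (D :* δ) := D :* i :* (ha :+ P :* δ))
           refl P (X p - X a) i (h a) (δ a) ⟩
    (X p - X a) * i * (h a + P * δ a)
      ≡⟨ cong (_* (h a + P * δ a)) (inv-inverse (X-X≢0 a<p)) ⟩
    1ℚ * (h a + P * δ a)
      ≡⟨ ℚ.*-identityˡ (h a + P * δ a) ⟩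
    h a + P * δ a ∎
    where
    i = inv (X p - X a)

ρ-1 : ρ (1 ∷ []) ≡ 1ℚ
ρ-1 = begin
  ½ * (2ℚ * inv (ι 1)) * 1ℚ * 1ℚ
    ≡⟨ cong (λ z → ½ * (2ℚ * inv z) * 1ℚ * 1ℚ) ι-1 ⟩
  ½ * (2ℚ * inv 1ℚ) * 1ℚ * 1ℚ
    ≡⟨ solve 1 (λ i → con ½ :* (con 2ℚ :* i) :* con 1ℚ :* con 1ℚ := con 1ℚ :* i) refl (inv 1ℚ) ⟩
  1ℚ * inv 1ℚ
    ≡⟨ inv-inverse {1ℚ} (λ ()) ⟩
  1ℚ ∎
  where open ≡-Reasoning

-- The partial fraction expansion of the rational function. `growSum-∷` needs it for the tail at b =
-- p; a general b closes the induction, because the divided difference of 1 / (X b - x) at X p is a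
-- constant multiple of that function itself.
growSum-resolvent : ∀ {ps b} → IsStrictPartition ps → 0 < b → All (_< b) ps →
  growSum ps (λ a → inv (X b - X a)) ≡ ρ ps * resolvent b ps
growSum-resolvent {[]} {b} _ 0<b _ = begin
  ρ (1 ∷ []) * inv (X b - X 0) + 0ℚ   ≡⟨ ℚ.+-identityʳ (ρ (1 ∷ []) * inv (X b - X 0)) ⟩
  ρ (1 ∷ []) * inv (X b - X 0)        ≡⟨ cong₂ _*_ ρ-1
      (cong inv (trans (cong (λ z → X b - (z * z + z)) ι-0) (ℚ.+-identityʳ (X b)))) ⟩
  1ℚ * inv (X b)                      ∎
  where
  open ≡-Reasoning
growSum-resolvent {p ∷ ps} {b} s 0<b (p<b ∷ ps<b) = begin
  growSum (p ∷ ps) (λ a → inv (X b - X a))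
    ≡⟨ growSum-∷ s (growSum-resolvent (strict-tail s) (strict-positive s) (strict-below s)) _
         (λ a → inv (X b - X p) * inv (X b - X a)) hδ ⟩
  K * growSum ps (λ a → inv (X b - X a) + 2ℚ * ι p * (inv (X b - X p) * inv (X b - X a)))
    ≡⟨ cong (K *_) (growSum-cong ps
         (λ a → solve 3 (λ i P j → i :+ P :* (j :* i) := (con 1ℚ :+ P :* j) :* i)
         refl (inv (X b - X a)) (2ℚ * ι p) (inv (X b - X p)))) ⟩
  K * growSum ps (λ a → (1ℚ + 2ℚ * ι p * inv (X b - X p)) * inv (X b - X a))
    ≡⟨ cong (K *_) (growSum-*ˡ ps (1ℚ + 2ℚ * ι p * inv (X b - X p))) ⟩
  K * ((1ℚ + 2ℚ * ι p * inv (X b - X p)) * growSum ps (λ a → inv (X b - X a)))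
    ≡⟨ cong₂ (λ y z → K * (y * z)) factor (growSum-resolvent (strict-tail s) 0<b ps<b) ⟩
  K * ((X b - Y p) * inv (X b - X p) * (ρ ps * resolvent b ps))
    ≡⟨ solve 4 (λ K f r R → K :* (f :* (r :* R)) := K :* r :* (f :* R)) refl
         K ((X b - Y p) * inv (X b - X p)) (ρ ps) (resolvent b ps) ⟩
  K * ρ ps * ((X b - Y p) * inv (X b - X p) * resolvent b ps) ∎
  where
  open ≡-Reasoning
  K = τ p * χ p ps
  factor : 1ℚ + 2ℚ * ι p * inv (X b - X p) ≡ (X b - Y p) * inv (X b - X p)
  factor = begin
    1ℚ + 2ℚ * ι p * inv (X b - X p)
      ≡⟨ cong (λ z → z + 2ℚ * ι p * inv (X b - X p)) (inv-inverse (X-X≢0 p<b)) ⟨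
    (X b - X p) * inv (X b - X p) + 2ℚ * ι p * inv (X b - X p)
      ≡⟨ solve 3 (λ x p i → (x :- (p :* p :+ p)) :* i :+ con 2ℚ :* p :* i := (x :- (p :* p :- p)) :*
           i)
           refl (X b) (ι p) (inv (X b - X p)) ⟩
    (X b - Y p) * inv (X b - X p) ∎
  hδ : ∀ {a} → a < p → inv (X b - X p) - inv (X b - X a) ≡
       (X p - X a) * (inv (X b - X p) * inv (X b - X a))
  hδ {a} a<p = begin
    i - j
      ≡⟨ solve 2 (λ i j → i :- j := con 1ℚ :* i :- con 1ℚ :* j) refl i j ⟩
    1ℚ * i - 1ℚ * j
      ≡⟨ cong₂ (λ y z → y * i - z * j) (inv-inverse (X-X≢0 (ℕ.<-trans a<p p<b)))
           (inv-inverse (X-X≢0 p<b)) ⟨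
    (X b - X a) * j * i - (X b - X p) * i * j
      ≡⟨ solve 5 (λ b a p i j → (b :- a) :* j :* i :- (b :- p) :* i :* j := (p :- a) :* (i :* j))
           refl (X b) (X a) (X p) i j ⟩
    (X p - X a) * (i * j) ∎
    where
    i = inv (X b - X p)
    j = inv (X b - X a)

cubes : List ℕ → ℚ
cubes ps = ∑[ p ∈ ps ] (ι p * ι p * ι p)

growSum-[] : ∀ h → growSum [] h ≡ h 0
growSum-[] h = begin
  ρ (1 ∷ []) * h 0 + 0ℚ  ≡⟨ ℚ.+-identityʳ (ρ (1 ∷ []) * h 0) ⟩
  ρ (1 ∷ []) * h 0       ≡⟨ cong (_* h 0) ρ-1 ⟩
  1ℚ * h 0               ≡⟨ ℚ.*-identityˡ (h 0) ⟩
  h 0                    ∎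
  where open ≡-Reasoning

X0≡0 : X 0 ≡ 0ℚ
X0≡0 = cong (λ z → z * z + z) ι-0

module _ {p ps} (s : IsStrictPartition (p ∷ ps)) where
  growSum-∷′ : ∀ (h δ : ℕ → ℚ) → (∀ {a} → a < p → h p - h a ≡ (X p - X a) * δ a) →
    growSum (p ∷ ps) h ≡ τ p * χ p ps * growSum ps (λ a → h a + 2ℚ * ι p * δ a)
  growSum-∷′ = growSum-∷ s (growSum-resolvent (strict-tail s) (strict-positive s) (strict-below s))

-- The probabilities have sum 1: a constant has divided difference 0.
growSum-1 : ∀ {ps} → IsStrictPartition ps → growSum ps (λ _ → 1ℚ) ≡ ρ ps
growSum-1 {[]}     _ = growSum-[] (λ _ → 1ℚ)
growSum-1 {p ∷ ps} s = begin
  growSum (p ∷ ps) (λ _ → 1ℚ)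
    ≡⟨ growSum-∷′ s (λ _ → 1ℚ) (λ _ → 0ℚ) (λ {a} _ → sym (ℚ.*-zeroʳ (X p - X a))) ⟩
  τ p * χ p ps * growSum ps (λ _ → 1ℚ + 2ℚ * ι p * 0ℚ)
    ≡⟨ cong (τ p * χ p ps *_) (trans
         (growSum-cong ps (λ _ → solve 1 (λ x → con 1ℚ :+ x :* con 0ℚ := con 1ℚ) refl (2ℚ * ι p)))
         (growSum-1 (strict-tail s))) ⟩
  τ p * χ p ps * ρ ps ∎
  where open ≡-Reasoning

-- The divided difference is 1, so every part p adds 2p to the mean.
growSum-X : ∀ {ps} → IsStrictPartition ps → growSum ps X ≡ ρ ps * (2ℚ * ι (sum ps))
growSum-X {[]}     _ = trans (growSum-[] X) (trans X0≡0 (sym (cong (λ z → 1ℚ * (2ℚ * z)) ι-0)))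
growSum-X {p ∷ ps} s = begin
  growSum (p ∷ ps) X
    ≡⟨ growSum-∷′ s X (λ _ → 1ℚ) (λ {a} _ → sym (ℚ.*-identityʳ (X p - X a))) ⟩
  K * growSum ps (λ a → X a + 2ℚ * ι p * 1ℚ)
    ≡⟨ cong (K *_) (growSum-+ ps) ⟩
  K * (growSum ps X + growSum ps (λ _ → 2ℚ * ι p * 1ℚ))
    ≡⟨ cong₂ (λ y z → K * (y + z)) (growSum-X (strict-tail s))
         (trans (growSum-*ˡ ps (2ℚ * ι p)) (cong (2ℚ * ι p *_) (growSum-1 (strict-tail s)))) ⟩
  K * (ρ ps * (2ℚ * ι (sum ps)) + 2ℚ * ι p * ρ ps)
    ≡⟨ solve 4 (λ K r n p → K :* (r :* (con 2ℚ :* n) :+ con 2ℚ :* p :* r) := K :* r :*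
         (con 2ℚ :* (p :+ n)))
         refl K (ρ ps) (ι (sum ps)) (ι p) ⟩
  K * ρ ps * (2ℚ * (ι p + ι (sum ps)))
    ≡⟨ cong (λ z → K * ρ ps * (2ℚ * z)) (ι-+ p (sum ps)) ⟨
  K * ρ ps * (2ℚ * ι (p ℕ.+ sum ps)) ∎
  where
  open ≡-Reasoning
  K = τ p * χ p ps

-- The divided difference X a + X p has mean 2n + p² + p, with n the size of the tail; and 2p (2n +
-- p² + p) = 2 ((p + n)² - n² + p³).
growSum-X² : ∀ {ps} → IsStrictPartition ps →
  growSum ps (λ a → X a * X a) ≡ ρ ps * (2ℚ * (ι (sum ps) * ι (sum ps) + cubes ps))
growSum-X² {[]}     _ = trans (growSum-[] (λ a → X a * X a)) (trans (cong (λ z → z * z) X0≡0)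
  (sym (cong (λ z → 1ℚ * (2ℚ * (z * z + 0ℚ))) ι-0)))
growSum-X² {p ∷ ps} s = begin
  growSum (p ∷ ps) (λ a → X a * X a)
    ≡⟨ growSum-∷′ s (λ a → X a * X a) (λ a → X a + X p)
         (λ {a} _ → solve 2 (λ p a → p :* p :- a :* a := (p :- a) :* (a :+ p)) refl (X p) (X a)) ⟩
  K * growSum ps (λ a → X a * X a + P * (X a + X p))
    ≡⟨ cong (K *_) (trans (growSum-cong ps (λ a →
         solve 3 (λ x P y → x :* x :+ P :* (x :+ y) := x :* x :+ (P :* x :+ P :* y :* con 1ℚ)) refl
             (X a) P (X p)))
         (trans (growSum-+ ps) (cong (λ z → growSum ps (λ a → X a * X a) + z) (growSum-+ ps)))) ⟩
  K * (growSum ps (λ a → X a * X a) +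
      (growSum ps (λ a → P * X a) + growSum ps (λ _ → P * X p * 1ℚ)))
    ≡⟨ cong₂ (λ y z → K * (y + z)) (growSum-X² s′) (cong₂ _+_
         (trans (growSum-*ˡ ps P) (cong (P *_) (growSum-X s′)))
         (trans (growSum-*ˡ ps (P * X p)) (cong (P * X p *_) (growSum-1 s′)))) ⟩
  K * (ρ ps * (2ℚ * (n * n + cubes ps)) + (P * (ρ ps * (2ℚ * n)) + P * X p * ρ ps))
    ≡⟨ solve 5 (λ K r n c p →
         K :* (r :* (con 2ℚ :* (n :* n :+ c)) :+
           (con 2ℚ :* p :* (r :* (con 2ℚ :* n)) :+ con 2ℚ :* p :* (p :* p :+ p) :* r)) :=
         K :* r :* (con 2ℚ :* ((p :+ n) :* (p :+ n) :+ (p :* p :* p :+ c)))) refl K (ρ ps) n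
             (cubes ps) (ι p) ⟩
  K * ρ ps * (2ℚ * ((ι p + n) * (ι p + n) + cubes (p ∷ ps)))
    ≡⟨ cong (λ z → K * ρ ps * (2ℚ * (z * z + cubes (p ∷ ps)))) (ι-+ p (sum ps)) ⟨
  K * ρ ps * (2ℚ * (ι (p ℕ.+ sum ps) * ι (p ℕ.+ sum ps) + cubes (p ∷ ps))) ∎
  where
  open ≡-Reasoning
  K = τ p * χ p ps
  P = 2ℚ * ι p
  n = ι (sum ps)
  s′ = strict-tail s

-- Contents

firstRow : ℕ → List Box
firstRow p = map (λ k → 1 , 1 ℕ.+ k) [1⋯ p ]

shift : Box → Box
shift (i , j) = suc i , suc j

shift-injective : ∀ {b c} → shift b ≡ shift c → b ≡ c
shift-injective refl = refl

[1⋯]≡map : ∀ n → [1⋯ n ] ≡ map suc (upTo n)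
[1⋯]≡map n = sym (List.map-upTo suc n)

-- Below the first row stands the diagram of the tail, moved one step along the diagonal. The move
-- preserves contents and hooks, and this drives all inductions on diagrams.
boxes-∷ : ∀ p ps → boxes (p ∷ ps) ≡ firstRow p ++ map shift (boxes ps)
boxes-∷ p ps = cong (firstRow p ++_) (begin
  concatMap (rowBoxes (p ∷ ps)) (applyUpTo (ℕ.suc ∘ ℕ.suc) n)
    ≡⟨ cong (concatMap (rowBoxes (p ∷ ps))) (sym (List.map-upTo (ℕ.suc ∘ ℕ.suc) n)) ⟩
  concatMap (rowBoxes (p ∷ ps)) (map (ℕ.suc ∘ ℕ.suc) (upTo n))
    ≡⟨ List.concatMap-map (rowBoxes (p ∷ ps)) (ℕ.suc ∘ ℕ.suc) (upTo n) ⟩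
  concatMap (λ i → map (λ k → suc (suc i) , suc (suc i) ℕ.+ k) [1⋯ part ps (suc i) ]) (upTo n)
    ≡⟨ List.concatMap-cong (λ i → List.map-∘ [1⋯ part ps (suc i) ]) (upTo n) ⟩
  concatMap (map shift ∘ rowBoxes ps ∘ ℕ.suc) (upTo n)
    ≡⟨ List.concatMap-map (map shift ∘ rowBoxes ps) suc (upTo n) ⟨
  concatMap (map shift ∘ rowBoxes ps) (map suc (upTo n))
    ≡⟨ cong (concatMap (map shift ∘ rowBoxes ps)) ([1⋯]≡map n) ⟨
  concatMap (map shift ∘ rowBoxes ps) [1⋯ n ]
    ≡⟨ List.map-concatMap shift (rowBoxes ps) [1⋯ n ] ⟨
  map shift (boxes ps) ∎)
  where
  open ≡-Reasoning
  n = length ps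
  rowBoxes : List ℕ → ℕ → List Box
  rowBoxes ps i = map (λ k → i , i ℕ.+ k) [1⋯ part ps i ]

firstRow-suc : ∀ p → firstRow (suc p) ≡ firstRow p ++ [ (1 , 1 ℕ.+ suc p) ]
firstRow-suc p = trans (cong (map _) (sym (List.applyUpTo-∷ʳ suc p)))
    (List.map-++ _ [1⋯ p ] [ suc p ])

boxTerm : Box → ℕ
boxTerm b = (content b ℕ.+ 1) C 4

contentSum-∷ : ∀ p ps → contentSum (p ∷ ps) ≡ sum (map boxTerm (firstRow p)) ℕ.+ contentSum ps
contentSum-∷ p ps = begin
  sum (map boxTerm (boxes (p ∷ ps)))
    ≡⟨ cong (sum ∘ map boxTerm) (boxes-∷ p ps) ⟩
  sum (map boxTerm (firstRow p ++ map shift (boxes ps)))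
    ≡⟨ cong sum (List.map-++ boxTerm (firstRow p) (map shift (boxes ps))) ⟩
  sum (map boxTerm (firstRow p) ++ map boxTerm (map shift (boxes ps)))
    ≡⟨ sum-++ (map boxTerm (firstRow p)) _ ⟩
  sum (map boxTerm (firstRow p)) ℕ.+ sum (map boxTerm (map shift (boxes ps)))
    ≡⟨ cong (λ L → sum (map boxTerm (firstRow p)) ℕ.+ sum L) (sym (List.map-∘ (boxes ps))) ⟩
  sum (map boxTerm (firstRow p)) ℕ.+ contentSum ps ∎
  where open ≡-Reasoning

contentSum-suc : ∀ p ps → contentSum (suc p ∷ ps) ≡ contentSum (p ∷ ps) ℕ.+ (suc p ℕ.+ 1) C 4
contentSum-suc p ps = begin
  contentSum (suc p ∷ ps)
    ≡⟨ contentSum-∷ (suc p) ps ⟩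
  sum (map boxTerm (firstRow (suc p))) ℕ.+ contentSum ps
    ≡⟨ cong (λ L → sum (map boxTerm L) ℕ.+ contentSum ps) (firstRow-suc p) ⟩
  sum (map boxTerm (firstRow p ++ [ b ])) ℕ.+ contentSum ps
    ≡⟨ cong (λ L → sum L ℕ.+ contentSum ps) (List.map-++ boxTerm (firstRow p) [ b ]) ⟩
  sum (map boxTerm (firstRow p) ++ [ c ]) ℕ.+ contentSum ps
    ≡⟨ cong (ℕ._+ contentSum ps) (sum-++ (map boxTerm (firstRow p)) [ c ]) ⟩
  sum (map boxTerm (firstRow p)) ℕ.+ (c ℕ.+ 0) ℕ.+ contentSum ps
    ≡⟨ rearrange (sum (map boxTerm (firstRow p))) c (contentSum ps) ⟩
  sum (map boxTerm (firstRow p)) ℕ.+ contentSum ps ℕ.+ c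
    ≡⟨ cong (ℕ._+ c) (contentSum-∷ p ps) ⟨
  contentSum (p ∷ ps) ℕ.+ c ∎
  where
  open ≡-Reasoning
  b = (1 , 1 ℕ.+ suc p)
  c = boxTerm b
  rearrange : ∀ x c y → x ℕ.+ (c ℕ.+ 0) ℕ.+ y ≡ x ℕ.+ y ℕ.+ c
  rearrange x c y rewrite ℕ.+-identityʳ c | ℕ.+-assoc x c y | ℕ.+-comm c y = sym (ℕ.+-assoc x y c)

contentSum-grow : ∀ {μ a ν} → (a , ν) ∈ grow μ → contentSum ν ≡ contentSum μ ℕ.+ (suc a ℕ.+ 1) C 4
contentSum-grow {[]}     (here refl) = refl
contentSum-grow {p ∷ ps} (here refl) = contentSum-suc p ps
contentSum-grow {p ∷ ps} (there m) with ∈-map⁻ (map₂ (p ∷_)) m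
... | (a , ν) , m′ , refl = begin
  contentSum (p ∷ ν)                   ≡⟨ contentSum-∷ p ν ⟩
  r ℕ.+ contentSum ν                   ≡⟨ cong (r ℕ.+_) (contentSum-grow m′) ⟩
  r ℕ.+ (contentSum ps ℕ.+ c)          ≡⟨ ℕ.+-assoc r (contentSum ps) c ⟨
  r ℕ.+ contentSum ps ℕ.+ c            ≡⟨ cong (ℕ._+ c) (contentSum-∷ p ps) ⟨
  contentSum (p ∷ ps) ℕ.+ c            ∎
  where
  open ≡-Reasoning
  r = sum (map boxTerm (firstRow p))
  c = (suc a ℕ.+ 1) C 4

sum-grow : ∀ {μ a ν} → (a , ν) ∈ grow μ → sum ν ≡ suc (sum μ)
sum-grow {[]}     (here refl) = refl
sum-grow {p ∷ ps} (here refl) = refl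
sum-grow {p ∷ ps} (there m) with ∈-map⁻ (map₂ (p ∷_)) m
... | (a , ν) , m′ , refl = trans (cong (p ℕ.+_) (sum-grow m′)) (ℕ.+-suc p (sum ps))

cubes-grow : ∀ {μ a ν} → (a , ν) ∈ grow μ → cubes ν ≡ cubes μ + (+ 3 / 1 * X a + 1ℚ)
cubes-grow {[]}     (here refl) rewrite ι-1 | ι-0 = refl
cubes-grow {p ∷ ps} (here refl) rewrite ι-suc p =
  solve 2 (λ p c → (con 1ℚ :+ p) :* (con 1ℚ :+ p) :* (con 1ℚ :+ p) :+ c
             := p :* p :* p :+ c :+ (con (+ 3 / 1) :* (p :* p :+ p) :+ con 1ℚ)) refl (ι p)
                 (cubes ps)
cubes-grow {p ∷ ps} (there m) with ∈-map⁻ (map₂ (p ∷_)) m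
... | (a , ν) , m′ , refl = trans (cong (λ z → ι p * ι p * ι p + z) (cubes-grow m′))
                              (sym (ℚ.+-assoc (ι p * ι p * ι p) (cubes ps) _))

grow-≤ : ∀ {p ps a ν} → 0 < p → All (_< p) ps → (a , ν) ∈ grow ps → All (_≤ p) ν
grow-≤ {ps = []}     0<p _           (here refl) = 0<p ∷ []
grow-≤ {ps = q ∷ qs} 0<p (q<p ∷ qs<p) (here refl) = q<p ∷ All.map ℕ.<⇒≤ qs<p
grow-≤ {ps = q ∷ qs} 0<p (q<p ∷ qs<p) (there m) with ∈-map⁻ (map₂ (q ∷_)) m
... | (a , ν) , m′ , refl = ℕ.<⇒≤ q<p ∷ grow-≤ 0<p qs<p m′

-- Strictness is lost only when a part reaches the part p above it, and then `χ` has the factor p -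
-- p.
grow-strict : ∀ {μ a ν} → IsStrictPartition μ → (a , ν) ∈ grow μ → IsStrictPartition ν ⊎ ρ ν ≡ 0ℚ
grow-strict {[]}     s (here refl) = inj₁ (strict-cons (s≤s z≤n) [] s)
grow-strict {p ∷ ps} s (here refl) =
  inj₁ (strict-cons (s≤s z≤n) (All.map ℕ.m≤n⇒m≤1+n (strict-below s)) (strict-tail s))
grow-strict {p ∷ ps} s (there m) with ∈-map⁻ (map₂ (p ∷_)) m
... | (a , ν) , m′ , refl with grow-strict (strict-tail s) m′
... | inj₂ ρν≡0 = inj₂ (trans (cong (τ p * χ p ν *_) ρν≡0) (ℚ.*-zeroʳ (τ p * χ p ν)))
... | inj₁ sν   = cons ν sν (grow-≤ (strict-positive s) (strict-below s) m′)
  where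
  cons : ∀ ν → IsStrictPartition ν → All (_≤ p) ν → IsStrictPartition (p ∷ ν) ⊎ ρ (p ∷ ν) ≡ 0ℚ
  cons []       sν _          = inj₁ (strict-cons (strict-positive s) [] sν)
  cons (v ∷ vs) sν (v≤p ∷ _) with v ℕ.≟ p
  ... | no v≢p   = inj₁ (strict-cons (strict-positive s)
                     (v<p ∷ All.map (λ w<v → ℕ.<-trans w<v v<p) (strict-below sν)) sν)
    where v<p = ℕ.≤∧≢⇒< v≤p v≢p
  ... | yes refl = inj₂ (solve 5 (λ t v i c r → t :* ((v :- v) :* i :* c) :* r := con 0ℚ) refl
                     (τ v) (ι v) (inv (ι v + ι v)) (χ v vs) (ρ (v ∷ vs)))

-- Binomial coefficients as polynomials, and the average over one step

ι-C-suc : ∀ n k → ι (suc n C suc k) ≡ ι (n C k) + ι (n C suc k)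
ι-C-suc n k = trans (cong ι (sym (nCk+nC[k+1]≡[n+1]C[k+1] n k))) (ι-+ (n C k) (n C suc k))

ι-C2 : ∀ n → 2ℚ * ι (n C 2) ≡ ι n * ι n - ι n
ι-C2 zero    rewrite ι-0 = refl
ι-C2 (suc n) rewrite ι-C-suc n 1 | nC1≡n n | ι-suc n = begin
  2ℚ * (ι n + ι (n C 2))        ≡⟨ ℚ.*-distribˡ-+ 2ℚ (ι n) (ι (n C 2)) ⟩
  2ℚ * ι n + 2ℚ * ι (n C 2)     ≡⟨ cong (λ z → 2ℚ * ι n + z) (ι-C2 n) ⟩
  2ℚ * ι n + (ι n * ι n - ι n)
    ≡⟨ solve 1 (λ n → con 2ℚ :* n :+ (n :* n :- n) := (con 1ℚ :+ n) :* (con 1ℚ :+ n) :-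
         (con 1ℚ :+ n)) refl (ι n) ⟩
  (1ℚ + ι n) * (1ℚ + ι n) - (1ℚ + ι n) ∎
  where open ≡-Reasoning

ι-C3 : ∀ n → + 6 / 1 * ι (n C 3) ≡ ι n * (ι n - 1ℚ) * (ι n - 2ℚ)
ι-C3 zero    rewrite ι-0 = refl
ι-C3 (suc n) rewrite ι-C-suc n 2 | ι-suc n = begin
  + 6 / 1 * (ι (n C 2) + ι (n C 3))
    ≡⟨ solve 2 (λ x y → con (+ 6 / 1) :* (x :+ y) := con (+ 3 / 1) :* (con 2ℚ :* x) :+ con (+ 6 / 1)
         :* y)
         refl (ι (n C 2)) (ι (n C 3)) ⟩
  + 3 / 1 * (2ℚ * ι (n C 2)) + + 6 / 1 * ι (n C 3)
    ≡⟨ cong₂ (λ x y → + 3 / 1 * x + y) (ι-C2 n) (ι-C3 n) ⟩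
  + 3 / 1 * (ι n * ι n - ι n) + ι n * (ι n - 1ℚ) * (ι n - 2ℚ)
    ≡⟨ solve 1 (λ n → con (+ 3 / 1) :* (n :* n :- n) :+ n :* (n :- con 1ℚ) :* (n :- con 2ℚ)
         := (con 1ℚ :+ n) :* (con 1ℚ :+ n :- con 1ℚ) :* (con 1ℚ :+ n :- con 2ℚ)) refl (ι n) ⟩
  (1ℚ + ι n) * (1ℚ + ι n - 1ℚ) * (1ℚ + ι n - 2ℚ) ∎
  where open ≡-Reasoning

ι-C4 : ∀ n → + 24 / 1 * ι (n C 4) ≡ ι n * (ι n - 1ℚ) * (ι n - 2ℚ) * (ι n - + 3 / 1)
ι-C4 zero    rewrite ι-0 = refl
ι-C4 (suc n) rewrite ι-C-suc n 3 | ι-suc n = begin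
  + 24 / 1 * (ι (n C 3) + ι (n C 4))
    ≡⟨ solve 2 (λ x y → con (+ 24 / 1) :* (x :+ y) := con (+ 4 / 1) :* (con (+ 6 / 1) :* x) :+ con
         (+ 24 / 1) :* y)
         refl (ι (n C 3)) (ι (n C 4)) ⟩
  + 4 / 1 * (+ 6 / 1 * ι (n C 3)) + + 24 / 1 * ι (n C 4)
    ≡⟨ cong₂ (λ x y → + 4 / 1 * x + y) (ι-C3 n) (ι-C4 n) ⟩
  + 4 / 1 * (ι n * (ι n - 1ℚ) * (ι n - 2ℚ)) + ι n * (ι n - 1ℚ) * (ι n - 2ℚ) * (ι n - + 3 / 1)
    ≡⟨ solve 1 (λ n → con (+ 4 / 1) :* (n :* (n :- con 1ℚ) :* (n :- con 2ℚ)) :+ n :* (n :- con 1ℚ)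
         :* (n :- con 2ℚ) :* (n :- con (+ 3 / 1))
         := (con 1ℚ :+ n) :* (con 1ℚ :+ n :- con 1ℚ) :* (con 1ℚ :+ n :- con 2ℚ) :*
             (con 1ℚ :+ n :- con (+ 3 / 1))) refl (ι n) ⟩
  (1ℚ + ι n) * (1ℚ + ι n - 1ℚ) * (1ℚ + ι n - 2ℚ) * (1ℚ + ι n - + 3 / 1) ∎
  where open ≡-Reasoning

-- With φ = X a / 2 the left side is binom(c + 1, 4) at c = a + 1, which is φ (φ - 1) / 6.
ι-contentTerm : ∀ a → ι ((suc a ℕ.+ 1) C 4) ≡ + 1 / 24 * (X a * X a - 2ℚ * X a)
ι-contentTerm a = *-cancelˡ (+ 24 / 1) (λ ()) (begin
  + 24 / 1 * ι ((suc a ℕ.+ 1) C 4)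
    ≡⟨ ι-C4 (suc a ℕ.+ 1) ⟩
  ι m * (ι m - 1ℚ) * (ι m - 2ℚ) * (ι m - + 3 / 1)
    ≡⟨ cong (λ z → z * (z - 1ℚ) * (z - 2ℚ) * (z - + 3 / 1))
         (trans (ι-+ (suc a) 1) (cong₂ _+_ (ι-suc a) ι-1)) ⟩
  w * (w - 1ℚ) * (w - 2ℚ) * (w - + 3 / 1)
    ≡⟨ solve 1 (λ a → (con 1ℚ :+ a :+ con 1ℚ) :* (con 1ℚ :+ a :+ con 1ℚ :- con 1ℚ)
           :* (con 1ℚ :+ a :+ con 1ℚ :- con 2ℚ) :* (con 1ℚ :+ a :+ con 1ℚ :- con (+ 3 / 1))
         := con (+ 24 / 1) :* (con (+ 1 / 24) :*
             ((a :* a :+ a) :* (a :* a :+ a) :- con 2ℚ :* (a :* a :+ a))))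
         refl (ι a) ⟩
  + 24 / 1 * (+ 1 / 24 * (X a * X a - 2ℚ * X a)) ∎)
  where
  open ≡-Reasoning
  m = suc a ℕ.+ 1
  w = 1ℚ + ι a + 1ℚ

-- The right side of the theorem for size `s`, with `q` in the place of q₂.
value : ℕ → ℚ → ℚ → ℚ
value n s q = + 2 / 3 * ι (n C 3) + + 2 / 3 * s * ι (n C 2) + + 1 / 12 * (q + s * s - 2ℚ * s) * ι n

-- The induction step in n, apart from f: after a growth at a the bracket is a quadratic polynomial
-- in `X a`, and its average is known from the first two moments. The constant `c` is the same on
-- both sides although μ changes.
grow-value : ∀ {μ} → IsStrictPartition μ → ∀ n c →
  ∑[ aν ∈ grow μ ] (ρ (proj₂ aν) *
    (ι (contentSum (proj₂ aν)) - c + value n (ι (sum (proj₂ aν))) (cubes (proj₂ aν))))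
  ≡ ρ μ * (ι (contentSum μ) - c + value (suc n) (ι (sum μ)) (cubes μ))
grow-value {μ} st n c = begin
  ∑[ aν ∈ grow μ ] (ρ (proj₂ aν) *
      (ι (contentSum (proj₂ aν)) - c + value n (ι (sum (proj₂ aν))) (cubes (proj₂ aν))))
    ≡⟨ ∑-cong (grow μ) (λ {(a , ν)} m → cong (ρ ν *_) (expand m)) ⟩
  growSum μ (λ a → k₀ * 1ℚ + (k₁ * X a + k₂ * (X a * X a)))
    ≡⟨ trans (growSum-+ μ) (cong (λ z → growSum μ (λ _ → k₀ * 1ℚ) + z) (growSum-+ μ)) ⟩
  growSum μ (λ _ → k₀ * 1ℚ) + (growSum μ (λ a → k₁ * X a) + growSum μ (λ a → k₂ * (X a * X a)))
    ≡⟨ cong₂ _+_ (trans (growSum-*ˡ μ k₀) (cong (k₀ *_) (growSum-1 st)))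
         (cong₂ _+_ (trans (growSum-*ˡ μ k₁) (cong (k₁ *_) (growSum-X st)))
                    (trans (growSum-*ˡ μ k₂) (cong (k₂ *_) (growSum-X² st)))) ⟩
  k₀ * ρ μ + (k₁ * (ρ μ * (2ℚ * s)) + k₂ * (ρ μ * (2ℚ * (s * s + q))))
    ≡⟨ solve 8 (λ r f c s q N C2 C3 →
         (f :- c :+ (con (+ 2 / 3) :* C3 :+ con (+ 2 / 3) :* (con 1ℚ :+ s) :* C2 :+ con (+ 1 / 12)
             :* (q :+ s :* s) :* N)) :* r
           :+ ((con (+ 1 / 4) :* N :- con (+ 1 / 12)) :* (r :* (con 2ℚ :* s)) :+ con (+ 1 / 24) :*
               (r :* (con 2ℚ :* (s :* s :+ q)))) :=
         r :* (f :- c :+ (con (+ 2 / 3) :* (C2 :+ C3) :+ con (+ 2 / 3) :* s :* (N :+ C2)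
           :+ con (+ 1 / 12) :* (q :+ s :* s :- con 2ℚ :* s) :* (con 1ℚ :+ N))))
         refl (ρ μ) F c s q N (ι (n C 2)) (ι (n C 3)) ⟩
  ρ μ * (F - c + (+ 2 / 3 * (ι (n C 2) + ι (n C 3)) + + 2 / 3 * s * (N + ι (n C 2))
    + + 1 / 12 * (q + s * s - 2ℚ * s) * (1ℚ + N)))
    ≡⟨ cong (λ z → ρ μ * (F - c + z)) (cong₂ _+_ (cong₂ (λ x y → + 2 / 3 * x + + 2 / 3 * s * y)
         (ι-C-suc n 2) (trans (ι-C-suc n 1) (cong (λ k → ι k + ι (n C 2)) (nC1≡n n))))
         (cong (+ 1 / 12 * (q + s * s - 2ℚ * s) *_) (ι-suc n))) ⟨
  ρ μ * (F - c + value (suc n) s q) ∎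
  where
  open ≡-Reasoning
  F = ι (contentSum μ)
  s = ι (sum μ)
  q = cubes μ
  N = ι n
  -- Here q + 1 + (1 + s)² - 2 (1 + s) = q + s².
  k₀ = F - c + (+ 2 / 3 * ι (n C 3) + + 2 / 3 * (1ℚ + s) * ι (n C 2) + + 1 / 12 * (q + s * s) * N)
  -- 3/12 comes from the increment of the cubes, -2/24 from the content of the new box.
  k₁ = + 1 / 4 * N - + 1 / 12
  k₂ = + 1 / 24
  expand : ∀ {a ν} → (a , ν) ∈ grow μ →
    ι (contentSum ν) - c + value n (ι (sum ν)) (cubes ν) ≡ k₀ * 1ℚ + (k₁ * X a + k₂ * (X a * X a))
  expand {a} {ν} m = begin
    ι (contentSum ν) - c + value n (ι (sum ν)) (cubes ν)
      ≡⟨ cong₂ (λ z w → z - c + w)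
           (trans (cong ι (contentSum-grow m))
               (trans (ι-+ (contentSum μ) _) (cong (λ z → F + z) (ι-contentTerm a))))
           (cong₂ (value n) (trans (cong ι (sum-grow m)) (ι-suc (sum μ))) (cubes-grow m)) ⟩
    F + + 1 / 24 * (X a * X a - 2ℚ * X a) - c + value n (1ℚ + s) (q + (+ 3 / 1 * X a + 1ℚ))
      ≡⟨ solve 8 (λ x f c s q N C2 C3 →
           f :+ con (+ 1 / 24) :* (x :* x :- con 2ℚ :* x) :- c :+
               (con (+ 2 / 3) :* C3 :+ con (+ 2 / 3) :* (con 1ℚ :+ s) :* C2
             :+ con (+ 1 / 12) :* (q :+ (con (+ 3 / 1) :* x :+ con 1ℚ) :+ (con 1ℚ :+ s) :*
                 (con 1ℚ :+ s) :- con 2ℚ :* (con 1ℚ :+ s)) :* N) :=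
           (f :- c :+ (con (+ 2 / 3) :* C3 :+ con (+ 2 / 3) :* (con 1ℚ :+ s) :* C2 :+ con (+ 1 / 12)
               :* (q :+ s :* s) :* N)) :* con 1ℚ
             :+ ((con (+ 1 / 4) :* N :- con (+ 1 / 12)) :* x :+ con (+ 1 / 24) :* (x :* x)))
           refl (X a) F c s q N (ι (n C 2)) (ι (n C 3)) ⟩
    k₀ * 1ℚ + (k₁ * X a + k₂ * (X a * X a)) ∎

count : {A : Set} {P : A → Set} → Decidable P → List A → ℕ
count P? xs = length (filter P? xs)

count-++ : ∀ {A : Set} {P : A → Set} (P? : Decidable P) xs ys → count P? (xs ++ ys) ≡ count P? xs
    ℕ.+ count P? ys
count-++ P? xs ys = trans (cong length (List.filter-++ P? xs ys)) (List.length-++ (filter P? xs))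

-- Hook products

filter-map : ∀ {A B : Set} {P : B → Set} {Q : A → Set} (P? : Decidable P) (Q? : Decidable Q)
             (k : A → B) xs →
             (∀ {x} → x ∈ xs → P (k x) → Q x) → (∀ {x} → x ∈ xs → Q x → P (k x)) →
             filter P? (map k xs) ≡ map k (filter Q? xs)
filter-map P? Q? k []       to from = refl
filter-map P? Q? k (x ∷ xs) to from with P? (k x) | Q? x
... | yes _ | yes _ = cong (k x ∷_) (filter-map P? Q? k xs (to ∘ there) (from ∘ there))
... | no _  | no _  = filter-map P? Q? k xs (to ∘ there) (from ∘ there)
... | yes p | no ¬q = contradiction (to (here refl) p) ¬q
... | no ¬p | yes q = contradiction (from (here refl) q) ¬p

count-map : ∀ {A B : Set} {P : B → Set} {Q : A → Set} (P? : Decidable P) (Q? : Decidable Q)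
            (k : A → B) xs →
            (∀ {x} → x ∈ xs → P (k x) → Q x) → (∀ {x} → x ∈ xs → Q x → P (k x)) →
            count P? (map k xs) ≡ count Q? xs
count-map P? Q? k xs to from =
  trans (cong length (filter-map P? Q? k xs to from)) (List.length-map k (filter Q? xs))

count-none : ∀ {A : Set} {P : A → Set} (P? : Decidable P) xs → (∀ {x} → x ∈ xs → ¬ P x) → count P?
    xs ≡ 0
count-none P? xs none = cong length (List.filter-none P? (All.tabulate none))

∈-firstRow⁻ : ∀ {p b} → b ∈ firstRow p → ∃ λ k → k < p × b ≡ (1 , suc (suc k))
∈-firstRow⁻ m with ∈-map⁻ (λ k → 1 , 1 ℕ.+ k) m
... | _ , k∈ , refl with ∈-applyUpTo⁻ suc k∈
... | k , k<p , refl = k , k<p , refl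

boxes-positive : ∀ ps {b} → b ∈ boxes ps → 0 < row b × 0 < col b
boxes-positive ps m with ∈-boxes⁻ ps m
... | i , k , _ , _ , refl = s≤s z≤n , s≤s z≤n

boxCount : ∀ {P : Box → Set} (P? : Decidable P) p ps →
  count P? (boxes (p ∷ ps)) ≡ count P? (firstRow p) ℕ.+ count P? (map shift (boxes ps))
boxCount P? p ps = trans (cong (count P?) (boxes-∷ p ps)) (count-++ P? (firstRow p) _)

-- The first row meets neither the arm nor the leg of a lower box, and the extra term, the part with
-- the index of the column, is shifted together with the column.
hook-shift : ∀ p ps {b} → b ∈ boxes ps → hook (p ∷ ps) (shift b) ≡ hook ps b
hook-shift p ps {suc i , suc j} m = cong₂ (λ x y → suc (x ℕ.+ y ℕ.+ part ps (suc j)))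
  (trans (boxCount arm′? p ps) (cong₂ ℕ._+_
    (count-none arm′? (firstRow p) (λ x∈ (r , _) → noRow (∈-firstRow⁻ x∈) r))
    (count-map arm′? arm? shift (boxes ps)
      (λ _ (r , c) → ℕ.suc-injective r , ℕ.s≤s⁻¹ c) (λ _ (r , c) → cong suc r , s≤s c))))
  (trans (boxCount leg′? p ps) (cong₂ ℕ._+_
    (count-none leg′? (firstRow p) (λ x∈ (r , _) → noRow′ (∈-firstRow⁻ x∈) r))
    (count-map leg′? leg? shift (boxes ps)
      (λ _ (r , c) → ℕ.s≤s⁻¹ r , ℕ.suc-injective c) (λ _ (r , c) → s≤s r , cong suc c))))
  where
  arm? = λ b → (row b ℕ.≟ suc i) ×-dec (suc j ℕ.<? col b)
  leg? = λ b → (suc i ℕ.<? row b) ×-dec (col b ℕ.≟ suc j)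
  arm′? = λ b → (row b ℕ.≟ suc (suc i)) ×-dec (suc (suc j) ℕ.<? col b)
  leg′? = λ b → (suc (suc i) ℕ.<? row b) ×-dec (col b ℕ.≟ suc (suc j))
  noRow : ∀ {p b} → (∃ λ k → k < p × b ≡ (1 , suc (suc k))) → row b ≢ suc (suc i)
  noRow (_ , _ , refl) ()
  noRow′ : ∀ {p b} → (∃ λ k → k < p × b ≡ (1 , suc (suc k))) → ¬ (suc (suc i) < row b)
  noRow′ (_ , _ , refl) (s≤s ())
hook-shift p ps {zero , j}      m = contradiction (proj₁ (boxes-positive ps m)) λ ()
hook-shift p ps {suc i , zero}  m = contradiction (proj₂ (boxes-positive ps m)) λ ()

columnLength : List ℕ → ℕ → ℕ
columnLength ps j = count (λ (b : Box) → col b ℕ.≟ j) (boxes ps)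

countRow : ∀ {P : Box → Set} (P? : Decidable P) p {k} → k < p →
  (∀ {l} → k < l → P (1 , suc (suc l))) → (∀ {l} → P (1 , suc (suc l)) → k < l) →
  count P? (firstRow p) ≡ p ∸ suc k
countRow {P} P? (suc p) {k} k<p to from with k ℕ.<? p
... | yes k<p′ = begin
  count P? (firstRow (suc p))                            ≡⟨ cong (count P?) (firstRow-suc p) ⟩
  count P? (firstRow p ++ [ (1 , suc (suc p)) ])         ≡⟨ count-++ P? (firstRow p) [
      (1 , suc (suc p)) ] ⟩
  count P? (firstRow p) ℕ.+ count P? [ (1 , suc (suc p)) ]
    ≡⟨ cong₂ ℕ._+_ (countRow P? p k<p′ to from)
         (cong length (List.filter-accept P? {(1 , suc (suc p))} {[]} (to k<p′))) ⟩
  p ∸ suc k ℕ.+ 1                                        ≡⟨ ℕ.+-comm (p ∸ suc k) 1 ⟩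
  suc (p ∸ suc k)                                        ≡⟨ ℕ.+-∸-assoc 1 k<p′ ⟨
  p ∸ k                                                  ∎
  where open ≡-Reasoning
... | no k≮p = trans
  (count-none P? (firstRow (suc p)) (λ x∈ → none (∈-firstRow⁻ x∈)))
  (sym (ℕ.m≤n⇒m∸n≡0 (ℕ.≮⇒≥ k≮p)))
  where
  none : ∀ {b} → (∃ λ l → l < suc p × b ≡ (1 , suc (suc l))) → ¬ P b
  none (l , l<p , refl) px = k≮p (ℕ.<-≤-trans (from px) (ℕ.s≤s⁻¹ l<p))

columnLength-1 : ∀ ps → columnLength ps 1 ≡ 0
columnLength-1 ps = count-none (λ (b : Box) → col b ℕ.≟ 1) (boxes ps) none
  where
  none : ∀ {b} → b ∈ boxes ps → col b ≢ 1
  none m e with ∈-boxes⁻ ps m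
  ... | i , k , _ , _ , refl with trans (sym (ℕ.+-suc i k)) (ℕ.suc-injective e)
  ... | ()

columnLength-shift : ∀ ps k →
  count (λ (b : Box) → col b ℕ.≟ suc (suc k)) (map shift (boxes ps)) ≡ columnLength ps (suc k)
columnLength-shift ps k = count-map (λ b → col b ℕ.≟ suc (suc k)) (λ b → col b ℕ.≟ suc k) shift
    (boxes ps)
  (λ _ → ℕ.suc-injective) (λ _ → cong suc)

columnLength-beyond : ∀ {p k} ps → p ≤ k →
  columnLength (p ∷ ps) (suc (suc k)) ≡ columnLength ps (suc k)
columnLength-beyond {p} {k} ps p≤k = trans (boxCount (λ (b : Box) → col b ℕ.≟ suc (suc k)) p ps)
    (cong₂ ℕ._+_
  (count-none (λ (b : Box) → col b ℕ.≟ suc (suc k)) (firstRow p) (λ x∈ → none (∈-firstRow⁻ x∈)))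
  (columnLength-shift ps k))
  where
  none : ∀ {b} → (∃ λ l → l < p × b ≡ (1 , suc (suc l))) → col b ≢ suc (suc k)
  none (l , l<p , refl) refl = ℕ.<⇒≱ l<p p≤k

countOne : ∀ p {k} → k < p → count (λ (b : Box) → col b ℕ.≟ suc (suc k)) (firstRow p) ≡ 1
countOne (suc p) {k} k<p = trans (cong (count P?) (firstRow-suc p))
  (trans (count-++ P? (firstRow p) [ (1 , suc (suc p)) ]) last)
  where
  P? = λ (b : Box) → col b ℕ.≟ suc (suc k)
  last : count P? (firstRow p) ℕ.+ count P? [ (1 , suc (suc p)) ] ≡ 1
  last with p ℕ.≟ k
  ... | yes refl = cong₂ ℕ._+_
    (count-none P? (firstRow p) (λ x∈ → none (∈-firstRow⁻ x∈)))
    (cong length (List.filter-accept P? {(1 , suc (suc p))} {[]} refl))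
    where
    none : ∀ {b} → (∃ λ l → l < p × b ≡ (1 , suc (suc l))) → col b ≢ suc (suc p)
    none (l , l<p , refl) refl = ℕ.<-irrefl refl l<p
  ... | no p≢k = cong₂ ℕ._+_ (countOne p (ℕ.≤∧≢⇒< (ℕ.s≤s⁻¹ k<p) (p≢k ∘ sym)))
    (cong length (List.filter-reject P? {(1 , suc (suc p))} {[]} (λ { refl → p≢k refl })))

columnLength-within : ∀ {p k} ps → k < p →
  columnLength (p ∷ ps) (suc (suc k)) ≡ suc (columnLength ps (suc k))
columnLength-within {p} {k} ps k<p = trans (boxCount (λ (b : Box) → col b ℕ.≟ suc (suc k)) p ps)
    (cong₂ ℕ._+_ (countOne p k<p) (columnLength-shift ps k))

-- The hook in column k + 2 of a first row p. Column and part are those of the tail, hence the index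
-- k + 1. With p kept apart, the rows of the tail can be deleted one at a time.
rowHook : ℕ → List ℕ → ℕ → ℕ
rowHook p ps k = suc (p ∸ suc k ℕ.+ columnLength ps (suc k) ℕ.+ part ps (suc k))

hook-firstRow : ∀ {p k} ps → k < p → hook (p ∷ ps) (1 , suc (suc k)) ≡ rowHook p ps k
hook-firstRow {p} {k} ps k<p = cong₂ (λ x y → suc (x ℕ.+ y ℕ.+ part ps (suc k)))
  (trans (boxCount arm? p ps) (trans (cong₂ ℕ._+_
    (countRow arm? p k<p (λ k<l → refl , s≤s (s≤s k<l)) (λ (_ , c) → ℕ.s≤s⁻¹ (ℕ.s≤s⁻¹ c)))
    (count-none arm? (map shift (boxes ps)) (λ x∈ (r , _) → noRow (∈-map⁻ shift x∈) r)))
    (ℕ.+-identityʳ _)))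
  (trans (boxCount leg? p ps) (cong₂ ℕ._+_
    (count-none leg? (firstRow p) (λ x∈ (r , _) → noLeg (∈-firstRow⁻ x∈) r))
    (count-map leg? (λ b → col b ℕ.≟ suc k) shift (boxes ps)
      (λ _ (_ , c) → ℕ.suc-injective c) (λ m c → s≤s (proj₁ (boxes-positive ps m)) , cong suc c))))
  where
  arm? = λ b → (row b ℕ.≟ 1) ×-dec (suc (suc k) ℕ.<? col b)
  leg? = λ b → (1 ℕ.<? row b) ×-dec (col b ℕ.≟ suc (suc k))
  noRow : ∀ {b} → (∃ λ c → c ∈ boxes ps × b ≡ shift c) → row b ≢ 1
  noRow (c , m , refl) e = ℕ.<⇒≢ (proj₁ (boxes-positive ps m)) (sym (ℕ.suc-injective e))
  noLeg : ∀ {b} → (∃ λ l → l < p × b ≡ (1 , suc (suc l))) → ¬ (1 < row b)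
  noLeg (_ , _ , refl) (s≤s ())

∏ : (ℕ → ℕ) → ℕ → ℕ
∏ g n = product (applyUpTo g n)

∏-cong : ∀ {g h} n → (∀ {k} → k < n → g k ≡ h k) → ∏ g n ≡ ∏ h n
∏-cong zero    e = refl
∏-cong (suc n) e = cong₂ ℕ._*_ (e (s≤s z≤n)) (∏-cong n (e ∘ s≤s))

∏-+ : ∀ g m n → ∏ g (m ℕ.+ n) ≡ ∏ g m ℕ.* ∏ (g ∘ (m ℕ.+_)) n
∏-+ g zero    n = sym (ℕ.+-identityʳ _)
∏-+ g (suc m) n = trans (cong (g 0 ℕ.*_) (∏-+ (g ∘ ℕ.suc) m n)) (sym (ℕ.*-assoc (g 0) _ _))

H-∷ : ∀ p ps → H (p ∷ ps) ≡ ∏ (rowHook p ps) p ℕ.* H ps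
H-∷ p ps = begin
  product (map h (boxes (p ∷ ps)))                      ≡⟨ cong (product ∘ map h) (boxes-∷ p ps) ⟩
  product (map h (firstRow p ++ map shift (boxes ps)))  ≡⟨ cong product
      (List.map-++ h (firstRow p) _) ⟩
  product (map h (firstRow p) ++ map h (map shift (boxes ps)))
    ≡⟨ product-++ (map h (firstRow p)) _ ⟩
  product (map h (firstRow p)) ℕ.* product (map h (map shift (boxes ps)))
    ≡⟨ cong₂ ℕ._*_ first (cong product (trans (sym (List.map-∘ (boxes ps)))
         (List.map-cong-local (All.tabulate (hook-shift p ps))))) ⟩
  ∏ (rowHook p ps) p ℕ.* H ps ∎
  where
  open ≡-Reasoning
  h = hook (p ∷ ps)
  first : product (map h (firstRow p)) ≡ ∏ (rowHook p ps) p
  first = trans (cong (product ∘ map h) (List.map-applyUpTo suc (λ k → 1 , 1 ℕ.+ k) p))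
    (trans (cong product (List.map-applyUpTo (λ k → 1 , suc (suc k)) h p))
           (∏-cong p (hook-firstRow ps)))

columnLength-0 : ∀ {q k} ps → IsStrictPartition ps → All (_< q) ps → q ≤ k → columnLength ps (suc k)
    ≡ 0
columnLength-0             []       _ _         _   = refl
columnLength-0 {k = zero}  (r ∷ rs) _ (r<0 ∷ _) z≤n = contradiction r<0 λ ()
columnLength-0 {k = suc k} (r ∷ rs) s (r<q ∷ _) q≤k =
  trans (columnLength-beyond rs r≤k) (columnLength-0 rs (strict-tail s) (strict-below s) r≤k)
  where r≤k = ℕ.s≤s⁻¹ (ℕ.≤-trans r<q q≤k)

part-0 : ∀ {q k} ps → IsStrictPartition ps → All (_< q) ps → q ≤ k → part ps (suc k) ≡ 0
part-0             []       _ _         _   = refl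
part-0 {k = zero}  (r ∷ rs) _ (r<0 ∷ _) z≤n = contradiction r<0 λ ()
part-0 {k = suc k} (r ∷ rs) s (r<q ∷ _) q≤k =
  part-0 rs (strict-tail s) (strict-below s) (ℕ.s≤s⁻¹ (ℕ.≤-trans r<q q≤k))

-- The first hook is p + q; the next q ones are hooks for p and qs; the others,
-- which meet no row of qs, give (p - q - 1)! against (p - q)!.
∏-rowHook : ∀ q m qs → IsStrictPartition (q ∷ qs) →
  ∏ (rowHook (suc (q ℕ.+ m)) (q ∷ qs)) (suc (q ℕ.+ m)) ℕ.* suc m ≡
  (suc (q ℕ.+ m) ℕ.+ q) ℕ.* ∏ (rowHook (suc (q ℕ.+ m)) qs) (suc (q ℕ.+ m))
∏-rowHook q m qs s = begin
  g 0 ℕ.* ∏ (g ∘ ℕ.suc) (q ℕ.+ m) ℕ.* suc m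
    ≡⟨ cong₂ (λ x y → x ℕ.* y ℕ.* suc m) g0 (∏-+ (g ∘ ℕ.suc) q m) ⟩
  (suc (q ℕ.+ m) ℕ.+ q) ℕ.* (∏ (g ∘ ℕ.suc) q ℕ.* ∏ (g ∘ ℕ.suc ∘ (q ℕ.+_)) m) ℕ.* suc m
    ≡⟨ cong₂ (λ x y → (suc (q ℕ.+ m) ℕ.+ q) ℕ.* (x ℕ.* y) ℕ.* suc m) (∏-cong q near)
         (∏-cong m (λ {k} _ → far k)) ⟩
  (suc (q ℕ.+ m) ℕ.+ q) ℕ.* (∏ h q ℕ.* ∏ (h ∘ (q ℕ.+_) ∘ ℕ.suc) m) ℕ.* suc m
    ≡⟨ trans (ℕ.*-assoc (suc (q ℕ.+ m) ℕ.+ q) (∏ h q ℕ.* ∏ (h ∘ (q ℕ.+_) ∘ ℕ.suc) m) (suc m))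
         (cong ((suc (q ℕ.+ m) ℕ.+ q) ℕ.*_)
             (ℕ.*-assoc (∏ h q) (∏ (h ∘ (q ℕ.+_) ∘ ℕ.suc) m) (suc m))) ⟩
  (suc (q ℕ.+ m) ℕ.+ q) ℕ.* (∏ h q ℕ.* (∏ (h ∘ (q ℕ.+_) ∘ ℕ.suc) m ℕ.* suc m))
    ≡⟨ cong (λ z → (suc (q ℕ.+ m) ℕ.+ q) ℕ.* (∏ h q ℕ.* z))
         (trans (ℕ.*-comm (∏ (h ∘ (q ℕ.+_) ∘ ℕ.suc) m) (suc m))
             (cong (ℕ._* ∏ (h ∘ (q ℕ.+_) ∘ ℕ.suc) m) (sym hq))) ⟩
  (suc (q ℕ.+ m) ℕ.+ q) ℕ.* (∏ h q ℕ.* ∏ (h ∘ (q ℕ.+_)) (suc m))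
    ≡⟨ cong ((suc (q ℕ.+ m) ℕ.+ q) ℕ.*_)
         (trans (sym (∏-+ h q (suc m))) (cong (∏ h) (ℕ.+-suc q m))) ⟩
  (suc (q ℕ.+ m) ℕ.+ q) ℕ.* ∏ h (suc (q ℕ.+ m)) ∎
  where
  open ≡-Reasoning
  p = suc (q ℕ.+ m)
  g = rowHook p (q ∷ qs)
  h = rowHook p qs
  g0 : g 0 ≡ suc (q ℕ.+ m) ℕ.+ q
  g0 = cong (λ z → suc (z ℕ.+ q))
      (trans (cong (q ℕ.+ m ℕ.+_) (columnLength-1 (q ∷ qs))) (ℕ.+-identityʳ _))
  near : ∀ {k} → k < q → g (suc k) ≡ h k
  near {k} k<q = cong (λ z → suc (z ℕ.+ part qs (suc k))) (begin
    q ℕ.+ m ∸ suc k ℕ.+ columnLength (q ∷ qs) (suc (suc k))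
      ≡⟨ cong (q ℕ.+ m ∸ suc k ℕ.+_) (columnLength-within qs k<q) ⟩
    q ℕ.+ m ∸ suc k ℕ.+ suc (columnLength qs (suc k))
      ≡⟨ ℕ.+-suc _ _ ⟩
    suc (q ℕ.+ m ∸ suc k) ℕ.+ columnLength qs (suc k)
      ≡⟨ cong (ℕ._+ columnLength qs (suc k))
           (ℕ.+-∸-assoc 1 {q ℕ.+ m} {suc k} (ℕ.≤-trans k<q (ℕ.m≤m+n q m))) ⟨
    q ℕ.+ m ∸ k ℕ.+ columnLength qs (suc k) ∎)
  h-beyond : ∀ k → q ≤ k → h k ≡ suc (p ∸ suc k)
  h-beyond k q≤k rewrite columnLength-0 qs (strict-tail s) (strict-below s) q≤k
                       | part-0 qs (strict-tail s) (strict-below s) q≤k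
    = cong suc (trans (ℕ.+-identityʳ _) (ℕ.+-identityʳ _))
  far : ∀ k → g (suc (q ℕ.+ k)) ≡ h (q ℕ.+ suc k)
  far k = begin
    suc (p ∸ suc (suc (q ℕ.+ k)) ℕ.+ columnLength (q ∷ qs) (suc (suc (q ℕ.+ k))) ℕ.+ part qs
        (suc (q ℕ.+ k)))
      ≡⟨ cong₂ (λ x y → suc (p ∸ suc (suc (q ℕ.+ k)) ℕ.+ x ℕ.+ y))
           (trans (columnLength-beyond qs q≤)
               (columnLength-0 qs (strict-tail s) (strict-below s) q≤))
           (part-0 qs (strict-tail s) (strict-below s) q≤) ⟩
    suc (p ∸ suc (suc (q ℕ.+ k)) ℕ.+ 0 ℕ.+ 0)
      ≡⟨ cong suc (trans (ℕ.+-identityʳ _) (ℕ.+-identityʳ _)) ⟩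
    suc (p ∸ suc (suc (q ℕ.+ k)))
      ≡⟨ cong (λ z → suc (p ∸ suc z)) (ℕ.+-suc q k) ⟨
    suc (p ∸ suc (q ℕ.+ suc k))
      ≡⟨ h-beyond (q ℕ.+ suc k) (ℕ.m≤m+n q (suc k)) ⟨
    h (q ℕ.+ suc k) ∎
    where q≤ = ℕ.m≤m+n q k
  -- The only factor of `h` without a partner in `g` is p - q = m + 1.
  hq : h (q ℕ.+ 0) ≡ suc m
  hq = trans (h-beyond (q ℕ.+ 0) (ℕ.m≤m+n q 0))
    (cong suc (trans (cong (q ℕ.+ m ∸_) (ℕ.+-identityʳ q)) (ℕ.m+n∸m≡n q m)))

∏-rowHook-[] : ∀ p → ∏ (rowHook p []) p ≡ p !
∏-rowHook-[] zero    = refl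
∏-rowHook-[] (suc p) = cong₂ ℕ._*_ (cong suc (trans (ℕ.+-identityʳ _) (ℕ.+-identityʳ p)))
    (∏-rowHook-[] p)

-- Deleting a row q of the tail multiplies the hook product of the first row by (p - q)/(p + q), and
-- a row standing alone has hook product p!.
χ-rowHook : ∀ {p} ps → 0 < p → IsStrictPartition ps → All (_< p) ps →
            χ p ps * ι (∏ (rowHook p ps) p) ≡ ι (p !)
χ-rowHook {p} []       _   _ _         = trans (ℚ.*-identityˡ _) (cong ι (∏-rowHook-[] p))
χ-rowHook {p} (q ∷ qs) 0<p s (q<p ∷ qs<p) = begin
  (ι p - ι q) * inv (ι p + ι q) * χ p qs * ι (∏ (rowHook p (q ∷ qs)) p)
    ≡⟨ solve 4 (λ d i c r → d :* i :* c :* r := i :* c :* (r :* d)) refl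
         (ι p - ι q) (inv (ι p + ι q)) (χ p qs) (ι (∏ (rowHook p (q ∷ qs)) p)) ⟩
  inv (ι p + ι q) * χ p qs * (ι (∏ (rowHook p (q ∷ qs)) p) * (ι p - ι q))
    ≡⟨ cong (inv (ι p + ι q) * χ p qs *_) (step p q<p) ⟩
  inv (ι p + ι q) * χ p qs * ((ι p + ι q) * ι (∏ (rowHook p qs) p))
    ≡⟨ solve 4 (λ s i c r → i :* c :* (s :* r) := s :* i :* (c :* r)) refl
         (ι p + ι q) (inv (ι p + ι q)) (χ p qs) (ι (∏ (rowHook p qs) p)) ⟩
  (ι p + ι q) * inv (ι p + ι q) * (χ p qs * ι (∏ (rowHook p qs) p))
    ≡⟨ cong₂ _*_ (inv-inverse (ι+ι≢0 0<p)) (χ-rowHook qs 0<p (strict-tail s) qs<p) ⟩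
  1ℚ * ι (p !)
    ≡⟨ ℚ.*-identityˡ (ι (p !)) ⟩
  ι (p !) ∎
  where
  open ≡-Reasoning
  step : ∀ p → q < p → ι (∏ (rowHook p (q ∷ qs)) p) * (ι p - ι q) ≡ (ι p + ι q) * ι
      (∏ (rowHook p qs) p)
  step p q<p with ℕ.m≤n⇒∃[o]m+o≡n q<p
  ... | m , refl = begin
    ι (∏ (rowHook p (q ∷ qs)) p) * (ι p - ι q)
      ≡⟨ cong (ι (∏ (rowHook p (q ∷ qs)) p) *_) (trans (sym (ι-∸ (ℕ.<⇒≤ q<p)))
           (cong ι (trans (cong (_∸ q) (sym (ℕ.+-suc q m))) (ℕ.m+n∸m≡n q (suc m))))) ⟩
    ι (∏ (rowHook p (q ∷ qs)) p) * ι (suc m)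
      ≡⟨ sym (ι-* (∏ (rowHook p (q ∷ qs)) p) (suc m)) ⟩
    ι (∏ (rowHook p (q ∷ qs)) p ℕ.* suc m)
      ≡⟨ cong ι (∏-rowHook q m qs s) ⟩
    ι ((p ℕ.+ q) ℕ.* ∏ (rowHook p qs) p)
      ≡⟨ trans (ι-* (p ℕ.+ q) _) (cong (_* ι (∏ (rowHook p qs) p)) (ι-+ p q)) ⟩
    (ι p + ι q) * ι (∏ (rowHook p qs) p) ∎

τ-! : ∀ p → τ p * ι (p !) ≡ ½ * ι (2 ^ p)
τ-! zero    = refl
τ-! (suc p) = begin
  τ p * (2ℚ * inv (ι (suc p))) * ι (suc p ℕ.* p !)
    ≡⟨ cong (τ p * (2ℚ * inv (ι (suc p))) *_) (ι-* (suc p) (p !)) ⟩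
  τ p * (2ℚ * inv (ι (suc p))) * (ι (suc p) * ι (p !))
    ≡⟨ solve 4 (λ t i s f → t :* (con 2ℚ :* i) :* (s :* f) := s :* i :* (con 2ℚ :* (t :* f))) refl
         (τ p) (inv (ι (suc p))) (ι (suc p)) (ι (p !)) ⟩
  ι (suc p) * inv (ι (suc p)) * (2ℚ * (τ p * ι (p !)))
    ≡⟨ cong₂ (λ x y → x * (2ℚ * y)) (inv-inverse (ι≢0 (suc p))) (τ-! p) ⟩
  1ℚ * (2ℚ * (½ * ι (2 ^ p)))
    ≡⟨ solve 1 (λ x → con 1ℚ :* (con 2ℚ :* (con ½ :* x)) := con ½ :* (x :+ (x :+ con 0ℚ))) refl
         (ι (2 ^ p)) ⟩
  ½ * (ι (2 ^ p) + (ι (2 ^ p) + 0ℚ))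
    ≡⟨ cong (½ *_) (trans (ι-+ (2 ^ p) _)
         (cong (λ z → ι (2 ^ p) + z) (trans (ι-+ (2 ^ p) 0) (cong (λ z → ι (2 ^ p) + z) ι-0)))) ⟨
  ½ * ι (2 ^ suc p) ∎
  where open ≡-Reasoning

length≤sum : ∀ ps → IsStrictPartition ps → length ps ≤ sum ps
length≤sum []       _ = z≤n
length≤sum (p ∷ ps) s = ℕ.+-mono-≤ (strict-positive s) (length≤sum ps (strict-tail s))

-- Row by row: the first row has hook product p! / χ, which `τ p` and `χ` turn into 2^(p - 1).
ρ-hook : ∀ ps → IsStrictPartition ps → ρ ps * ι (H ps) ≡ ι (2 ^ (sum ps ∸ length ps))
ρ-hook []       _ rewrite ι-1 = refl
ρ-hook (p ∷ ps) s = begin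
  τ p * χ p ps * ρ ps * ι (H (p ∷ ps))
    ≡⟨ cong (τ p * χ p ps * ρ ps *_) (trans (cong ι (H-∷ p ps)) (ι-* (∏ (rowHook p ps) p) (H ps))) ⟩
  τ p * χ p ps * ρ ps * (ι (∏ (rowHook p ps) p) * ι (H ps))
    ≡⟨ solve 5 (λ t c r w h → t :* c :* r :* (w :* h) := t :* (c :* w) :* (r :* h)) refl
         (τ p) (χ p ps) (ρ ps) (ι (∏ (rowHook p ps) p)) (ι (H ps)) ⟩
  τ p * (χ p ps * ι (∏ (rowHook p ps) p)) * (ρ ps * ι (H ps))
    ≡⟨ cong₂ (λ x y → τ p * x * y)
         (χ-rowHook ps (strict-positive s) (strict-tail s) (strict-below s))
         (ρ-hook ps (strict-tail s)) ⟩
  τ p * ι (p !) * ι (2 ^ (sum ps ∸ length ps))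
    ≡⟨ cong (_* ι (2 ^ (sum ps ∸ length ps))) (trans (τ-! p) (halve p (strict-positive s))) ⟩
  ι (2 ^ (p ∸ 1)) * ι (2 ^ (sum ps ∸ length ps))
    ≡⟨ trans (sym (ι-* (2 ^ (p ∸ 1)) _))
         (cong ι (sym (ℕ.^-distribˡ-+-* 2 (p ∸ 1) (sum ps ∸ length ps)))) ⟩
  ι (2 ^ (p ∸ 1 ℕ.+ (sum ps ∸ length ps)))
    ≡⟨ cong (λ z → ι (2 ^ z)) (exponent p (strict-positive s)) ⟩
  ι (2 ^ (p ℕ.+ sum ps ∸ suc (length ps))) ∎
  where
  open ≡-Reasoning
  exponent : ∀ p → 0 < p → p ∸ 1 ℕ.+ (sum ps ∸ length ps) ≡ p ℕ.+ sum ps ∸ suc (length ps)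
  exponent (suc p) _ = sym (ℕ.+-∸-assoc p (length≤sum ps (strict-tail s)))
  halve : ∀ p → 0 < p → ½ * ι (2 ^ p) ≡ ι (2 ^ (p ∸ 1))
  halve (suc p) _ = begin
    ½ * ι (2 ^ suc p)
      ≡⟨ cong (½ *_) (ι-* 2 (2 ^ p)) ⟩
    ½ * (ι 2 * ι (2 ^ p))
      ≡⟨ cong (λ z → ½ * (z * ι (2 ^ p))) (trans (ι-suc 1) (cong (λ z → 1ℚ + z) ι-1)) ⟩
    ½ * (2ℚ * ι (2 ^ p))
      ≡⟨ solve 1 (λ x → con ½ :* (con 2ℚ :* x) := x) refl (ι (2 ^ p)) ⟩
    ι (2 ^ p) ∎

-- Standard fillings

unique⇒↭ : {A : Set} {xs ys : List A} → Unique xs → Unique ys →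
           (∀ {z} → z ∈ xs → z ∈ ys) → (∀ {z} → z ∈ ys → z ∈ xs) → xs ↭ ys
unique⇒↭ u v to from = ∼bag⇒↭ (unique∧set⇒bag u v (mk⇔ to from))

length-concatMap : {A B : Set} (k : A → List B) (xs : List A) →
                   length (concatMap k xs) ≡ sum (map (length ∘ k) xs)
length-concatMap k []       = refl
length-concatMap k (x ∷ xs) = trans (List.length-++ (k x))
    (cong (length (k x) ℕ.+_) (length-concatMap k xs))

-- Fillings are compared through their codes, so pointwise equality is enough and no function
-- extensionality is assumed.
funToFin-cong : ∀ {m n} {S T : Fin m → Fin n} → S ≗ T → funToFin S ≡ funToFin T
funToFin-cong {zero}  e = refl
funToFin-cong {suc m} e = cong₂ combine (e zero) (funToFin-cong (e ∘ suc))

-- The row and column conditions on a filling become monotonicity along this single relation.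
Before : Box → Box → Set
Before b c = (row b ≡ row c × col b < col c) ⊎ (col b ≡ col c × row b < row c)

before? : ∀ b c → Dec (Before b c)
before? b c = ((row b ℕ.≟ row c) ×-dec (col b ℕ.<? col c)) ⊎-dec
    ((col b ℕ.≟ col c) ×-dec (row b ℕ.<? row c))

¬Before-refl : ∀ b → ¬ Before b b
¬Before-refl b (inj₁ (_ , lt)) = ℕ.<-irrefl refl lt
¬Before-refl b (inj₂ (_ , lt)) = ℕ.<-irrefl refl lt

-- The boxes form a family indexed by `Fin n` here, so that deleting one is composition with
-- `punchIn`.
record Standard {n} (v : Fin n → Box) (T : Fin n → Fin n) : Set where
  constructor standard
  field
    injective  : ∀ i j → T i ≡ T j → i ≡ j
    surjective : ∀ c → ∃ λ i → T i ≡ c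
    monotone   : ∀ i j → Before (v i) (v j) → T i Fin.< T j

open Standard

standard? : ∀ {n} (v : Fin n → Box) → Decidable (Standard v)
standard? v T with Fin.all? (λ i → Fin.all? λ j → (T i Fin.≟ T j) →-dec (i Fin.≟ j))
                 | Fin.all? (λ c → Fin.any? λ i → T i Fin.≟ c)
                 | Fin.all? (λ i → Fin.all? λ j → before? (v i) (v j) →-dec (T i Fin.<? T j))
... | yes p | yes q | yes r = yes (standard p q r)
... | no ¬p | _     | _     = no (¬p ∘ injective)
... | _     | no ¬q | _     = no (¬q ∘ surjective)
... | _     | _     | no ¬r = no (¬r ∘ monotone)

standard-resp : ∀ {n} {v w : Fin n → Box} {S T} → v ≗ w → S ≗ T → Standard v S → Standard w T
standard-resp {v = v} {w} {S} {T} v≗w S≗T s = record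
  { injective  = λ i j e → injective s i j (trans (S≗T i) (trans e (sym (S≗T j))))
  ; surjective = λ c → proj₁ (surjective s c) , trans (sym (S≗T _)) (proj₂ (surjective s c))
  ; monotone   = λ i j b → subst₂< (S≗T i) (S≗T j)
      (monotone s i j (resp (sym (v≗w i)) (sym (v≗w j)) b))
  }
  where
  subst₂< : ∀ {i j k l} → i ≡ j → k ≡ l → i Fin.< k → j Fin.< l
  subst₂< refl refl lt = lt
  resp : ∀ {a b c d} → a ≡ b → c ≡ d → Before a c → Before b d
  resp refl refl lt = lt

standards : ∀ {n} → (Fin n → Box) → List (Fin (n ^ n))
standards {n} v = filter (standard? v ∘ finToFun) (allFin (n ^ n))

standards-cong : ∀ {m n} (e : m ≡ n) {v : Fin m → Box} {w : Fin n → Box} →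
                 (∀ i → v i ≡ w (cast e i)) → length (standards v) ≡ length (standards w)
standards-cong {m} refl {v} {w} e = cong length
    (List.filter-≐ (standard? v ∘ finToFun) (standard? w ∘ finToFun)
  (standard-resp e′ (λ _ → refl) , standard-resp (sym ∘ e′) (λ _ → refl)) (allFin (m ^ m)))
  where
  e′ : v ≗ w
  e′ i = trans (e i) (cong w (Fin.cast-is-id refl i))

countStandard-lookup : ∀ bs → countStandard bs ≡ length (standards (lookup bs))
countStandard-lookup bs = cong length
    (List.filter-≐ (isStandard? bs ∘ finToFun) (standard? (lookup bs) ∘ finToFun)
  (to , from) (allFin (length bs ^ length bs)))
  where
  to : ∀ {T} → IsStandard bs T → Standard (lookup bs) T
  to s = record
    { injective  = λ i j → proj₁ bijective
    ; surjective = surjective⇒strictlySurjective (proj₂ bijective)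
    ; monotone   = λ { i j (inj₁ (r , c)) → rows i j r c ; i j (inj₂ (c , r)) → columns i j c r }
    }
    where open IsStandard s
  from : ∀ {T} → Standard (lookup bs) T → IsStandard bs T
  from s = record
    { bijective = (λ {i} {j} → injective s i j) , strictlySurjective⇒surjective (surjective s)
    ; rows      = λ i j r c → monotone s i j (inj₁ (r , c))
    ; columns   = λ i j c r → monotone s i j (inj₂ (c , r))
    }

countStandard-tabulate : ∀ {n} (v : Fin n → Box) → countStandard (tabulate v) ≡ length (standards v)
countStandard-tabulate v = trans (countStandard-lookup (tabulate v))
  (sym (standards-cong (sym (List.length-tabulate v)) (sym ∘ List.lookup-tabulate v)))

data View {n} (a : Fin (suc n)) : Fin (suc n) → Set where
  same  : View a a
  other : ∀ i → View a (punchIn a i)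

view : ∀ {n} (a x : Fin (suc n)) → View a x
view a x with a Fin.≟ x
... | yes refl = same
... | no a≢x   = subst (View a) (Fin.punchIn-punchOut a≢x) (other (punchOut a≢x))

-- The inverse of deleting the least entry, which stood at `a`, and lowering the others.
insert : ∀ {n} → Fin (suc n) → (Fin n → Fin n) → Fin (suc n) → Fin (suc n)
insert a T x with a Fin.≟ x
... | yes _  = zero
... | no a≢x = suc (T (punchOut a≢x))

insert-same : ∀ {n} a (T : Fin n → Fin n) → insert a T a ≡ zero
insert-same a T with a Fin.≟ a
... | yes _  = refl
... | no a≢a = contradiction refl a≢a

insert-other : ∀ {n} a (T : Fin n → Fin n) i → insert a T (punchIn a i) ≡ suc (T i)
insert-other a T i with a Fin.≟ punchIn a i
... | yes e  = contradiction (sym e) (Fin.punchInᵢ≢i a i)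
... | no a≢x = cong (suc ∘ T) (trans (Fin.punchOut-cong a refl) (Fin.punchOut-punchIn a))

insert-cong : ∀ {n} a {S T : Fin n → Fin n} → S ≗ T → insert a S ≗ insert a T
insert-cong a e x with a Fin.≟ x
... | yes _  = refl
... | no a≢x = cong suc (e (punchOut a≢x))

module _ {n} (v : Fin (suc n) → Box) where

  -- The positions where the least entry of a standard filling can stand.
  Source : Fin (suc n) → Set
  Source a = ∀ j → ¬ Before (v j) (v a)

  source? : Decidable Source
  source? a = Fin.all? (λ j → ¬? (before? (v j) (v a)))

  insert-standard : ∀ {a T} → Source a → Standard (v ∘ punchIn a) T → Standard v (insert a T)
  insert-standard {a} {T} src s = standard inj sur mon
    where
    inj : ∀ x y → insert a T x ≡ insert a T y → x ≡ y
    inj x y e with view a x | view a y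
    ... | same    | same    = refl
    ... | same    | other j with trans (sym (insert-same a T)) (trans e (insert-other a T j))
    ... | ()
    inj x y e | other i | same with trans (sym (insert-other a T i)) (trans e (insert-same a T))
    ... | ()
    inj x y e | other i | other j = cong (punchIn a) (injective s i j
      (Fin.suc-injective (trans (sym (insert-other a T i)) (trans e (insert-other a T j)))))
    sur : ∀ c → ∃ λ x → insert a T x ≡ c
    sur zero    = a , insert-same a T
    sur (suc c) with surjective s c
    ... | i , refl = punchIn a i , insert-other a T i
    mon : ∀ x y → Before (v x) (v y) → insert a T x Fin.< insert a T y
    mon x y b with view a x | view a y
    ... | _       | same    = contradiction b (src x)
    ... | same    | other j rewrite insert-same a T | insert-other a T j = s≤s z≤n
    ... | other i | other j rewrite insert-other a T i | insert-other a T j = s≤s (monotone s i j b)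

  module _ {T} (s : Standard v T) where
    least : Fin (suc n)
    least = proj₁ (surjective s zero)

    least-zero : T least ≡ zero
    least-zero = proj₂ (surjective s zero)

    least-source : Source least
    least-source j b with subst (T j Fin.<_) least-zero (monotone s j least b)
    ... | ()

    others≢0 : ∀ i → zero ≢ T (punchIn least i)
    others≢0 i e = Fin.punchInᵢ≢i least i (injective s _ _ (trans (sym e) (sym least-zero)))

    others : Fin n → Fin n
    others i = punchOut (others≢0 i)

    suc-others : ∀ i → suc (others i) ≡ T (punchIn least i)
    suc-others i = Fin.punchIn-punchOut (others≢0 i)

    others-standard : Standard (v ∘ punchIn least) others
    others-standard = standard
      (λ i j e → Fin.punchIn-injective least i j (injective s _ _
        (trans (sym (suc-others i)) (trans (cong suc e) (suc-others j)))))
      sur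
      (λ i j b → ℕ.s≤s⁻¹ (subst₂< (sym (suc-others i)) (sym (suc-others j)) (monotone s _ _ b)))
      where
      subst₂< : ∀ {m} {i j k l : Fin m} → i ≡ j → k ≡ l → i Fin.< k → j Fin.< l
      subst₂< refl refl lt = lt
      sur : ∀ c → ∃ λ i → others i ≡ c
      sur c with surjective s (suc c)
      ... | x , e with view least x
      ... | same with trans (sym least-zero) e
      ... | ()
      sur c | _ , e | other i = i , Fin.suc-injective (trans (suc-others i) e)

    insert-others : insert least others ≗ T
    insert-others x with view least x
    ... | same    = trans (insert-same least others) (sym least-zero)
    ... | other i = trans (insert-other least others i) (suc-others i)

  extend : Fin (suc n) → Fin (n ^ n) → Fin (suc n ^ suc n)
  extend a c = funToFin (insert a (finToFun c))

  extensionsAt : Fin (suc n) → List (Fin (suc n ^ suc n))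
  extensionsAt a = map (extend a) (standards (v ∘ punchIn a))

  extend-fun : ∀ a c → finToFun (extend a c) ≗ insert a (finToFun c)
  extend-fun a c = Fin.finToFun-funToFin (insert a (finToFun c))

  extend-injective : ∀ a {c d} → extend a c ≡ extend a d → c ≡ d
  extend-injective a {c} {d} e = begin
    c                                      ≡⟨ Fin.funToFin-finToFin {n} {n} c ⟨
    funToFin (finToFun {n} {n} c)          ≡⟨ funToFin-cong pointwise ⟩
    funToFin (finToFun {n} {n} d)          ≡⟨ Fin.funToFin-finToFin {n} {n} d ⟩
    d                                      ∎
    where
    open ≡-Reasoning
    pointwise : finToFun {n} {n} c ≗ finToFun d
    pointwise i = Fin.suc-injective (begin
      suc (finToFun c i)                     ≡⟨ insert-other a (finToFun c) i ⟨
      insert a (finToFun c) (punchIn a i)    ≡⟨ extend-fun a c (punchIn a i) ⟨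
      finToFun (extend a c) (punchIn a i)    ≡⟨ cong
          (λ z → finToFun {suc n} {suc n} z (punchIn a i)) e ⟩
      finToFun (extend a d) (punchIn a i)    ≡⟨ extend-fun a d (punchIn a i) ⟩
      insert a (finToFun d) (punchIn a i)    ≡⟨ insert-other a (finToFun d) i ⟩
      suc (finToFun d i)                     ∎)

  extensionsAt-zero : ∀ {a x} → x ∈ extensionsAt a → finToFun {suc n} {suc n} x a ≡ zero
  extensionsAt-zero {a} m with ∈-map⁻ (extend a) m
  ... | c , _ , refl = trans (extend-fun a c a) (insert-same a (finToFun c))

  -- A standard filling is determined by the position of its least entry and by
  -- the remaining entries, lowered by one.
  standards-↭ : standards v ↭ concatMap extensionsAt (filter source? (allFin (suc n)))
  standards-↭ = unique⇒↭
    (Unique.filter⁺ (standard? v ∘ finToFun) (Unique.allFin⁺ (suc n ^ suc n)))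
    (Unique.concat⁺
      (All.map⁺ (All.universal (λ a → Unique.map⁺ (extend-injective a)
        (Unique.filter⁺ (standard? (v ∘ punchIn a) ∘ finToFun) (Unique.allFin⁺ (n ^ n)))) sources))
      (AllPairs.map⁺ (AllPairs.map disjoint (Unique.filter⁺ source? (Unique.allFin⁺ (suc n))))))
    to from
    where
    sources = filter source? (allFin (suc n))
    -- A common code would be zero at both `a` and `b`, but an inserted filling is zero only at its
    -- source.
    disjoint : ∀ {a b} → a ≢ b → Disjoint (extensionsAt a) (extensionsAt b)
    disjoint {a} {b} a≢b {x} (p , q) with ∈-map⁻ (extend a) p
    ... | c , _ , refl with view a b
    ... | same    = a≢b refl
    ... | other i with trans (sym (extensionsAt-zero q))
        (trans (extend-fun a c (punchIn a i)) (insert-other a (finToFun c) i))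
    ... | ()
    to : ∀ {x} → x ∈ standards v → x ∈ concatMap extensionsAt sources
    to {x} m = ∈-concatMap⁺ extensionsAt (lose
      (∈-filter⁺ source? (∈-allFin (least s)) (least-source s))
      (subst (_∈ extensionsAt (least s)) code
        (∈-map⁺ (extend (least s)) (∈-filter⁺ (standard? _ ∘ finToFun) (∈-allFin c)
          (standard-resp (λ _ → refl) (sym ∘ Fin.finToFun-funToFin (others s))
              (others-standard s))))))
      where
      s = proj₂ (∈-filter⁻ (standard? v ∘ finToFun) {xs = allFin (suc n ^ suc n)} m)
      c = funToFin (others s)
      code : extend (least s) c ≡ x
      code = trans (funToFin-cong (λ y → trans
               (insert-cong (least s) (Fin.finToFun-funToFin (others s)) y) (insert-others s y)))
             (Fin.funToFin-finToFin {suc n} {suc n} x)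
    from : ∀ {x} → x ∈ concatMap extensionsAt sources → x ∈ standards v
    from m with find (∈-concatMap⁻ extensionsAt {xs = sources} m)
    ... | a , a∈ , x∈ with ∈-map⁻ (extend a) x∈
    ... | c , c∈ , refl = ∈-filter⁺ (standard? v ∘ finToFun) (∈-allFin (extend a c))
      (standard-resp (λ _ → refl) (sym ∘ extend-fun a c)
        (insert-standard (proj₂ (∈-filter⁻ source? {xs = allFin (suc n)} a∈))
          (proj₂ (∈-filter⁻ (standard? (v ∘ punchIn a) ∘ finToFun) {xs = allFin (n ^ n)} c∈))))

  length-standards : length (standards v) ≡
    sum (map (λ a → length (standards (v ∘ punchIn a))) (filter source? (allFin (suc n))))
  length-standards = trans (↭.↭-length standards-↭) (trans
    (length-concatMap extensionsAt (filter source? (allFin (suc n))))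
    (cong sum (List.map-cong (λ a → List.length-map (extend a) (standards (v ∘ punchIn a)))
        (filter source? (allFin (suc n))))))

remove : Box → List Box → List Box
remove b = filter (λ c → ¬? (c ≟ᵇ b))

remove-tabulate : ∀ {n} (v : Fin (suc n) → Box) → (∀ {i j} → v i ≡ v j → i ≡ j) →
                  ∀ a → remove (v a) (tabulate v) ≡ tabulate (v ∘ punchIn a)
remove-tabulate v inj zero = trans
  (List.filter-reject (λ c → ¬? (c ≟ᵇ v zero)) (λ ne → ne refl))
  (List.filter-all (λ c → ¬? (c ≟ᵇ v zero)) (All.tabulate⁺ (λ i e → contradiction (inj e) λ ())))
remove-tabulate {suc n} v inj (suc a) = trans
  (List.filter-accept (λ c → ¬? (c ≟ᵇ v (suc a))) (λ e → contradiction (inj e) λ ()))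
  (cong (v zero ∷_) (remove-tabulate (v ∘ suc) (Fin.suc-injective ∘ inj) a))

Minimal : List Box → Box → Set
Minimal bs b = All (λ c → ¬ Before c b) bs

minimal? : ∀ bs → Decidable (Minimal bs)
minimal? bs b = All.all? (λ c → ¬? (before? c b)) bs

lookup-injective : ∀ {A : Set} {xs : List A} → Unique xs →
                   ∀ {i j} → lookup xs i ≡ lookup xs j → i ≡ j
lookup-injective (_ ∷ u)  {zero}  {zero}  e = refl
lookup-injective (x∉ ∷ u) {zero}  {suc j} e = contradiction e (All.lookup x∉ (∈-lookup j))
lookup-injective (x∉ ∷ u) {suc i} {zero}  e = contradiction (sym e) (All.lookup x∉ (∈-lookup i))
lookup-injective (_ ∷ u)  {suc i} {suc j} e = cong suc (lookup-injective u e)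

-- The least entry sits in a minimal box, and the rest is a standard filling of the remaining boxes.
-- The list must be inhabited: the empty one has a single filling but no minimal box.
countStandard-minimal : ∀ {b bs} → b ∈ bs → Unique bs →
  countStandard bs ≡ sum (map (λ c → countStandard (remove c bs)) (filter (minimal? bs) bs))
countStandard-minimal {bs = bs@(x ∷ xs)} _ u = begin
  countStandard bs
    ≡⟨ countStandard-lookup bs ⟩
  length (standards v)
    ≡⟨ length-standards v ⟩
  sum (map (λ a → length (standards (v ∘ punchIn a))) sources)
    ≡⟨ cong sum (List.map-cong removed sources) ⟩
  sum (map (λ a → countStandard (remove (v a) bs)) sources)
    ≡⟨ cong sum (List.map-∘ sources) ⟩
  sum (map (λ c → countStandard (remove c bs)) (map v sources))
    ≡⟨ cong (λ L → sum (map (λ c → countStandard (remove c bs)) L)) minimals ⟨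
  sum (map (λ c → countStandard (remove c bs)) (filter (minimal? bs) bs)) ∎
  where
  open ≡-Reasoning
  v = lookup bs
  sources = filter (source? v) (allFin (length bs))
  removed : ∀ a → length (standards (v ∘ punchIn a)) ≡ countStandard (remove (v a) bs)
  removed a = begin
    length (standards (v ∘ punchIn a))          ≡⟨ countStandard-tabulate (v ∘ punchIn a) ⟨
    countStandard (tabulate (v ∘ punchIn a))    ≡⟨ cong countStandard
        (remove-tabulate v (lookup-injective u) a) ⟨
    countStandard (remove (v a) (tabulate v))   ≡⟨ cong (countStandard ∘ remove (v a))
        (List.tabulate-lookup bs) ⟩
    countStandard (remove (v a) bs)             ∎
  minimals : filter (minimal? bs) bs ≡ map v sources
  minimals = trans
    (cong (filter (minimal? bs))
        (trans (sym (List.tabulate-lookup bs)) (sym (List.map-tabulate id v))))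
    (filter-map (minimal? bs) (source? v) v (allFin (length bs))
      (λ _ min j → All.lookup min (∈-lookup j))
      (λ _ src → subst (All _) (List.tabulate-lookup bs) (All.tabulate⁺ src)))

-- Coordinates from 0, in which membership in the diagram of `ps` reads k < `part ps (suc i)`.
box : ℕ → ℕ → Box
box i k = suc i , suc i ℕ.+ suc k

-- Skew shapes

part-0≡0 : ∀ ps → part ps 0 ≡ 0
part-0≡0 []       = refl
part-0≡0 (p ∷ ps) = refl

part-length : ∀ ps {i k} → k < part ps (suc i) → i < length ps
part-length (p ∷ ps) {zero}  k< = s≤s z≤n
part-length (p ∷ ps) {suc i} k< = s≤s (part-length ps k<)

box∈ : ∀ ps {i k} → k < part ps (suc i) → box i k ∈ boxes ps
box∈ ps k< = ∈-boxes⁺ ps (part-length ps k<) k<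

box-injective : ∀ {i k j l} → box i k ≡ box j l → i ≡ j × k ≡ l
box-injective {i} {k} {j} {l} e with ℕ.suc-injective (cong proj₁ e)
... | refl = refl , ℕ.suc-injective (ℕ.+-cancelˡ-≡ (suc i) (suc k) (suc l) (cong proj₂ e))

box∈⁻ : ∀ ps {i k} → box i k ∈ boxes ps → k < part ps (suc i)
box∈⁻ ps m with ∈-boxes⁻ ps m
... | _ , _ , _ , k< , e with box-injective e
... | refl , refl = k<

⊆⇒⊇ : ∀ {ps qs} → (∀ {b} → b ∈ boxes qs → b ∈ boxes ps) → ps ⊇ qs
⊆⇒⊇ {ps} {qs}     sub zero    = subst (_≤ part ps 0) (sym (part-0≡0 qs)) z≤n
⊆⇒⊇ {ps} {qs} sub (suc i) with part qs (suc i) in e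
... | zero  = z≤n
... | suc k = box∈⁻ ps (sub (box∈ qs (ℕ.≤-reflexive (sym e))))

⊇⇒⊆ : ∀ {ps qs b} → ps ⊇ qs → b ∈ boxes qs → b ∈ boxes ps
⊇⇒⊆ {ps} {qs} sup m with ∈-boxes⁻ qs m
... | i , k , _ , k< , refl = box∈ ps (ℕ.≤-trans k< (sup (suc i)))

-- Directly above `box (suc i) k` lies `box i (suc k)`, so strictness of the parts says that columns
-- have no holes.
part-step : ∀ {ps} → IsStrictPartition ps → ∀ i {k} → k < part ps (suc (suc i)) → suc k < part ps
    (suc i)
part-step {p ∷ []}     s zero    ()
part-step {p ∷ q ∷ qs} s zero    k< = ℕ.≤-<-trans k< (All.head (strict-below s))
part-step {p ∷ ps}     s (suc i) k< = part-step (strict-tail s) i k<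

part-steps : ∀ {ps} → IsStrictPartition ps → ∀ i d {k} → k < part ps (suc (i ℕ.+ d)) → k ℕ.+ d <
    part ps (suc i)
part-steps s i zero    {k} k< rewrite ℕ.+-identityʳ i | ℕ.+-identityʳ k = k<
part-steps s i (suc d) {k} k< rewrite ℕ.+-suc i d | ℕ.+-suc k d = part-steps s i d
    (part-step s (i ℕ.+ d) k<)

-- A shifted diagram is closed under moving left and up. Membership in `boxes qs` provides that `c`
-- has the form `box j l`, which keeps the move on the right side of the diagonal.
before-closed : ∀ {ps qs b c} → IsStrictPartition ps → b ∈ boxes ps → c ∈ boxes qs → Before c b → c
    ∈ boxes ps
before-closed {ps} {qs} s b∈ c∈ before with ∈-boxes⁻ ps b∈ | ∈-boxes⁻ qs c∈
before-closed {ps} s b∈ c∈ (inj₁ (refl , col<)) | i , k , _ , k< , refl | .i , l , _ , _ , refl =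
  box∈ ps (ℕ.<-trans (ℕ.s≤s⁻¹ (ℕ.+-cancelˡ-< (suc i) (suc l) (suc k) col<)) k<)
before-closed {ps} s b∈ c∈ (inj₂ (col≡ , s≤s j<i)) | i , k , _ , k< , refl | j , l , _ , _ , refl
  with ℕ.m≤n⇒∃[o]m+o≡n j<i
... | o , refl = box∈ ps (subst (_< part ps (suc j)) k+d≡l
                   (part-steps s j (suc o) (subst (λ z → k < part ps (suc z)) (sym (ℕ.+-suc j o))
                       k<)))
  where
  k+d≡l : k ℕ.+ suc o ≡ l
  k+d≡l = ℕ.suc-injective (ℕ.+-cancelˡ-≡ j (suc (k ℕ.+ suc o)) (suc l) (begin
    j ℕ.+ suc (k ℕ.+ suc o)     ≡⟨ cong (j ℕ.+_)
        (trans (cong suc (ℕ.+-suc k o)) (cong (ℕ.suc ∘ ℕ.suc) (ℕ.+-comm k o))) ⟩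
    j ℕ.+ (suc (suc o) ℕ.+ k)   ≡⟨ cong (j ℕ.+_) (sym (ℕ.+-suc (suc o) k)) ⟩
    j ℕ.+ (suc o ℕ.+ suc k)     ≡⟨ ℕ.+-assoc j (suc o) (suc k) ⟨
    j ℕ.+ suc o ℕ.+ suc k       ≡⟨ cong (ℕ._+ suc k) (ℕ.+-suc j o) ⟩
    suc (j ℕ.+ o ℕ.+ suc k)     ≡⟨ ℕ.suc-injective col≡ ⟨
    j ℕ.+ suc l                 ∎))
    where open ≡-Reasoning

-- `grow` with the new box as label: the moments depend on the enlarged part, skew shapes on the
-- box.
growBox : List ℕ → List (Box × List ℕ)
growBox []       = ((1 , 2) , [ 1 ]) ∷ []
growBox (p ∷ ps) = ((1 , suc (suc p)) , suc p ∷ ps) ∷ map (×-map shift (p ∷_)) (growBox ps)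

growBox-grow : ∀ μ → map proj₂ (growBox μ) ≡ map proj₂ (grow μ)
growBox-grow []       = refl
growBox-grow (p ∷ ps) = cong ((suc p ∷ ps) ∷_) (begin
  map proj₂ (map (×-map shift (p ∷_)) (growBox ps))  ≡⟨ List.map-∘ (growBox ps) ⟨
  map ((p ∷_) ∘ proj₂) (growBox ps)                  ≡⟨ List.map-∘ (growBox ps) ⟩
  map (p ∷_) (map proj₂ (growBox ps))                ≡⟨ cong (map (p ∷_)) (growBox-grow ps) ⟩
  map (p ∷_) (map proj₂ (grow ps))                   ≡⟨ List.map-∘ (grow ps) ⟨
  map ((p ∷_) ∘ proj₂) (grow ps)                     ≡⟨ List.map-∘ (grow ps) ⟩
  map proj₂ (map (map₂ (p ∷_)) (grow ps))            ∎)
  where open ≡-Reasoning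

∈-boxes-∷⁻ : ∀ p ps {b} → b ∈ boxes (p ∷ ps) → b ∈ firstRow p ⊎ ∃ λ c → c ∈ boxes ps × b ≡ shift c
∈-boxes-∷⁻ p ps {b} m with ∈-++⁻ (firstRow p) (subst (b ∈_) (boxes-∷ p ps) m)
... | inj₁ m′ = inj₁ m′
... | inj₂ m′ = inj₂ (∈-map⁻ shift m′)

∈-boxes-∷ˡ : ∀ p ps {b} → b ∈ firstRow p → b ∈ boxes (p ∷ ps)
∈-boxes-∷ˡ p ps {b} m = subst (b ∈_) (sym (boxes-∷ p ps)) (∈-++⁺ˡ m)

∈-boxes-∷ʳ : ∀ p ps {c} → c ∈ boxes ps → shift c ∈ boxes (p ∷ ps)
∈-boxes-∷ʳ p ps {c} m = subst (shift c ∈_) (sym (boxes-∷ p ps))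
    (∈-++⁺ʳ (firstRow p) (∈-map⁺ shift m))

-- This and the next three lemmas say that the diagram of ν is that of μ together with the new box
-- b.
growBox-∈ : ∀ {μ b ν} → (b , ν) ∈ growBox μ → b ∈ boxes ν
growBox-∈ {[]}     (here refl) = here refl
growBox-∈ {p ∷ ps} (here refl) = box∈ (suc p ∷ ps) {0} {p} ℕ.≤-refl
growBox-∈ {p ∷ ps} (there m) with ∈-map⁻ (×-map shift (p ∷_)) m
... | (_ , ν) , m′ , refl = ∈-boxes-∷ʳ p ν (growBox-∈ m′)

growBox-⊆ : ∀ {μ b ν c} → (b , ν) ∈ growBox μ → c ∈ boxes μ → c ∈ boxes ν
growBox-⊆ {p ∷ ps} (here refl) c∈ = ⊇⇒⊆ {suc p ∷ ps} {p ∷ ps} sup c∈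
  where
  sup : (suc p ∷ ps) ⊇ (p ∷ ps)
  sup zero          = z≤n
  sup (suc zero)    = ℕ.n≤1+n p
  sup (suc (suc i)) = ℕ.≤-refl
growBox-⊆ {p ∷ ps} (there m) c∈ with ∈-map⁻ (×-map shift (p ∷_)) m
... | (_ , ν) , m′ , refl with ∈-boxes-∷⁻ p ps c∈
... | inj₁ c∈row            = ∈-boxes-∷ˡ p ν c∈row
... | inj₂ (c , c∈′ , refl) = ∈-boxes-∷ʳ p ν (growBox-⊆ m′ c∈′)

growBox-∉ : ∀ {μ b ν} → (b , ν) ∈ growBox μ → b ∉ boxes μ
growBox-∉ {p ∷ ps} (here refl) b∈ = ℕ.<-irrefl refl (box∈⁻ (p ∷ ps) {0} {p} b∈)
growBox-∉ {p ∷ ps} (there m) b∈ with ∈-map⁻ (×-map shift (p ∷_)) m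
... | (c , ν) , m′ , refl with ∈-boxes-∷⁻ p ps b∈
... | inj₂ (_ , c∈ , e) = growBox-∉ m′ (subst (_∈ boxes ps) (sym (shift-injective e)) c∈)
... | inj₁ c∈ with ∈-firstRow⁻ c∈
... | _ , _ , e = contradiction (ℕ.suc-injective (cong proj₁ e))
    (ℕ.>⇒≢ (proj₁ (boxes-positive ν (growBox-∈ m′))))

growBox-new : ∀ {μ b ν c} → (b , ν) ∈ growBox μ → c ∈ boxes ν → c ∈ boxes μ ⊎ c ≡ b
growBox-new {[]}     (here refl) (here refl) = inj₂ refl
growBox-new {p ∷ ps} (here refl) c∈ with ∈-boxes⁻ (suc p ∷ ps) c∈
... | suc i , k , _ , k< , refl = inj₁ (box∈ (p ∷ ps) {suc i} k<)
... | zero  , k , _ , k< , refl with k ℕ.≟ p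
... | yes refl = inj₂ refl
... | no k≢p   = inj₁ (box∈ (p ∷ ps) {0} (ℕ.≤∧≢⇒< (ℕ.s≤s⁻¹ k<) k≢p))
growBox-new {p ∷ ps} (there m) c∈ with ∈-map⁻ (×-map shift (p ∷_)) m
... | (b , ν) , m′ , refl with ∈-boxes-∷⁻ p ν c∈
... | inj₁ c∈row = inj₁ (∈-boxes-∷ˡ p ps c∈row)
... | inj₂ (_ , c∈′ , refl) with growBox-new m′ c∈′
... | inj₁ c∈μ  = inj₁ (∈-boxes-∷ʳ p ps c∈μ)
... | inj₂ refl = inj₂ refl

growBox-positive : ∀ {μ b ν} → (b , ν) ∈ growBox μ → 0 < row b
growBox-positive {μ} {b} {ν} m = proj₁ (boxes-positive ν (growBox-∈ m))

growBox-unique : ∀ μ → AllPairs (_≢_ on proj₁) (growBox μ)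
growBox-unique []       = [] ∷ []
growBox-unique (p ∷ ps) =
  All.map⁺ (All.tabulate (λ m e → ℕ.<⇒≢ (growBox-positive m) (ℕ.suc-injective (cong proj₁ e))))
  ∷ AllPairs.map⁺ (AllPairs.map (λ b≢c e → b≢c (shift-injective e)) (growBox-unique ps))

-- The gap keeps the enlarged part below its predecessor. The last component strengthens the
-- induction: it allows a larger part to be put in front of ν.
growBox-addable : ∀ μ → IsStrictPartition μ → ∀ i →
  (∀ j → i ≡ suc j → suc (part μ (suc i)) < part μ i) →
  ∃ λ ν → (box i (part μ (suc i)) , ν) ∈ growBox μ × IsStrictPartition ν ×
    (∀ q → 0 < q → (i ≡ 0 → suc (part μ 1) < q) → All (_< q) μ → All (_< q) ν)
growBox-addable []       s zero    _   =
  [ 1 ] , here refl , strict-cons (s≤s z≤n) [] s , λ q _ lt _ → lt refl ∷ []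
growBox-addable []       s (suc i) gap = contradiction (gap i refl) λ ()
growBox-addable (p ∷ ps) s zero    _   =
  suc p ∷ ps , here refl ,
  strict-cons (s≤s z≤n) (All.map ℕ.m≤n⇒m≤1+n (strict-below s)) (strict-tail s) ,
  λ { q _ lt (_ ∷ ps<q) → lt refl ∷ ps<q }
growBox-addable (p ∷ ps) s (suc i) gap with growBox-addable ps (strict-tail s) i
    (λ { j refl → gap (suc j) refl })
... | ν , m , sν , bound =
  p ∷ ν , there (∈-map⁺ (×-map shift (p ∷_)) m) , strict-cons (strict-positive s) ν<p sν ,
  λ { q 0<q _ (p<q ∷ _) → p<q ∷ All.map (λ x<p → ℕ.<-trans x<p p<q) ν<p }
  where ν<p = bound p (strict-positive s) (λ { refl → gap 0 refl }) (strict-below s)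

boxes-unique : ∀ ps → Unique (boxes ps)
boxes-unique []       = []
boxes-unique (p ∷ ps) = subst Unique (sym (boxes-∷ p ps)) (Unique.++⁺
  (Unique.map⁺ (λ { refl → refl })
      (Unique.applyUpTo⁺₁ suc p (λ i<j _ e → ℕ.<⇒≢ i<j (ℕ.suc-injective e))))
  (Unique.map⁺ (λ { refl → refl }) (boxes-unique ps))
  disjoint)
  where
  disjoint : ∀ {b} → ¬ (b ∈ firstRow p × b ∈ map shift (boxes ps))
  disjoint (b∈ , c∈) with ∈-firstRow⁻ b∈ | ∈-map⁻ shift c∈
  ... | _ , _ , refl | c , c∈′ , e = ℕ.<⇒≢ (proj₁ (boxes-positive ps c∈′))
      (ℕ.suc-injective (cong proj₁ e))

filter-filter : ∀ {A : Set} {P Q R : A → Set} (P? : Decidable P) (Q? : Decidable Q)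
    (R? : Decidable R) →
  (∀ {x} → R x → P x × Q x) → (∀ {x} → P x → Q x → R x) →
  ∀ xs → filter P? (filter Q? xs) ≡ filter R? xs
filter-filter P? Q? R? to from []       = refl
filter-filter P? Q? R? to from (x ∷ xs) with Q? x | R? x
... | no ¬q | yes r = contradiction (proj₂ (to r)) ¬q
... | no ¬q | no _  = filter-filter P? Q? R? to from xs
... | yes q | yes r with P? x
...   | yes _ = cong (x ∷_) (filter-filter P? Q? R? to from xs)
...   | no ¬p = contradiction (proj₁ (to r)) ¬p
filter-filter P? Q? R? to from (x ∷ xs) | yes q | no ¬r with P? x
...   | yes p = contradiction (from p q) ¬r
...   | no _  = filter-filter P? Q? R? to from xs

∈-skew⁺ : ∀ ps qs {b} → b ∈ boxes ps → b ∉ boxes qs → b ∈ skew ps qs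
∈-skew⁺ ps qs = ∈-filter⁺ (λ b → ¬? (b ∈? boxes qs))

∈-skew⁻ : ∀ ps qs {b} → b ∈ skew ps qs → b ∈ boxes ps × b ∉ boxes qs
∈-skew⁻ ps qs = ∈-filter⁻ (λ b → ¬? (b ∈? boxes qs)) {xs = boxes ps}

-- Both sides filter `boxes ƛ` in the same order, so the lists are equal and `countStandard` need
-- not be shown invariant under permutation.
skew-grow : ∀ {ƛ μ b ν} → (b , ν) ∈ growBox μ → remove b (skew ƛ μ) ≡ skew ƛ ν
skew-grow {ƛ} {μ} {b} {ν} m = filter-filter (λ c → ¬? (c ≟ᵇ b)) (λ c → ¬? (c ∈? boxes μ))
    (λ c → ¬? (c ∈? boxes ν))
  (λ c∉ → (λ { refl → c∉ (growBox-∈ m) }) , c∉ ∘ growBox-⊆ m)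
  (λ c≢ c∉ c∈ → outside c≢ c∉ (growBox-new m c∈)) (boxes ƛ)
  where
  outside : ∀ {c} → c ≢ b → c ∉ boxes μ → ¬ (c ∈ boxes μ ⊎ c ≡ b)
  outside c≢ c∉ (inj₁ c∈) = c∉ c∈
  outside c≢ c∉ (inj₂ e)  = c≢ e

⊇-tail : ∀ {p ps q qs} → (p ∷ ps) ⊇ (q ∷ qs) → ps ⊇ qs
⊇-tail {ps = ps} {qs = qs} sup zero    = subst (_≤ part ps 0) (sym (part-0≡0 qs)) z≤n
⊇-tail           sup (suc i) = sup (suc (suc i))

sum-mono : ∀ {ps qs} → ps ⊇ qs → sum qs ≤ sum ps
sum-mono {ps}     {[]}     _   = z≤n
sum-mono {[]}     {q ∷ qs} sup = ℕ.+-mono-≤ (sup 1) (sum-mono {[]} {qs} tail)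
  where
  tail : [] ⊇ qs
  tail zero    = ℕ.≤-reflexive (part-0≡0 qs)
  tail (suc i) = sup (suc (suc i))
sum-mono {p ∷ ps} {q ∷ qs} sup =
  ℕ.+-mono-≤ (sup 1) (sum-mono {ps} {qs} (⊇-tail {p} {ps} {q} {qs} sup))

module _ {ƛ μ} (sƛ : IsStrictPartition ƛ) (sμ : IsStrictPartition μ) (ƛ⊇μ : ƛ ⊇ μ) where

  Admissible : Box × List ℕ → Set
  Admissible (b , ν) = IsStrictPartition ν × ƛ ⊇ ν

  admissible? : Decidable Admissible
  admissible? (b , ν) = isStrictPartition? ν ×-dec (ƛ ⊇? ν)

  -- A box of λ before b lies in ν, whose diagram is closed, hence in μ or at b itself.
  admissible-minimal : ∀ {b ν} → (b , ν) ∈ growBox μ → Admissible (b , ν) →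
                       b ∈ filter (minimal? (skew ƛ μ)) (skew ƛ μ)
  admissible-minimal {b} {ν} m (sν , ƛ⊇ν) = ∈-filter⁺ (minimal? (skew ƛ μ))
    (∈-skew⁺ ƛ μ (⊇⇒⊆ {ƛ} {ν} ƛ⊇ν b∈ν) (growBox-∉ m))
    (All.tabulate minimal)
    where
    b∈ν = growBox-∈ m
    minimal : ∀ {c} → c ∈ skew ƛ μ → ¬ Before c b
    minimal c∈ before with ∈-skew⁻ ƛ μ c∈
    ... | c∈ƛ , c∉μ with growBox-new m (before-closed {ν} {ƛ} sν b∈ν c∈ƛ before)
    ... | inj₁ c∈μ  = c∉μ c∈μ
    ... | inj₂ refl = ¬Before-refl b before

  -- By minimality the left and the upper neighbour of b, if present, lie in μ. The left one puts b
  -- at the end of its row of μ, the upper one provides the gap for adding it.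
  minimal-admissible : ∀ {b} → b ∈ filter (minimal? (skew ƛ μ)) (skew ƛ μ) →
                       ∃ λ ν → (b , ν) ∈ growBox μ × Admissible (b , ν)
  minimal-admissible b∈ with ∈-filter⁻ (minimal? (skew ƛ μ)) {xs = skew ƛ μ} b∈
  ... | b∈sk , min with ∈-skew⁻ ƛ μ b∈sk
  ... | b∈ƛ , b∉μ with ∈-boxes⁻ ƛ b∈ƛ
  ... | i , k , _ , k< , refl = ν , m , sν , ⊆⇒⊇ {ƛ} {ν} sub
    where
    μᵢ≤k : part μ (suc i) ≤ k
    μᵢ≤k = ℕ.≮⇒≥ (b∉μ ∘ box∈ μ)
    before-in : ∀ {j l} → box j l ∈ boxes ƛ → Before (box j l) (box i k) → l < part μ (suc j)
    before-in {j} {l} c∈ before with box j l ∈? boxes μ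
    ... | yes c∈μ = box∈⁻ μ c∈μ
    ... | no c∉μ  = contradiction before (All.lookup min (∈-skew⁺ ƛ μ c∈ c∉μ))
    left : ∀ k → k < part ƛ (suc i) → part μ (suc i) ≤ k →
           (∀ {l} → l < k → l < part μ (suc i)) → part μ (suc i) ≡ k
    left zero    k< μ≤ h = ℕ.n≤0⇒n≡0 μ≤
    left (suc k) k< μ≤ h = ℕ.≤-antisym μ≤ (h ℕ.≤-refl)
    μᵢ≡k : part μ (suc i) ≡ k
    μᵢ≡k = left k k< μᵢ≤k (λ {l} l<k → before-in (box∈ ƛ (ℕ.<-trans l<k k<))
             (inj₁ (refl , ℕ.+-monoʳ-< (suc i) (s≤s l<k))))
    gap : ∀ j → i ≡ suc j → suc (part μ (suc i)) < part μ i
    gap j refl = subst (λ z → suc z < part μ i) (sym μᵢ≡k)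
      (before-in {j} {suc k} (box∈ ƛ (part-step sƛ j k<))
        (inj₂ (cong suc (ℕ.+-suc j (suc k)) , ℕ.n<1+n (suc j))))
    added = growBox-addable μ sμ i gap
    ν = proj₁ added
    m : (box i k , ν) ∈ growBox μ
    m = subst (λ z → (box i z , ν) ∈ growBox μ) μᵢ≡k (proj₁ (proj₂ added))
    sν = proj₁ (proj₂ (proj₂ added))
    sub : ∀ {c} → c ∈ boxes ν → c ∈ boxes ƛ
    sub c∈ with growBox-new m c∈
    ... | inj₁ c∈μ  = ⊇⇒⊆ {ƛ} {μ} ƛ⊇μ c∈μ
    ... | inj₂ refl = b∈ƛ

  skew-nonempty : sum μ < sum ƛ → ∃ λ b → b ∈ skew ƛ μ
  skew-nonempty lt with skew ƛ μ in e
  ... | b ∷ _ = b , here refl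
  ... | []    = contradiction (sum-mono {μ} {ƛ} (⊆⇒⊇ {μ} {ƛ} sub)) (ℕ.<⇒≱ lt)
    where
    sub : ∀ {b} → b ∈ boxes ƛ → b ∈ boxes μ
    sub {b} b∈ with b ∈? boxes μ
    ... | yes b∈μ = b∈μ
    ... | no b∉μ with subst (b ∈_) e (∈-skew⁺ ƛ μ b∈ b∉μ)
    ... | ()

  minimal-↭ : filter (minimal? (skew ƛ μ)) (skew ƛ μ) ↭ map proj₁ (filter admissible? (growBox μ))
  minimal-↭ = unique⇒↭
    (Unique.filter⁺ (minimal? (skew ƛ μ)) (Unique.filter⁺ _ (boxes-unique ƛ)))
    (AllPairs.map⁺ (AllPairs.filter⁺ admissible? (growBox-unique μ)))
    (λ b∈ → let ν , m , adm = minimal-admissible b∈ in ∈-map⁺ proj₁ (∈-filter⁺ admissible? m adm))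
    from
    where
    from : ∀ {b} → b ∈ map proj₁ (filter admissible? (growBox μ)) → b ∈ filter (minimal? (skew ƛ μ))
        (skew ƛ μ)
    from b∈ with ∈-map⁻ proj₁ b∈
    ... | _ , m , refl with ∈-filter⁻ admissible? {xs = growBox μ} m
    ... | m′ , adm = admissible-minimal m′ adm

  -- The box with the least entry is minimal in λ/μ, and its deletion leaves λ/ν for an admissible
  -- ν.
  f-grow : sum μ < sum ƛ →
           f ƛ μ ≡ sum (map (λ bν → f ƛ (proj₂ bν)) (filter admissible? (growBox μ)))
  f-grow lt = trans (countStandard-minimal (proj₂ (skew-nonempty lt))
      (Unique.filter⁺ _ (boxes-unique ƛ)))
    (trans (sum-↭ (↭.map⁺ g minimal-↭))
    (trans (cong sum (sym (List.map-∘ {g = g} {f = proj₁} admissibles)))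
           (cong sum (List.map-cong-local {f = g ∘ proj₁} {g = h} (All.tabulate removed)))))
    where
    g : Box → ℕ
    g b = countStandard (remove b (skew ƛ μ))
    h : Box × List ℕ → ℕ
    h bν = f ƛ (proj₂ bν)
    admissibles = filter admissible? (growBox μ)
    removed : ∀ {bν} → bν ∈ admissibles → g (proj₁ bν) ≡ h bν
    removed {b , ν} m = cong countStandard
        (skew-grow {ƛ} {μ} {b} {ν} (proj₁ (∈-filter⁻ admissible? {xs = growBox μ} m)))

-- Outer corners

-- When a row p may lose its last box above a row q. The last row has q = 0 and no condition,
-- because a row of length 1 may disappear.
Gap : ℕ → ℕ → Set
Gap p q = 0 < q → suc q < p

gap? : ∀ p q → Dec (Gap p q)
gap? p q = (0 ℕ.<? q) →-dec (suc q ℕ.<? p)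

record Corner (ps : List ℕ) (i k : ℕ) : Set where
  constructor corner
  field
    end : suc k ≡ part ps (suc i)
    gap : Gap (suc k) (part ps (suc (suc i)))

-- A box kept to the right would force b back into ν; and the row below, kept entirely, must still
-- be shorter than the shortened row, as ν is strict.
outerCorner⇒corner : ∀ {ps b} → IsOuterCorner ps b → ∃ λ i → ∃ λ k → b ≡ box i k × Corner ps i k
outerCorner⇒corner {ps} (outerCorner inside (ν , sν , r)) with ∈-boxes⁻ ps inside
... | i , k , _ , k< , refl = i , k , refl , corner (ℕ.≤-antisym k< (ℕ.≮⇒≥ last)) gap
  where
  b∉ν : ¬ k < part ν (suc i)
  b∉ν lt = proj₂ (Equivalence.to (r _) (box∈ ν {i} {k} lt)) refl
  keep : ∀ {j l} → l < part ps (suc j) → box j l ≢ box i k → l < part ν (suc j)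
  keep l< ne = box∈⁻ ν (Equivalence.from (r _) (box∈ ps l< , ne))
  last : ¬ suc k < part ps (suc i)
  last lt = b∉ν (ℕ.<-trans (ℕ.n<1+n k)
      (keep lt (λ e → ℕ.1+n≢n (proj₂ (box-injective {i} {suc k} {i} {k} e)))))
  gap : Gap (suc k) (part ps (suc (suc i)))
  gap 0<q with part ps (suc (suc i)) in e
  gap ()  | zero
  ... | suc l = s≤s (ℕ.≤-trans (part-step sν i (keep {suc i} {l} (ℕ.≤-reflexive (sym e))
                  (λ e → ℕ.1+n≢n (proj₁ (box-injective {suc i} {l} {i} {k} e)))))
                (ℕ.≮⇒≥ b∉ν))

-- Removal as reversed growth, so that the facts on `growBox` describe the diagram that is left. The
-- bound on the parts of ν serves the induction.
corner-shrink : ∀ {ps} i {k} → IsStrictPartition ps → Corner ps i k →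
  ∃ λ ν → (box i k , ps) ∈ growBox ν × IsStrictPartition ν × (∀ {q} → All (_< q) ps → All (_< q) ν)
corner-shrink {p ∷ []} zero {zero} s (corner refl _) =
  [] , here refl , strict-tail s , λ _ → []
corner-shrink {p ∷ q ∷ qs} zero {zero} s (corner refl gap) =
  contradiction (gap (strict-positive (strict-tail s))) λ { (s≤s ()) }
corner-shrink {p ∷ ps} zero {suc k} s (corner refl gap) =
  suc k ∷ ps , here refl , strict-cons (s≤s z≤n) (below ps (strict-tail s) gap) (strict-tail s) ,
  λ { (p<q ∷ ps<q) → ℕ.<-trans (ℕ.n<1+n (suc k)) p<q ∷ ps<q }
  where
  below : ∀ ps → IsStrictPartition ps → Gap (suc (suc k)) (part ps 1) → All (_< suc k) ps
  below []       _  _   = []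
  below (q ∷ qs) sq gap = q<k ∷ All.map (λ x<q → ℕ.<-trans x<q q<k) (strict-below sq)
    where q<k = ℕ.s≤s⁻¹ (gap (strict-positive sq))
corner-shrink {p ∷ ps} (suc i) s (corner e gap) with corner-shrink i (strict-tail s) (corner e gap)
... | ν , m , sν , bound =
  p ∷ ν , there (∈-map⁺ (×-map shift (p ∷_)) m) ,
  strict-cons (strict-positive s) (bound (strict-below s)) sν ,
  λ { (p<q ∷ ps<q) → p<q ∷ bound ps<q }

corner⇒outerCorner : ∀ {ps i k} → IsStrictPartition ps → Corner ps i k → IsOuterCorner ps (box i k)
corner⇒outerCorner {ps} {i} {k} s c with corner-shrink i s c
... | ν , m , sν , _ = outerCorner (growBox-∈ m)
  (ν , sν , λ b → mk⇔ (λ b∈ → growBox-⊆ m b∈ , λ { refl → growBox-∉ m b∈ })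
                      (λ (b∈ , b≢) → old b≢ (growBox-new m b∈)))
  where
  old : ∀ {b} → b ≢ box i k → b ∈ boxes ν ⊎ b ≡ box i k → b ∈ boxes ν
  old b≢ (inj₁ b∈) = b∈
  old b≢ (inj₂ e)  = contradiction e b≢

corners : List ℕ → List Box
corners []       = []
corners (p ∷ ps) with gap? p (part ps 1)
... | yes _ = (1 , suc p) ∷ map shift (corners ps)
... | no  _ = map shift (corners ps)

cornerBoxes : List ℕ → List Box
cornerBoxes ps = filter (isOuterCorner? ps) (boxes ps)

-- In the first row only the last box can be a corner, and whether a lower box is one depends on its
-- own row and the next alone.
corners-correct : ∀ ps → IsStrictPartition ps → cornerBoxes ps ≡ corners ps
corners-correct []       _ = refl
corners-correct (zero ∷ ps) s with strict-positive s
... | ()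
corners-correct (suc k ∷ ps) s = begin
  filter P? (boxes (suc k ∷ ps))
    ≡⟨ cong (filter P?) (boxes-∷ (suc k) ps) ⟩
  filter P? (firstRow (suc k) ++ map shift (boxes ps))
    ≡⟨ List.filter-++ P? (firstRow (suc k)) (map shift (boxes ps)) ⟩
  filter P? (firstRow (suc k)) ++ filter P? (map shift (boxes ps))
    ≡⟨ cong₂ _++_ row′ rest′ ⟩
  filter P? [ (1 , suc (suc k)) ] ++ map shift (corners ps)
    ≡⟨ last ⟩
  corners (suc k ∷ ps) ∎
  where
  open ≡-Reasoning
  P? = isOuterCorner? (suc k ∷ ps)
  cornerAt : ∀ {j l} → IsOuterCorner (suc k ∷ ps) (box j l) → Corner (suc k ∷ ps) j l
  cornerAt {j} {l} oc with outerCorner⇒corner {suc k ∷ ps} oc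
  ... | i , m , e , c with box-injective {j} {l} {i} {m} e
  ... | refl , refl = c
  to : ∀ {c} → c ∈ boxes ps → IsOuterCorner (suc k ∷ ps) (shift c) → IsOuterCorner ps c
  to c∈ oc with ∈-boxes⁻ ps c∈
  ... | i , l , _ , _ , refl with cornerAt {suc i} {l} oc
  ... | corner e g = corner⇒outerCorner (strict-tail s) (corner e g)
  from : ∀ {c} → c ∈ boxes ps → IsOuterCorner ps c → IsOuterCorner (suc k ∷ ps) (shift c)
  from _ oc with outerCorner⇒corner {ps} oc
  ... | i , l , refl , corner e g = corner⇒outerCorner {suc k ∷ ps} {suc i} {l} s (corner e g)
  rest′ : filter P? (map shift (boxes ps)) ≡ map shift (corners ps)
  rest′ = trans (filter-map P? (isOuterCorner? ps) shift (boxes ps) to from)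
                (cong (map shift) (corners-correct ps (strict-tail s)))
  inner : ∀ {b} → b ∈ firstRow k → ¬ IsOuterCorner (suc k ∷ ps) b
  inner b∈ oc with ∈-firstRow⁻ b∈
  ... | l , l<k , refl = ℕ.<⇒≢ l<k (ℕ.suc-injective (Corner.end (cornerAt {0} {l} oc)))
  row′ : filter P? (firstRow (suc k)) ≡ filter P? [ (1 , suc (suc k)) ]
  row′ = begin
    filter P? (firstRow (suc k))
      ≡⟨ cong (filter P?) (firstRow-suc k) ⟩
    filter P? (firstRow k ++ [ (1 , suc (suc k)) ])
      ≡⟨ List.filter-++ P? (firstRow k) [ (1 , suc (suc k)) ] ⟩
    filter P? (firstRow k) ++ filter P? [ (1 , suc (suc k)) ]
      ≡⟨ cong (_++ filter P? [ (1 , suc (suc k)) ]) (List.filter-none P? (All.tabulate inner)) ⟩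
    filter P? [ (1 , suc (suc k)) ] ∎
  last : filter P? [ (1 , suc (suc k)) ] ++ map shift (corners ps) ≡ corners (suc k ∷ ps)
  last with gap? (suc k) (part ps 1)
  ... | yes g = cong (_++ map shift (corners ps)) (List.filter-accept P? {(1 , suc (suc k))} {[]}
                  (corner⇒outerCorner {suc k ∷ ps} {0} {k} s (corner refl g)))
  ... | no ¬g = cong (_++ map shift (corners ps)) (List.filter-reject P? {(1 , suc (suc k))} {[]}
                  (λ oc → ¬g (Corner.gap (cornerAt {0} {k} oc))))

filter-reverse : ∀ {A : Set} {P : A → Set} (P? : Decidable P) xs → filter P? (reverse xs) ≡ reverse
    (filter P? xs)
filter-reverse P? []       = refl
filter-reverse P? (x ∷ xs) = trans (cong (filter P?) (List.unfold-reverse x xs)) (trans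
  (List.filter-++ P? (reverse xs) [ x ]) step)
  where
  step : filter P? (reverse xs) ++ filter P? [ x ] ≡ reverse (filter P? (x ∷ xs))
  step with P? x
  ... | yes _ = trans (cong (_++ [ x ]) (filter-reverse P? xs))
      (sym (List.unfold-reverse x (filter P? xs)))
  ... | no _  = trans (List.++-identityʳ _) (filter-reverse P? xs)

outerCorners-correct : ∀ {ps} → IsStrictPartition ps → outerCorners ps ≡ reverse (corners ps)
outerCorners-correct {ps} s = trans (filter-reverse (isOuterCorner? ps) (boxes ps))
    (cong reverse (corners-correct ps s))

-- xContents ps is xDifferences (length ps + 1) (outerCorners ps); its last entry is lastCol.
xDifferences : ℕ → List Box → List ℕ
xDifferences β L = zipWith _∸_ (β ∷ map col L) (map row L ++ 0 ∷ [])

lastCol : ℕ → List Box → ℕ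
lastCol β []      = β
lastCol β (c ∷ L) = lastCol (col c) L

lastCol-shift : ∀ β L → lastCol (suc β) (map shift L) ≡ suc (lastCol β L)
lastCol-shift β []      = refl
lastCol-shift β (c ∷ L) = lastCol-shift (col c) L

lastCol-∷ʳ : ∀ β L c → lastCol β (L ++ [ c ]) ≡ col c
lastCol-∷ʳ β []      c = refl
lastCol-∷ʳ β (d ∷ L) c = lastCol-∷ʳ (col d) L c

reverse-shift : ∀ ps → reverse (map shift (corners ps)) ≡ map shift (reverse (corners ps))
reverse-shift ps = sym (List.reverse-map shift (corners ps))

reverse-corner : ∀ p ps → reverse ((1 , suc p) ∷ map shift (corners ps)) ≡
                 map shift (reverse (corners ps)) ++ [ (1 , suc p) ]
reverse-corner p ps = trans (List.unfold-reverse (1 , suc p) (map shift (corners ps)))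
                            (cong (_++ [ (1 , suc p) ]) (reverse-shift ps))

no-gap : ∀ {p ps} → IsStrictPartition (p ∷ ps) → ¬ Gap p (part ps 1) → suc (part ps 1) ≡ p
no-gap {p} {[]}     s ¬g = contradiction (λ ()) ¬g
no-gap {p} {q ∷ qs} s ¬g = ℕ.≤-antisym (All.head (strict-below s)) (ℕ.≮⇒≥ (λ lt → ¬g (λ _ → lt)))

-- Without a gap the second row is one box shorter and ends in the same column as the first. So the
-- topmost corner always has the column in which the first row ends.
lastCol-corners : ∀ {ps} → IsStrictPartition ps →
                  lastCol (suc (length ps)) (reverse (corners ps)) ≡ suc (part ps 1)
lastCol-corners {[]}     _ = refl
lastCol-corners {p ∷ ps} s with gap? p (part ps 1)
... | yes _ = trans (cong (lastCol (suc (suc (length ps)))) (reverse-corner p ps))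
                    (lastCol-∷ʳ (suc (suc (length ps))) (map shift (reverse (corners ps)))
                        (1 , suc p))
... | no ¬g = trans (cong (lastCol (suc (suc (length ps)))) (reverse-shift ps))
              (trans (lastCol-shift (suc (length ps)) (reverse (corners ps)))
                     (cong suc (trans (lastCol-corners (strict-tail s)) (no-gap s ¬g))))

content-shift : ∀ L → map content (map shift L) ≡ map content L
content-shift L = sym (List.map-∘ L)

module _ (g : ℕ → ℕ) where
  open ≡-Reasoning

  -- The effect of a new first row without a corner: all differences are preserved except the last,
  -- which subtracts 0 and so grows by one.
  xDifferences-shift : ∀ β L →
    sum (map g (xDifferences (suc β) (map shift L))) ℕ.+ g (lastCol β L) ≡
    sum (map g (xDifferences β L)) ℕ.+ g (suc (lastCol β L))
  xDifferences-shift β []      = trans (cong (ℕ._+ g β) (ℕ.+-identityʳ (g (suc β))))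
    (trans (ℕ.+-comm (g (suc β)) (g β)) (cong (ℕ._+ g (suc β)) (sym (ℕ.+-identityʳ (g β)))))
  xDifferences-shift β (c ∷ L) = trans (ℕ.+-assoc (g (β ∸ row c)) _ _)
    (trans (cong (g (β ∸ row c) ℕ.+_) (xDifferences-shift (col c) L))
        (sym (ℕ.+-assoc (g (β ∸ row c)) _ _)))

  -- The effect of a new first row with a corner: the formerly last difference now subtracts 1,
  -- which cancels the shift, and `e` - 0 is appended.
  xDifferences-∷ʳ : ∀ β L e →
    sum (map g (xDifferences (suc β) (map shift L ++ [ (1 , e) ]))) ≡
    sum (map g (xDifferences β L)) ℕ.+ g e
  xDifferences-∷ʳ β []      e = trans (cong (g β ℕ.+_) (ℕ.+-identityʳ (g e)))
      (cong (ℕ._+ g e) (sym (ℕ.+-identityʳ (g β))))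
  xDifferences-∷ʳ β (c ∷ L) e = trans (cong (g (β ∸ row c) ℕ.+_) (xDifferences-∷ʳ (col c) L e))
      (sym (ℕ.+-assoc (g (β ∸ row c)) _ _))

  xSum ySum : List ℕ → ℕ
  xSum ps = sum (map g (xDifferences (suc (length ps)) (reverse (corners ps))))
  ySum ps = sum (map g (map content (reverse (corners ps))))

  -- A first row p raises the x-sum minus the y-sum by g (p + 1) - g p, here written without
  -- subtraction. If it has a corner, the terms p + 1 and p are new; if not, the last x passes from
  -- p to p + 1.
  xySum-∷ : ∀ {p ps} → IsStrictPartition (p ∷ ps) →
            xSum (p ∷ ps) ℕ.+ ySum ps ℕ.+ g p ≡ xSum ps ℕ.+ ySum (p ∷ ps) ℕ.+ g (suc p)
  xySum-∷ {p} {ps} s with gap? p (part ps 1)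
  ... | yes _ = begin
    sum (map g (xDifferences (suc (suc (length ps)))
        (reverse ((1 , suc p) ∷ map shift (corners ps))))) ℕ.+ ySum ps ℕ.+ g p
      ≡⟨ cong (λ L → sum (map g (xDifferences (suc (suc (length ps))) L)) ℕ.+ ySum ps ℕ.+ g p)
           (reverse-corner p ps) ⟩
    sum (map g (xDifferences (suc (suc (length ps)))
        (map shift (reverse (corners ps)) ++ [ (1 , suc p) ]))) ℕ.+ ySum ps ℕ.+ g p
      ≡⟨ cong (λ z → z ℕ.+ ySum ps ℕ.+ g p)
           (xDifferences-∷ʳ (suc (length ps)) (reverse (corners ps)) (suc p)) ⟩
    xSum ps ℕ.+ g (suc p) ℕ.+ ySum ps ℕ.+ g p
      ≡⟨ rearrange (xSum ps) (g (suc p)) (ySum ps) (g p) ⟩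
    xSum ps ℕ.+ (ySum ps ℕ.+ (g p ℕ.+ 0)) ℕ.+ g (suc p)
      ≡⟨ cong (λ z → xSum ps ℕ.+ z ℕ.+ g (suc p)) y-step ⟨
    xSum ps ℕ.+ sum (map g (map content (reverse ((1 , suc p) ∷ map shift (corners ps))))) ℕ.+ g
        (suc p) ∎
    where
    rearrange : ∀ a b c d → a ℕ.+ b ℕ.+ c ℕ.+ d ≡ a ℕ.+ (c ℕ.+ (d ℕ.+ 0)) ℕ.+ b
    rearrange a b c d rewrite ℕ.+-identityʳ d | ℕ.+-assoc a b c | ℕ.+-comm b c | sym
        (ℕ.+-assoc a c b)
      | sym (ℕ.+-assoc a c d) | ℕ.+-assoc (a ℕ.+ c) b d | ℕ.+-comm b d = sym
          (ℕ.+-assoc (a ℕ.+ c) d b)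
    y-step : sum (map g (map content (reverse ((1 , suc p) ∷ map shift (corners ps))))) ≡ ySum ps
        ℕ.+ (g p ℕ.+ 0)
    y-step = begin
      sum (map g (map content (reverse ((1 , suc p) ∷ map shift (corners ps)))))
        ≡⟨ cong (sum ∘ map g ∘ map content) (reverse-corner p ps) ⟩
      sum (map g (map content (map shift (reverse (corners ps)) ++ [ (1 , suc p) ])))
        ≡⟨ cong (sum ∘ map g) (trans
             (List.map-++ content (map shift (reverse (corners ps))) [ (1 , suc p) ])
             (cong (_++ [ p ]) (content-shift (reverse (corners ps))))) ⟩
      sum (map g (map content (reverse (corners ps)) ++ [ p ]))
        ≡⟨ trans (cong sum (List.map-++ g (map content (reverse (corners ps))) [ p ]))
             (sum-++ (map g (map content (reverse (corners ps)))) [ g p ]) ⟩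
      ySum ps ℕ.+ (g p ℕ.+ 0) ∎
  ... | no ¬g = begin
    sum (map g (xDifferences (suc (suc (length ps))) (reverse (map shift (corners ps))))) ℕ.+ ySum
        ps ℕ.+ g p
      ≡⟨ swap (sum (map g (xDifferences (suc (suc (length ps)))
           (reverse (map shift (corners ps)))))) (ySum ps) (g p) ⟩
    sum (map g (xDifferences (suc (suc (length ps))) (reverse (map shift (corners ps))))) ℕ.+ g p
        ℕ.+ ySum ps
      ≡⟨ cong₂ (λ L z → sum (map g (xDifferences (suc (suc (length ps))) L)) ℕ.+ g z ℕ.+ ySum ps)
           (reverse-shift ps) (sym last≡p) ⟩
    sum (map g (xDifferences (suc (suc (length ps))) (map shift (reverse (corners ps))))) ℕ.+ g
        (lastCol (suc (length ps)) (reverse (corners ps))) ℕ.+ ySum ps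
      ≡⟨ cong (ℕ._+ ySum ps) (xDifferences-shift (suc (length ps)) (reverse (corners ps))) ⟩
    xSum ps ℕ.+ g (suc (lastCol (suc (length ps)) (reverse (corners ps)))) ℕ.+ ySum ps
      ≡⟨ cong (λ z → xSum ps ℕ.+ g (suc z) ℕ.+ ySum ps) last≡p ⟩
    xSum ps ℕ.+ g (suc p) ℕ.+ ySum ps
      ≡⟨ swap (xSum ps) (g (suc p)) (ySum ps) ⟩
    xSum ps ℕ.+ ySum ps ℕ.+ g (suc p)
      ≡⟨ cong (λ L → xSum ps ℕ.+ sum (map g L) ℕ.+ g (suc p))
           (trans (cong (map content) (reverse-shift ps)) (content-shift (reverse (corners ps)))) ⟨
    xSum ps ℕ.+ sum (map g (map content (reverse (map shift (corners ps))))) ℕ.+ g (suc p) ∎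
    where
    last≡p : lastCol (suc (length ps)) (reverse (corners ps)) ≡ p
    last≡p = trans (lastCol-corners (strict-tail s)) (no-gap s ¬g)
    swap : ∀ a b c → a ℕ.+ b ℕ.+ c ≡ a ℕ.+ c ℕ.+ b
    swap a b c = trans (ℕ.+-assoc a b c)
        (trans (cong (a ℕ.+_) (ℕ.+-comm b c)) (sym (ℕ.+-assoc a c b)))

-- From corner contents to the sum of cubes

C2² : ℕ → ℕ
C2² x = (x C 2) ^ 2

ι-C2² : ∀ x → + 4 / 1 * ι (C2² x) ≡ (ι x * ι x - ι x) * (ι x * ι x - ι x)
ι-C2² x = begin
  + 4 / 1 * ι ((x C 2) ℕ.* ((x C 2) ℕ.* 1))
    ≡⟨ cong (λ z → + 4 / 1 * ι ((x C 2) ℕ.* z)) (ℕ.*-identityʳ (x C 2)) ⟩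
  + 4 / 1 * ι ((x C 2) ℕ.* (x C 2))
    ≡⟨ cong (+ 4 / 1 *_) (ι-* (x C 2) (x C 2)) ⟩
  + 4 / 1 * (ι (x C 2) * ι (x C 2))
    ≡⟨ solve 1 (λ c → con (+ 4 / 1) :* (c :* c) := (con 2ℚ :* c) :* (con 2ℚ :* c)) refl
         (ι (x C 2)) ⟩
  2ℚ * ι (x C 2) * (2ℚ * ι (x C 2))
    ≡⟨ cong (λ z → z * z) (ι-C2 x) ⟩
  (ι x * ι x - ι x) * (ι x * ι x - ι x) ∎
  where open ≡-Reasoning

-- Nicomachus: squared triangular numbers differ by cubes.
ι-C2²-suc : ∀ p → ι (C2² (suc p)) ≡ ι p * ι p * ι p + ι (C2² p)
ι-C2²-suc p = *-cancelˡ (+ 4 / 1) (λ ()) (begin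
  + 4 / 1 * ι (C2² (suc p))
    ≡⟨ ι-C2² (suc p) ⟩
  (ι (suc p) * ι (suc p) - ι (suc p)) * (ι (suc p) * ι (suc p) - ι (suc p))
    ≡⟨ cong (λ z → (z * z - z) * (z * z - z)) (ι-suc p) ⟩
  ((1ℚ + ι p) * (1ℚ + ι p) - (1ℚ + ι p)) * ((1ℚ + ι p) * (1ℚ + ι p) - (1ℚ + ι p))
    ≡⟨ solve 1 (λ p → ((con 1ℚ :+ p) :* (con 1ℚ :+ p) :- (con 1ℚ :+ p)) :*
         ((con 1ℚ :+ p) :* (con 1ℚ :+ p) :- (con 1ℚ :+ p))
         := con (+ 4 / 1) :* (p :* p :* p) :+ (p :* p :- p) :* (p :* p :- p)) refl (ι p) ⟩
  + 4 / 1 * (ι p * ι p * ι p) + (ι p * ι p - ι p) * (ι p * ι p - ι p)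
    ≡⟨ cong (λ z → + 4 / 1 * (ι p * ι p * ι p) + z) (ι-C2² p) ⟨
  + 4 / 1 * (ι p * ι p * ι p) + + 4 / 1 * ι (C2² p)
    ≡⟨ ℚ.*-distribˡ-+ (+ 4 / 1) (ι p * ι p * ι p) (ι (C2² p)) ⟨
  + 4 / 1 * (ι p * ι p * ι p + ι (C2² p)) ∎)
  where open ≡-Reasoning

-- By `xySum-∷` and the preceding identity every row p adds exactly p³.
xySum-cubes : ∀ {ps} → IsStrictPartition ps → ι (xSum C2² ps) - ι (ySum C2² ps) ≡ cubes ps
xySum-cubes {[]}     _ rewrite ι-0 = refl
xySum-cubes {p ∷ ps} s = begin
  x′ - y′
    ≡⟨ solve 5 (λ x′ y′ x y c → x′ :- y′ := (x′ :+ y :+ c) :- c :- y :- y′) refl x′ y′ x y c ⟩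
  x′ + y + c - c - y - y′
    ≡⟨ cong (λ z → z - c - y - y′) eq ⟩
  x + y′ + (ι p * ι p * ι p + c) - c - y - y′
    ≡⟨ solve 5 (λ x y′ q c y → x :+ y′ :+ (q :+ c) :- c :- y :- y′ := q :+ (x :- y)) refl x y′
         (ι p * ι p * ι p) c y ⟩
  ι p * ι p * ι p + (x - y)
    ≡⟨ cong (λ z → ι p * ι p * ι p + z) (xySum-cubes (strict-tail s)) ⟩
  ι p * ι p * ι p + cubes ps ∎
  where
  open ≡-Reasoning
  x′ = ι (xSum C2² (p ∷ ps))
  y′ = ι (ySum C2² (p ∷ ps))
  x = ι (xSum C2² ps)
  y = ι (ySum C2² ps)
  c = ι (C2² p)
  eq : x′ + y + c ≡ x + y′ + (ι p * ι p * ι p + c)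
  eq = begin
    x′ + y + c
      ≡⟨ trans (ι-+ (xSum C2² (p ∷ ps) ℕ.+ ySum C2² ps) (C2² p))
           (cong (_+ c) (ι-+ (xSum C2² (p ∷ ps)) (ySum C2² ps))) ⟨
    ι (xSum C2² (p ∷ ps) ℕ.+ ySum C2² ps ℕ.+ C2² p)
      ≡⟨ cong ι (xySum-∷ C2² s) ⟩
    ι (xSum C2² ps ℕ.+ ySum C2² (p ∷ ps) ℕ.+ C2² (suc p))
      ≡⟨ trans (ι-+ (xSum C2² ps ℕ.+ ySum C2² (p ∷ ps)) (C2² (suc p)))
           (cong₂ _+_ (ι-+ (xSum C2² ps) (ySum C2² (p ∷ ps))) (ι-C2²-suc p)) ⟩
    x + y′ + (ι p * ι p * ι p + c) ∎

fromℤ-q₂ : ∀ {ps} → IsStrictPartition ps → fromℤ (q₂ ps) ≡ cubes ps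
fromℤ-q₂ {ps} s = begin
  fromℤ (+ sum (map C2² (xContents ps)) ℤ.- + sum (map C2² (yContents ps)))
    ≡⟨ fromℤ-- (+ sum (map C2² (xContents ps))) (+ sum (map C2² (yContents ps))) ⟩
  fromℤ (+ sum (map C2² (xContents ps))) - fromℤ (+ sum (map C2² (yContents ps)))
    ≡⟨ cong₂ _-_ (ι≡fromℤ (sum (map C2² (xContents ps)))) (ι≡fromℤ (sum (map C2² (yContents ps)))) ⟨
  ι (sum (map C2² (xContents ps))) - ι (sum (map C2² (yContents ps)))
    ≡⟨ cong₂ (λ x y → ι x - ι y)
         (cong₂ (λ β L → sum (map C2² (xDifferences β L))) (ℕ.+-comm (length ps) 1)
             (outerCorners-correct s))
         (cong (sum ∘ map C2² ∘ map content) (outerCorners-correct s)) ⟩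
  ι (xSum C2² ps) - ι (ySum C2² ps)
    ≡⟨ xySum-cubes s ⟩
  cubes ps ∎
  where open ≡-Reasoning

-- Iterated growth

strictUpTo-strict : ∀ k {ps} → ps ∈ strictUpTo k → IsStrictPartition ps × All (_≤ k) ps
strictUpTo-strict zero    (here refl) = (Linked.[] , []) , []
strictUpTo-strict (suc k) m with ∈-++⁻ (map (suc k ∷_) (strictUpTo k)) m
... | inj₂ m′ = let s , ≤k = strictUpTo-strict k m′ in s , All.map ℕ.m≤n⇒m≤1+n ≤k
... | inj₁ m′ with ∈-map⁻ (suc k ∷_) m′
... | ps , m″ , refl = let s , ≤k = strictUpTo-strict k m″ in
  strict-cons (s≤s z≤n) (All.map s≤s ≤k) s , ℕ.≤-refl ∷ All.map ℕ.m≤n⇒m≤1+n ≤k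

strictUpTo-unique : ∀ k → Unique (strictUpTo k)
strictUpTo-unique zero    = [] ∷ []
strictUpTo-unique (suc k) = Unique.++⁺
  (Unique.map⁺ (λ { refl → refl }) (strictUpTo-unique k)) (strictUpTo-unique k) disjoint
  where
  disjoint : ∀ {ps} → ¬ (ps ∈ map (suc k ∷_) (strictUpTo k) × ps ∈ strictUpTo k)
  disjoint (p , q) with ∈-map⁻ (suc k ∷_) p
  ... | _ , _ , refl = ℕ.1+n≰n (All.head (proj₂ (strictUpTo-strict k q)))

∈-extensions⁻ : ∀ {μ n ƛ} → ƛ ∈ extensions μ n → IsStrictPartition ƛ × sum ƛ ≡ sum μ ℕ.+ n × ƛ ⊇ μ
∈-extensions⁻ {μ} {n} m with ∈-filter⁻ (_⊇? μ) {xs = strictPartitions (sum μ ℕ.+ n)} m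
... | m′ , sup with ∈-filter⁻ (λ ps → sum ps ℕ.≟ sum μ ℕ.+ n) {xs = strictUpTo (sum μ ℕ.+ n)} m′
... | m″ , e = proj₁ (strictUpTo-strict (sum μ ℕ.+ n) m″) , e , sup

part-1≤sum : ∀ ps → part ps 1 ≤ sum ps
part-1≤sum []       = z≤n
part-1≤sum (p ∷ ps) = ℕ.m≤m+n p (sum ps)

⊇-antisym : ∀ {ps qs} → IsStrictPartition ps → IsStrictPartition qs → ps ⊇ qs → sum ps ≡ sum qs → ps
    ≡ qs
⊇-antisym {[]}     {[]}     _  _  _   _ = refl
⊇-antisym {p ∷ ps} {[]}     sp _  _   e = contradiction (ℕ.m+n≡0⇒m≡0 p e)
    (ℕ.>⇒≢ (strict-positive sp))
⊇-antisym {[]}     {q ∷ qs} _  sq sup _ = contradiction (strict-positive sq) (ℕ.≤⇒≯ (sup 1))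
⊇-antisym {p ∷ ps} {q ∷ qs} sp sq sup e = cong₂ _∷_ p≡q
    (⊇-antisym (strict-tail sp) (strict-tail sq) sup′ sums)
  where
  sup′ = ⊇-tail {p} {ps} {q} {qs} sup
  p≡q : p ≡ q
  p≡q = ℕ.≤-antisym (ℕ.+-cancelʳ-≤ (sum qs) p q
      (ℕ.≤-trans (ℕ.+-monoʳ-≤ p (sum-mono {ps} {qs} sup′)) (ℕ.≤-reflexive e))) (sup 1)
  sums : sum ps ≡ sum qs
  sums = ℕ.+-cancelˡ-≡ q (sum ps) (sum qs) (trans (cong (ℕ._+ sum ps) (sym p≡q)) e)

-- This makes the truncated subtraction in the exponent of `weight` exact.
excess-mono : ∀ {ps qs} → IsStrictPartition ps → IsStrictPartition qs → ps ⊇ qs →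
              sum qs ∸ length qs ≤ sum ps ∸ length ps
excess-mono {ps}     {[]}     _  _  _   = z≤n
excess-mono {[]}     {q ∷ qs} _  sq sup = contradiction (strict-positive sq) (ℕ.≤⇒≯ (sup 1))
excess-mono {zero ∷ ps} sp _ _ = contradiction (strict-positive sp) λ ()
excess-mono {suc p ∷ ps} {zero ∷ qs} _ sq _ = contradiction (strict-positive sq) λ ()
excess-mono {suc p ∷ ps} {suc q ∷ qs} sp sq sup
  rewrite ℕ.+-∸-assoc p (length≤sum ps (strict-tail sp)) | ℕ.+-∸-assoc q
      (length≤sum qs (strict-tail sq)) =
  ℕ.+-mono-≤ (ℕ.s≤s⁻¹ (sup 1))
      (excess-mono (strict-tail sp) (strict-tail sq) (⊇-tail {suc p} {ps} {suc q} {qs} sup))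

extensions-0 : ∀ {μ} → IsStrictPartition μ → extensions μ 0 ≡ [ μ ]
extensions-0 {μ} s = singleton
  (Unique.filter⁺ (_⊇? μ) (Unique.filter⁺ (λ ps → sum ps ℕ.≟ sum μ ℕ.+ 0)
      (strictUpTo-unique (sum μ ℕ.+ 0))))
  (∈-filter⁺ (_⊇? μ) (∈-filter⁺ (λ ps → sum ps ℕ.≟ sum μ ℕ.+ 0)
    (∈-strictUpTo (sum μ ℕ.+ 0) μ s (ℕ.≤-trans (part-1≤sum μ) (ℕ.m≤m+n (sum μ) 0)))
    (sym (ℕ.+-identityʳ (sum μ)))) (λ _ → ℕ.≤-refl))
  (λ m → let sƛ , e , sup = ∈-extensions⁻ {μ} {0} m in ⊇-antisym sƛ s sup (trans e (ℕ.+-identityʳ (sum μ))))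
  where
  singleton : ∀ {A : Set} {x : A} {xs} → Unique xs → x ∈ xs → (∀ {y} → y ∈ xs → y ≡ x) → xs ≡ [ x ]
  singleton {xs = y ∷ []}     _             _ all = cong [_] (all (here refl))
  singleton {xs = y ∷ z ∷ zs} ((y≢z ∷ _) ∷ _) _ all =
    contradiction (trans (all (here refl)) (sym (all (there (here refl))))) y≢z

f-refl : ∀ μ → f μ μ ≡ 1
f-refl μ = cong countStandard
    (List.filter-none (λ b → ¬? (b ∈? boxes μ)) (All.tabulate (λ m ne → ne m)))

-- Weights as growth probabilities

/-* : ∀ i n .{{_ : ℕ.NonZero n}} → i / n * ι n ≡ fromℤ i
/-* i (suc n) = trans (cong (i / suc n *_) (ι≡fromℤ (suc n))) (ℚ.toℚᵘ-injective (begin-equality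
  toℚᵘ (i / suc n * (+ suc n / 1))                     ≃⟨ ℚ.toℚᵘ-homo-* (i / suc n) (+ suc n / 1) ⟩
  toℚᵘ (i / suc n) ℚᵘ.* toℚᵘ (+ suc n / 1)
    ≃⟨ ℚᵘ.*-cong (ℚ.toℚᵘ-fromℚᵘ (ℚᵘ.mkℚᵘ i n)) (ℚ.toℚᵘ-fromℚᵘ (ℚᵘ.mkℚᵘ (+ suc n) 0)) ⟩
  ℚᵘ.mkℚᵘ i n ℚᵘ.* ℚᵘ.mkℚᵘ (+ suc n) 0
    ≃⟨ ℚᵘ.*≡* (trans (ℤ.*-identityʳ (i ℤ.* + suc n))
         (cong (λ z → i ℤ.* + suc z) (sym (ℕ.*-identityʳ n)))) ⟩
  ℚᵘ.mkℚᵘ i 0                                          ≃⟨ ℚ.toℚᵘ-fromℚᵘ (ℚᵘ.mkℚᵘ i 0) ⟨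
  toℚᵘ (fromℤ i)                                       ∎))
  where open ℚᵘ.≤-Reasoning

ι-H≢0 : ∀ ps → ι (H ps) ≢ 0ℚ
ι-H≢0 ps = ι≢0 (H ps) {{H-nonZero ps}}

ρ≢0 : ∀ {ps} → IsStrictPartition ps → ρ ps ≢ 0ℚ
ρ≢0 {ps} s e = ι≢0 (2 ^ (sum ps ∸ length ps)) {{ℕ.m^n≢0 2 (sum ps ∸ length ps)}}
  (trans (sym (ρ-hook ps s)) (trans (cong (_* ι (H ps)) e) (ℚ.*-zeroˡ (ι (H ps)))))

-- The weight is the probability of reaching λ from μ: f λ/μ paths, each of probability ρ λ / ρ μ.
weight-ρ : ∀ {μ ƛ} → IsStrictPartition μ → IsStrictPartition ƛ → ƛ ⊇ μ →
           ρ μ * weight μ ƛ ≡ ι (f ƛ μ) * ρ ƛ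
weight-ρ {μ} {ƛ} sμ sƛ sup = *-cancelˡ (ι (H ƛ)) (ι-H≢0 ƛ) (begin
  ι (H ƛ) * (ρ μ * weight μ ƛ)
    ≡⟨ solve 3 (λ h r w → h :* (r :* w) := r :* (w :* h)) refl (ι (H ƛ)) (ρ μ) (weight μ ƛ) ⟩
  ρ μ * (weight μ ƛ * ι (H ƛ))
    ≡⟨ cong (ρ μ *_) (trans (/-* (+ (2 ^ e ℕ.* f ƛ μ ℕ.* H μ)) (H ƛ) {{H-nonZero ƛ}})
         (sym (ι≡fromℤ (2 ^ e ℕ.* f ƛ μ ℕ.* H μ)))) ⟩
  ρ μ * ι (2 ^ e ℕ.* f ƛ μ ℕ.* H μ)
    ≡⟨ cong (ρ μ *_) (trans (ι-* (2 ^ e ℕ.* f ƛ μ) (H μ))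
         (cong (_* ι (H μ)) (ι-* (2 ^ e) (f ƛ μ)))) ⟩
  ρ μ * (ι (2 ^ e) * ι (f ƛ μ) * ι (H μ))
    ≡⟨ solve 4 (λ r t f h → r :* (t :* f :* h) := f :* (t :* (r :* h))) refl (ρ μ) (ι (2 ^ e))
         (ι (f ƛ μ)) (ι (H μ)) ⟩
  ι (f ƛ μ) * (ι (2 ^ e) * (ρ μ * ι (H μ)))
    ≡⟨ cong (λ z → ι (f ƛ μ) * (ι (2 ^ e) * z)) (ρ-hook μ sμ) ⟩
  ι (f ƛ μ) * (ι (2 ^ e) * ι (2 ^ b))
    ≡⟨ cong (ι (f ƛ μ) *_) (trans (sym (ι-* (2 ^ e) (2 ^ b)))
         (cong ι (trans (sym (ℕ.^-distribˡ-+-* 2 e b)) (cong (2 ^_) e+b≡a)))) ⟩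
  ι (f ƛ μ) * ι (2 ^ a)
    ≡⟨ cong (ι (f ƛ μ) *_) (ρ-hook ƛ sƛ) ⟨
  ι (f ƛ μ) * (ρ ƛ * ι (H ƛ))
    ≡⟨ solve 3 (λ f r h → f :* (r :* h) := h :* (f :* r)) refl (ι (f ƛ μ)) (ρ ƛ) (ι (H ƛ)) ⟩
  ι (H ƛ) * (ι (f ƛ μ) * ρ ƛ) ∎)
  where
  open ≡-Reasoning
  e = (sum ƛ ℕ.+ length μ) ∸ (length ƛ ℕ.+ sum μ)
  a = sum ƛ ∸ length ƛ
  b = sum μ ∸ length μ
  e+b≡a : e ℕ.+ b ≡ a
  e+b≡a = begin
    (sum ƛ ℕ.+ length μ) ∸ (length ƛ ℕ.+ sum μ) ℕ.+ b
      ≡⟨ cong₂ (λ x y → (x ℕ.+ length μ) ∸ (length ƛ ℕ.+ y) ℕ.+ b)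
           (ℕ.m+[n∸m]≡n (length≤sum ƛ sƛ)) (ℕ.m∸n+n≡m (length≤sum μ sμ)) ⟨
    (length ƛ ℕ.+ a ℕ.+ length μ) ∸ (length ƛ ℕ.+ (b ℕ.+ length μ)) ℕ.+ b
      ≡⟨ cong (λ x → x ∸ (length ƛ ℕ.+ (b ℕ.+ length μ)) ℕ.+ b)
           (ℕ.+-assoc (length ƛ) a (length μ)) ⟩
    (length ƛ ℕ.+ (a ℕ.+ length μ)) ∸ (length ƛ ℕ.+ (b ℕ.+ length μ)) ℕ.+ b
      ≡⟨ cong (ℕ._+ b) (trans (ℕ.[m+n]∸[m+o]≡n∸o (length ƛ) _ _) (trans
           (cong₂ _∸_ (ℕ.+-comm a (length μ)) (ℕ.+-comm b (length μ)))
               (ℕ.[m+n]∸[m+o]≡n∸o (length μ) a b))) ⟩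
    a ∸ b ℕ.+ b
      ≡⟨ ℕ.m∸n+n≡m (excess-mono sƛ sμ sup) ⟩
    a ∎

-- An indicator. It makes the range of an inner sum independent of the outer index, so that the two
-- sums can be interchanged.
keep : {P : Set} → Dec P → ℚ → ℚ
keep (yes _) q = q
keep (no _)  q = 0ℚ

keep-* : ∀ {P : Set} (P? : Dec P) q r → keep P? q * r ≡ keep P? (q * r)
keep-* (yes _) q r = refl
keep-* (no _)  q r = ℚ.*-zeroˡ r

∑-filter : ∀ {A : Set} {P : A → Set} (P? : Decidable P) xs {g : A → ℚ} →
           ∑ (filter P? xs) g ≡ ∑[ x ∈ xs ] keep (P? x) (g x)
∑-filter P? []           = refl
∑-filter P? (x ∷ xs) {g} with P? x
... | yes _ = cong (λ z → g x + z) (∑-filter P? xs)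
... | no _  = trans (∑-filter P? xs) (sym (ℚ.+-identityˡ _))

ι-sum : ∀ {A : Set} (xs : List A) {g : A → ℕ} → ι (sum (map g xs)) ≡ ∑[ x ∈ xs ] ι (g x)
ι-sum []           = ι-0
ι-sum (x ∷ xs) {g} = trans (ι-+ (g x) (sum (map g xs))) (cong (λ z → ι (g x) + z) (ι-sum xs))

strictGrow : List ℕ → List (Box × List ℕ)
strictGrow μ = filter (λ bν → isStrictPartition? (proj₂ bν)) (growBox μ)

∈-strictGrow⁻ : ∀ μ {bν} → bν ∈ strictGrow μ → bν ∈ growBox μ × IsStrictPartition (proj₂ bν)
∈-strictGrow⁻ μ = ∈-filter⁻ (λ bν → isStrictPartition? (proj₂ bν)) {xs = growBox μ}

growBox⇒grow : ∀ {μ b ν} → (b , ν) ∈ growBox μ → ∃ λ a → (a , ν) ∈ grow μ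
growBox⇒grow {[]}     (here refl) = 0 , here refl
growBox⇒grow {p ∷ ps} (here refl) = p , here refl
growBox⇒grow {p ∷ ps} (there m) with ∈-map⁻ (×-map shift (p ∷_)) m
... | _ , m′ , refl = map₂ (there ∘ ∈-map⁺ (map₂ (p ∷_))) (growBox⇒grow m′)

growBox-sum : ∀ {μ b ν} → (b , ν) ∈ growBox μ → sum ν ≡ suc (sum μ)
growBox-sum m = sum-grow (proj₂ (growBox⇒grow m))

growBox-strict : ∀ {μ b ν} → IsStrictPartition μ → (b , ν) ∈ growBox μ → ¬ IsStrictPartition ν → ρ ν
    ≡ 0ℚ
growBox-strict s m ¬sν with grow-strict s (proj₂ (growBox⇒grow m))
... | inj₁ sν  = contradiction sν ¬sν
... | inj₂ ρ≡0 = ρ≡0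

-- The left side times `ρ μ`, with content sums measured from a fixed `c` that survives the passage
-- from μ to a larger partition.
extensionSum : List ℕ → ℕ → ℚ → ℚ
extensionSum μ n c = ∑[ ƛ ∈ extensions μ n ] (ι (f ƛ μ) * (ρ ƛ * (ι (contentSum ƛ) - c)))

f-strictGrow : ∀ {μ ƛ} → IsStrictPartition μ → IsStrictPartition ƛ → ƛ ⊇ μ → sum μ < sum ƛ →
               ι (f ƛ μ) ≡ ∑[ bν ∈ strictGrow μ ] keep (ƛ ⊇? proj₂ bν) (ι (f ƛ (proj₂ bν)))
f-strictGrow {μ} {ƛ} s sƛ sup lt =
  trans (cong ι (f-grow sƛ s sup lt))
  (trans (ι-sum (filter adm? (growBox μ)) {h})
  (trans (cong (λ L → ∑ L (ι ∘ h))
      (sym (filter-filter inside? strict? adm? (λ (p , q) → q , p) (λ q p → p , q) (growBox μ))))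
         (∑-filter inside? (strictGrow μ) {ι ∘ h})))
  where
  h : Box × List ℕ → ℕ
  h bν = f ƛ (proj₂ bν)
  adm? = admissible? sƛ s sup
  inside? : Decidable (λ (bν : Box × List ℕ) → ƛ ⊇ proj₂ bν)
  inside? bν = ƛ ⊇? proj₂ bν
  strict? : Decidable (λ (bν : Box × List ℕ) → IsStrictPartition (proj₂ bν))
  strict? bν = isStrictPartition? (proj₂ bν)

-- Containing ν implies containing μ, and ν has one box more.
extensions-grow : ∀ {μ b ν} n → (b , ν) ∈ growBox μ → filter (_⊇? ν) (extensions μ (suc n)) ≡
    extensions ν n
extensions-grow {μ} {b} {ν} n m = trans
  (filter-filter (_⊇? ν) (_⊇? μ) (_⊇? ν) (λ {ƛ} sup → sup , λ i → ℕ.≤-trans (ν⊇μ i) (sup i))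
      (λ sup _ → sup)
    (strictPartitions (sum μ ℕ.+ suc n)))
  (cong (filter (_⊇? ν) ∘ strictPartitions)
      (trans (ℕ.+-suc (sum μ) n) (cong (ℕ._+ n) (sym (growBox-sum m)))))
  where
  ν⊇μ : ν ⊇ μ
  ν⊇μ = ⊆⇒⊇ {ν} {μ} (growBox-⊆ m)

-- Conditioning on the first step: f λ/μ is split by the box of the least entry, and the sums over λ
-- and ν are interchanged.
extensionSum-suc : ∀ {μ} → IsStrictPartition μ → ∀ n c →
  extensionSum μ (suc n) c ≡ ∑[ bν ∈ strictGrow μ ] extensionSum (proj₂ bν) n c
extensionSum-suc {μ} s n c = begin
  ∑[ ƛ ∈ E ] (ι (f ƛ μ) * w ƛ)
    ≡⟨ ∑-cong E (λ {ƛ} m → trans (cong (_* w ƛ) (split m)) (inside ƛ)) ⟩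
  ∑[ ƛ ∈ E ] ∑[ bν ∈ S ] keep (ƛ ⊇? proj₂ bν) (ι (f ƛ (proj₂ bν)) * w ƛ)
    ≡⟨ ∑-swap E S ⟩
  ∑[ bν ∈ S ] ∑[ ƛ ∈ E ] keep (ƛ ⊇? proj₂ bν) (ι (f ƛ (proj₂ bν)) * w ƛ)
    ≡⟨ ∑-cong S (λ {bν} m → trans (sym (∑-filter (_⊇? proj₂ bν) E))
         (cong (λ L → ∑[ ƛ ∈ L ] (ι (f ƛ (proj₂ bν)) * w ƛ))
             (extensions-grow n (proj₁ (∈-strictGrow⁻ μ m))))) ⟩
  ∑[ bν ∈ S ] extensionSum (proj₂ bν) n c ∎
  where
  open ≡-Reasoning
  E = extensions μ (suc n)
  S = strictGrow μ
  w : List ℕ → ℚ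
  w ƛ = ρ ƛ * (ι (contentSum ƛ) - c)
  split : ∀ {ƛ} → ƛ ∈ E → ι (f ƛ μ) ≡ ∑[ bν ∈ S ] keep (ƛ ⊇? proj₂ bν) (ι (f ƛ (proj₂ bν)))
  split m = let sƛ , e , sup = ∈-extensions⁻ {μ} {suc n} m in
    f-strictGrow s sƛ sup (subst (sum μ <_) (sym e) (ℕ.m<m+n (sum μ) (s≤s z≤n)))
  inside : ∀ ƛ → ∑[ bν ∈ S ] keep (ƛ ⊇? proj₂ bν) (ι (f ƛ (proj₂ bν))) * w ƛ ≡
           ∑[ bν ∈ S ] keep (ƛ ⊇? proj₂ bν) (ι (f ƛ (proj₂ bν)) * w ƛ)
  inside ƛ = trans (ℚ.*-comm _ (w ƛ)) (trans (sym (∑-*ˡ (w ƛ) S)) (∑-cong S (λ {bν} _ →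
    trans (ℚ.*-comm (w ƛ) _) (keep-* (ƛ ⊇? proj₂ bν) (ι (f ƛ (proj₂ bν))) (w ƛ)))))

extensionSum-value : ∀ n {μ} → IsStrictPartition μ → ∀ c →
  extensionSum μ n c ≡ ρ μ * (ι (contentSum μ) - c + value n (ι (sum μ)) (cubes μ))
extensionSum-value zero {μ} s c = begin
  extensionSum μ 0 c
    ≡⟨ cong (λ L → ∑[ ƛ ∈ L ] (ι (f ƛ μ) * (ρ ƛ * (ι (contentSum ƛ) - c)))) (extensions-0 s) ⟩
  ι (f μ μ) * (ρ μ * d) + 0ℚ
    ≡⟨ cong (λ z → z * (ρ μ * d) + 0ℚ) (trans (cong ι (f-refl μ)) ι-1) ⟩
  1ℚ * (ρ μ * d) + 0ℚ
    ≡⟨ solve 4 (λ r d s q → con 1ℚ :* (r :* d) :+ con 0ℚ :=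
         r :* (d :+ (con (+ 2 / 3) :* con 0ℚ :+ con (+ 2 / 3) :* s :* con 0ℚ :+ con (+ 1 / 12) :*
             (q :+ s :* s :- con 2ℚ :* s) :* con 0ℚ)))
         refl (ρ μ) d (ι (sum μ)) (cubes μ) ⟩
  ρ μ * (d + (+ 2 / 3 * 0ℚ + + 2 / 3 * ι (sum μ) * 0ℚ + + 1 / 12 *
      (cubes μ + ι (sum μ) * ι (sum μ) - 2ℚ * ι (sum μ)) * 0ℚ))
    ≡⟨ cong (λ z → ρ μ * (d + (+ 2 / 3 * z + + 2 / 3 * ι (sum μ) * z + + 1 / 12 *
         (cubes μ + ι (sum μ) * ι (sum μ) - 2ℚ * ι (sum μ)) * z))) ι-0 ⟨
  ρ μ * (d + value 0 (ι (sum μ)) (cubes μ)) ∎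
  where
  open ≡-Reasoning
  d = ι (contentSum μ) - c
extensionSum-value (suc n) {μ} s c = begin
  extensionSum μ (suc n) c
    ≡⟨ extensionSum-suc s n c ⟩
  ∑[ bν ∈ strictGrow μ ] extensionSum (proj₂ bν) n c
    ≡⟨ ∑-cong (strictGrow μ) (λ m → extensionSum-value n (proj₂ (∈-strictGrow⁻ μ m)) c) ⟩
  ∑[ bν ∈ strictGrow μ ] v (proj₂ bν)
    ≡⟨ ∑-filter (λ bν → isStrictPartition? (proj₂ bν)) (growBox μ) ⟩
  ∑[ bν ∈ growBox μ ] keep (isStrictPartition? (proj₂ bν)) (v (proj₂ bν))
    -- The growths that are not strict return with value 0, since `grow-value` averages over all of
    -- them.
    ≡⟨ ∑-cong (growBox μ) drop ⟩
  ∑[ bν ∈ growBox μ ] v (proj₂ bν)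
    ≡⟨ ∑-map proj₂ (growBox μ) ⟨
  ∑ (map proj₂ (growBox μ)) v
    ≡⟨ cong (λ L → ∑ L v) (growBox-grow μ) ⟩
  ∑ (map proj₂ (grow μ)) v
    ≡⟨ ∑-map proj₂ (grow μ) ⟩
  ∑[ aν ∈ grow μ ] v (proj₂ aν)
    ≡⟨ grow-value s n c ⟩
  ρ μ * (ι (contentSum μ) - c + value (suc n) (ι (sum μ)) (cubes μ)) ∎
  where
  open ≡-Reasoning
  v : List ℕ → ℚ
  v ν = ρ ν * (ι (contentSum ν) - c + value n (ι (sum ν)) (cubes ν))
  drop : ∀ {bν} → bν ∈ growBox μ → keep (isStrictPartition? (proj₂ bν)) (v (proj₂ bν)) ≡ v
      (proj₂ bν)
  drop {b , ν} m with isStrictPartition? ν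
  ... | yes _  = refl
  ... | no ¬sν = sym (trans (cong (_* k) (growBox-strict s m ¬sν)) (ℚ.*-zeroˡ k))
    where k = ι (contentSum ν) - c + value n (ι (sum ν)) (cubes ν)

-- Return to integer coefficients and to the weights

linearCoefficient : ∀ {μ} → IsStrictPartition μ →
  fromℤ (q₂ μ ℤ.+ + (sum μ ^ 2) ℤ.- + 2 ℤ.* + sum μ) ≡ cubes μ + ι (sum μ) * ι (sum μ) - 2ℚ * ι
      (sum μ)
linearCoefficient {μ} s = begin
  fromℤ (q₂ μ ℤ.+ + (sum μ ^ 2) ℤ.- + 2 ℤ.* + sum μ)
    ≡⟨ fromℤ-- (q₂ μ ℤ.+ + (sum μ ^ 2)) (+ 2 ℤ.* + sum μ) ⟩
  fromℤ (q₂ μ ℤ.+ + (sum μ ^ 2)) - fromℤ (+ 2 ℤ.* + sum μ)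
    ≡⟨ cong₂ _-_ (fromℤ-+ (q₂ μ) (+ (sum μ ^ 2))) (fromℤ-* (+ 2) (+ sum μ)) ⟩
  fromℤ (q₂ μ) + fromℤ (+ (sum μ ^ 2)) - 2ℚ * fromℤ (+ sum μ)
    ≡⟨ cong₂ (λ x y → x - 2ℚ * y) (cong₂ _+_ (fromℤ-q₂ s) square) (sym (ι≡fromℤ (sum μ))) ⟩
  cubes μ + ι (sum μ) * ι (sum μ) - 2ℚ * ι (sum μ) ∎
  where
  open ≡-Reasoning
  square : fromℤ (+ (sum μ ^ 2)) ≡ ι (sum μ) * ι (sum μ)
  square = trans (sym (ι≡fromℤ (sum μ ^ 2)))
    (trans (cong (λ z → ι (sum μ ℕ.* z)) (ℕ.*-identityʳ (sum μ))) (ι-* (sum μ) (sum μ)))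

weighted-term : ∀ {μ n ƛ} → IsStrictPartition μ → ƛ ∈ extensions μ n →
  ρ μ * (weight μ ƛ * fromℤ (+ contentSum ƛ ℤ.- + contentSum μ)) ≡
  ι (f ƛ μ) * (ρ ƛ * (ι (contentSum ƛ) - ι (contentSum μ)))
weighted-term {μ} {n} {ƛ} s m =
  let sƛ , _ , sup = ∈-extensions⁻ {μ} {n} m in
  reassociate (ρ μ) (weight μ ƛ) (fromℤ (+ contentSum ƛ ℤ.- + contentSum μ)) (ι (f ƛ μ)) (ρ ƛ)
      (ι (contentSum ƛ) - ι (contentSum μ))
    (weight-ρ {μ} {ƛ} s sƛ sup) difference
  where
  reassociate : ∀ a b c x y z → a * b ≡ x * y → c ≡ z → a * (b * c) ≡ x * (y * z)
  reassociate a b c x y z e refl = trans (sym (ℚ.*-assoc a b c))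
      (trans (cong (_* c) e) (ℚ.*-assoc x y c))
  difference : fromℤ (+ contentSum ƛ ℤ.- + contentSum μ) ≡ ι (contentSum ƛ) - ι (contentSum μ)
  difference = trans (fromℤ-- (+ contentSum ƛ) (+ contentSum μ))
    (cong₂ _-_ (sym (ι≡fromℤ (contentSum ƛ))) (sym (ι≡fromℤ (contentSum μ))))

theorem4p3 : (μ : List ℕ) → IsStrictPartition μ → (n : ℕ) →
    Σℚ (map (λ ƛ → weight μ ƛ * fromℤ (+ contentSum ƛ ℤ.- + contentSum μ)) (extensions μ n))
    ≡ + 2 / 3 * fromℤ (+ (n C 3))
    + + 2 / 3 * fromℤ (+ sum μ) * fromℤ (+ (n C 2))
    + + 1 / 12 * fromℤ (q₂ μ ℤ.+ + (sum μ ^ 2) ℤ.- + 2 ℤ.* + sum μ) * fromℤ (+ n)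
theorem4p3 μ s n = trans
  -- Times `ρ μ`, which is not zero, the left side is `extensionSum μ n c` for `c` the content sum
  -- of μ itself, so the difference of contents in front of `value` is zero.
  (*-cancelˡ (ρ μ) {Σℚ (map t E)} {v} (ρ≢0 s)
    (trans (sym (∑-*ˡ (ρ μ) E {t}))
    (trans (∑-cong E {λ ƛ → ρ μ * t ƛ} {u} (weighted-term {μ} {n} s))
    (trans (extensionSum-value n s c) (cong (ρ μ *_) (cancel c v))))))
  (assemble (ι≡fromℤ (n C 3)) (ι≡fromℤ (sum μ)) (ι≡fromℤ (n C 2)) (sym (linearCoefficient s)) (ι≡fromℤ n))
  where
  E = extensions μ n
  c = ι (contentSum μ)
  v = value n (ι (sum μ)) (cubes μ)
  t u : List ℕ → ℚ
  t ƛ = weight μ ƛ * fromℤ (+ contentSum ƛ ℤ.- + contentSum μ)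
  u ƛ = ι (f ƛ μ) * (ρ ƛ * (ι (contentSum ƛ) - c))
  cancel : ∀ x y → x - x + y ≡ y
  cancel = solve 2 (λ x y → x :- x :+ y := y) refl
  assemble : ∀ {a a′ b b′ c c′ d d′ e e′ : ℚ} → a ≡ a′ → b ≡ b′ → c ≡ c′ → d ≡ d′ → e ≡ e′ →
    + 2 / 3 * a + + 2 / 3 * b * c + + 1 / 12 * d * e ≡ + 2 / 3 * a′ + + 2 / 3 * b′ * c′ + + 1 / 12 * d′ * e′
  assemble refl refl refl refl refl = refl
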